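{- Let $(M,\nu,\mathfrak{e})$, $(\mathscr{O},\eta,e)$, $\tau$ form a $c$-monop, and let $P_{(M,\mathscr O)}[n]$ denote the associated poset on $(M\cdot E(\mathscr O))[\{1,\dots,n\}]$. Define, for $0\leq k\leq n$, $C_{n,k}=|M\cdot\gamma_k(\mathscr{O})[n]|$ and $\widehat C_{n,k}=|M\cdot\gamma_k(\mathscr{O})[n]|_\mu$. Then the infinite lower triangular matrices $(C_{n,k})$ and $(\widehat C_{n,k})$ are inverse to each other: $\sum_{k=j}^{n}C_{n,k}\widehat C_{k,j}=\delta_{n,j}$ for all $0\le j\le n$. Equivalently, $(C_{n,k})$ is the Riordan array of the Riordan pair $(M(x),\mathscr{O}(x))$ and $(\widehat C_{n,k})$ is the Riordan array of its inverse pair $(M(x),\mathscr{O}(x))^{ -1}=\big(1/M(\mathscr O^{\langle-1\rangle}(x)),\mathscr O^{\langle-1\rangle}(x)\big)$.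
   Context: Species are functors from finite sets with bijections to finite sets; positive means $F[\emptyset]=\emptyset$; sums are disjoint unions; $[n]=\{1,\dots,n\}$. Product $(M\cdot N)[V]=\sum_{V_1+V_2=V}M[V_1]\times N[V_2]$. For positive $P$, $R(P)[V]=\sum_\pi(\prod_{B\in\pi}P[B])\times R[\pi]$ over partitions $\pi$ of $V$; elements are pairs $(a,r)$ with $a=\{p_B\}_{B\in\pi}$ an assembly of $P$-structures. $E(P)[V]$ is the set of all assemblies of $P$-structures on $V$; $\gamma_k(P)[V]$ those with exactly $k$ members; $|a|$ is the number of members. $M\cdot\gamma_k(\mathscr O)[n]\subseteq (M\cdot E(\mathscr O))[n]$ is the set of pairs $(m,a)$ with $|a|=k$. For a subset $A$ of a poset with least element $\hat0$, $|A|_\mu=\sum_{x\in A}\mu(\hat0,x)$, $\mu$ the Möbius function. Exponential generating series $F(x)=\sum_n|F[n]|x^n/n!$; for a series $H$, $H[n]$ denotes $n!$ times the coefficient of $x^n$. The Riordan array of a pair $(F,G)$ with $F(0)\neq0$, $G(0)=0$, $G'(0)\ne0$ is the matrix with entries $\big(F(x)\,G(x)^k/k!\big)[n]$; $G^{\langle-1\rangle}$ is the compositional inverse. Monoid $(M,\nu,\mathfrak e)$: $\nu:M\cdot M\to M$ associative with two-sided unit $\mathfrak e\in M[\emptyset]$. Operad $(\mathscr O,\eta,e)$: $\mathscr O$ positive, $\eta:\mathscr O(\mathscr O)\to\mathscr O$, $e_v\in\mathscr O[\{v\}]$; for an assembly $a=\{\omega_C\}_{C\in\pi}$ on $V$ and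 an assembly $b=\{w_D\}_{D\in\sigma}$ on the set $\pi$, $\bar\eta(a,b)=\{\eta(\{\omega_C\}_{C\in D},w_D)\}_{D\in\sigma}$; axioms $\eta(\bar\eta(a,b),\omega)=\eta(a,\eta(b,\omega))$, $\eta(\{e_v\}_{v\in V},\omega)=\omega=\eta(\{\omega\},e_V)$. Right module: $\tau:M(\mathscr O)\to M$ with $\tau(\bar\eta(a,b),m)=\tau(a,\tau(b,m))$ and $\tau(\{e_v\}_{v\in V},m)=m$. Compatibility: $\nu(\tau(a_1,m_1),\tau(a_2,m_2))=\tau(a_1\sqcup a_2,\nu(m_1,m_2))$ for disjoint supports. A $c$-monop is such data with in addition: $|M[\emptyset]|=1$; $\nu(m_1,m_2)=\nu(m_1,m_2')\Rightarrow m_2=m_2'$; $|\mathscr O[\{v\}]|=1$ for every singleton; $\eta(a,\omega)=\eta(a,\omega')\Rightarrow\omega=\omega'$; $\tau(a,m)=\tau(a,m')\Rightarrow m=m'$. Poset $P_{(M,\mathscr O)}[V]$: underlying set $(M\cdot E(\mathscr O))[V]$; for $(m_1,a_1)$ with $a_1$ of underlying partition $\pi$ and $(m_2',a_2')\in M[\pi_1]\times E(\mathscr O)[\pi_2]$, $\pi=\pi_1+\pi_2$, with $a_1^{(i)}$ the subassembly of $a_1$ over $\pi_i$, put $\bar\rho((m_1,a_1),(m_2',a_2'))=(\nu(m_1,\tau(a_1^{(1)},m_2')),\bar\eta(a_1^{(2)},a_2'))$; $(m_1,a_1)\leq(m_2,a_2)$ iff $(m_2,a_2)=\bar\rho((m_1,a_1),(m_2',a_2'))$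 for some such $(m_2',a_2')$. Its least element is $\hat0=(\mathfrak e,\{e_v\}_{v\in V})$. -}

module Defs where

-- ============================================================================
-- Conventions.
--
-- * A species F is given by its values F n on the canonical sets [n] = Fin n,
--   with an action of the maps Fin n → Fin n (only the action of the
--   bijections is constrained by laws).  A structure on an arbitrary finite
--   *ordered* set V (here always a subset of some Fin n ordered as a subset
--   of ℕ, or a set of blocks ordered by the minima of the blocks) is an
--   element of F |V| (transport along the unique order-preserving bijection
--   V ≅ Fin |V|).  Every finite set with bijections is equivalent to this
--   skeleton, so this is the standard faithful encoding of species.
--
-- * A subset of Fin n is a vector  s : Vec Bool n ;  a decomposition
--   V = V₁ + V₂ is a subset s (V₁ = trues, V₂ = falses).
--
-- * An assembly of P-structures on Fin n with k members is stored
--   canonically: the partition is a restricted-growth word  blk : Vec ℕ n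
--   (blocks numbered 0..k-1 in increasing order of their minima), and
--   ps : Vec (Σ ℕ P) k lists, for each block j, its size together with a
--   P-structure on it.  Validity (RGF + correct sizes) is a Bool check,
--   hence a proposition.  The set π of blocks is thereby identified with
--   Fin k ordered by minima of blocks.
--
-- * Operations that mathematically always succeed but whose well-typedness
--   needs arithmetic facts (e.g. |V₁| computed in two ways) are computed
--   with decidable checks and return  Maybe ;  laws are stated for every
--   successful result (equivalently: unconditionally, since the checks
--   succeed), and  ∀ (e : a ≡ b) → …  is used to transport along true
--   numerical identities (ℕ-equalities are propositions).
-- ============================================================================

open import Data.Nat as ℕ using (ℕ; zero; suc; _+_; _∸_; _<?_; _≡ᵇ_; _<ᵇ_)
open import Data.Fin as Fin using (Fin; toℕ; fromℕ<)
open import Data.Bool as B using (Bool; true; false; T; not; _∧_; if_then_else_)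
open import Data.Vec as Vec using (Vec; []; _∷_)
open import Data.List as List using (List; []; _∷_; _++_)
open import Data.List.Membership.Propositional using (_∈_)
open import Data.List.Relation.Unary.Unique.Propositional using (Unique)
open import Data.Maybe using (Maybe; just; nothing; _>>=_)
open import Data.Product using (Σ; _×_; _,_; proj₁; proj₂; ∃)
open import Data.Empty using (⊥)
open import Relation.Binary.PropositionalEquality using (_≡_; refl; subst)
open import Relation.Binary.Definitions using (DecidableEquality)
open import Relation.Nullary using (Dec; yes; no; ¬_; does)
open import Relation.Nullary.Decidable using (T?)
open import Function.Bundles using (_↔_)
open import Data.Integer as ℤ using (ℤ; 0ℤ; 1ℤ)
open import Data.Rational as ℚ using (ℚ; 0ℚ; 1ℚ)
open import Data.Nat.Properties using (_!≢0)
open import Data.Nat.Base using () renaming (_! to fact)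

eqB : Bool → Bool → Bool
eqB true  true  = true
eqB false false = true
eqB true  false = false
eqB false true  = false

cnt : Bool → ∀ {n} → Vec Bool n → ℕ
cnt b [] = 0
cnt b (x ∷ xs) = if eqB b x then suc (cnt b xs) else cnt b xs

sel : ∀ {A : Set} (b : Bool) {n} (s : Vec Bool n) → Vec A n → Vec A (cnt b s)
sel b [] [] = []
sel b (x ∷ s) (a ∷ as) with eqB b x
... | true  = a ∷ sel b s as
... | false = sel b s as

rankIn : Bool → ∀ {n} → Vec Bool n → ℕ → ℕ
rankIn b [] x = 0
rankIn b (y ∷ s) zero = 0
rankIn b (y ∷ s) (suc x) = (if eqB b y then 1 else 0) + rankIn b s x

embℕ : Bool → ∀ {n} → Vec Bool n → ℕ → ℕ
embℕ b [] r = 0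
embℕ b (y ∷ s) r with eqB b y | r
... | true  | zero   = 0
... | true  | suc r' = suc (embℕ b s r')
... | false | r'     = suc (embℕ b s r')

toFinOr : ∀ {k} → ℕ → Fin k → Fin k
toFinOr {k} x i with x <? k
... | yes p = fromℕ< p
... | no _  = i

liftℕ : ∀ {m} → (Fin m → Fin m) → ℕ → ℕ
liftℕ {m} σ x with x <? m
... | yes p = toℕ (σ (fromℕ< p))
... | no _  = x

invℕ : ∀ {m} → (Fin m → Fin m) → ℕ → ℕ
invℕ {m} σ j = go (List.allFin m)
  where
  go : List (Fin m) → ℕ
  go [] = j
  go (i ∷ is) = if toℕ (σ i) ≡ᵇ j then toℕ i else go is

lookupOr : ∀ {A : Set} {n} → A → Vec A n → ℕ → A
lookupOr d [] _ = d
lookupOr d (x ∷ xs) zero = x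
lookupOr d (x ∷ xs) (suc i) = lookupOr d xs i

lookupM : ∀ {A : Set} {n} → Vec A n → ℕ → Maybe A
lookupM [] _ = nothing
lookupM (x ∷ xs) zero = just x
lookupM (x ∷ xs) (suc i) = lookupM xs i

lookupL : ∀ {A : Set} → A → List A → ℕ → A
lookupL d [] _ = d
lookupL d (x ∷ xs) zero = x
lookupL d (x ∷ xs) (suc i) = lookupL d xs i

indexOf : ℕ → List ℕ → Maybe ℕ
indexOf x [] = nothing
indexOf x (y ∷ ys) = if x ≡ᵇ y then just 0 else go (indexOf x ys)
  where
  go : Maybe ℕ → Maybe ℕ
  go (just i) = just (suc i)
  go nothing  = nothing

indexOr : ℕ → List ℕ → ℕ
indexOr x ys with indexOf x ys
... | just i  = i
... | nothing = List.length ys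

seqM : ∀ {A : Set} → List (Maybe A) → Maybe (List A)
seqM [] = just []
seqM (nothing ∷ _) = nothing
seqM (just x ∷ xs) with seqM xs
... | just ys = just (x ∷ ys)
... | nothing = nothing

castM : (A : ℕ → Set) {m : ℕ} (n : ℕ) → A m → Maybe (A n)
castM A {m} n x with m ℕ.≟ n
... | yes p = just (subst A p x)
... | no _  = nothing

filterB : ∀ {A : Set} → (A → Bool) → List A → List A
filterB p [] = []
filterB p (x ∷ xs) = if p x then x ∷ filterB p xs else filterB p xs

-- canonical renumbering of block labels by order of first appearance:
-- returns the restricted growth word and the list of old labels in new order
canonV : List ℕ → ∀ {n} → Vec ℕ n → Vec ℕ n × List ℕ
canonV seen [] = [] , seen
canonV seen (x ∷ xs) with indexOf x seen
... | just i  = let r = canonV seen xs in (i ∷ proj₁ r) , proj₂ r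
... | nothing = let r = canonV (seen ++ (x ∷ [])) xs
                in (List.length seen ∷ proj₁ r) , proj₂ r

canon : ∀ {n} → Vec ℕ n → Vec ℕ n × List ℕ
canon = canonV []

Injective′ : ∀ {n} → (Fin n → Fin n) → Set
Injective′ f = ∀ i j → f i ≡ f j → i ≡ j

record Species : Set₁ where
  field
    F      : ℕ → Set
    card   : ℕ → ℕ
    finite : ∀ n → F n ↔ Fin (card n)
    act    : ∀ {n} → (Fin n → Fin n) → F n → F n
    act-id : ∀ {n} (f : Fin n → Fin n) → (∀ i → f i ≡ i) → ∀ x → act f x ≡ x
    act-∘  : ∀ {n} (f g h : Fin n → Fin n) → Injective′ f → Injective′ g →
             (∀ i → h i ≡ f (g i)) → ∀ x → act h x ≡ act f (act g x)

Positive : Species → Set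
Positive S = Species.F S 0 → ⊥

countVal : ℕ → ∀ {n} → Vec ℕ n → ℕ
countVal j [] = 0
countVal j (x ∷ xs) = if x ≡ᵇ j then suc (countVal j xs) else countVal j xs

rgfOK : ℕ → ∀ {n} → Vec ℕ n → ℕ → Bool
rgfOK seen [] k = seen ≡ᵇ k
rgfOK seen (b ∷ bs) k =
  if b <ᵇ seen then rgfOK seen bs k
  else (if b ≡ᵇ seen then rgfOK (suc seen) bs k else false)

sizesOK : ∀ {P : ℕ → Set} {n k} → ℕ → Vec ℕ n → Vec (Σ ℕ P) k → Bool
sizesOK j blk [] = true
sizesOK j blk ((s , _) ∷ ps) = (s ≡ᵇ countVal j blk) ∧ sizesOK (suc j) blk ps

validAsm : ∀ {P : ℕ → Set} {n k} → Vec ℕ n → Vec (Σ ℕ P) k → Bool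
validAsm {k = k} blk ps = rgfOK 0 blk k ∧ sizesOK 0 blk ps

record Asm (P : ℕ → Set) (n k : ℕ) : Set where
  constructor asm
  field
    blk : Vec ℕ n
    ps  : Vec (Σ ℕ P) k
    ok  : T (validAsm blk ps)
open Asm public

E : (ℕ → Set) → ℕ → Set
E P n = Σ ℕ (Asm P n)

mkAsm : ∀ {P : ℕ → Set} {n k} → Vec ℕ n → Vec (Σ ℕ P) k → Maybe (Asm P n k)
mkAsm blk ps with T? (validAsm blk ps)
... | yes p = just (asm blk ps p)
... | no _  = nothing

mkAsmL : ∀ {P : ℕ → Set} {n} → Vec ℕ n → List (Σ ℕ P) → (k : ℕ) → Maybe (Asm P n k)
mkAsmL {P} blk l k = castM (λ z → Vec (Σ ℕ P) z) k (Vec.fromList l) >>= mkAsm blk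

blockVec : ∀ {P : ℕ → Set} {n k} → Asm P n k → ℕ → Vec Bool n
blockVec a c = Vec.map (λ b → b ≡ᵇ c) (blk a)

memSet : ∀ {P : ℕ → Set} {n k} → Asm P n k → Vec Bool k → Vec Bool n
memSet a t = Vec.map (lookupOr false t) (blk a)

restrict : ∀ {P : ℕ → Set} {n k} (b : Bool) (a : Asm P n k) (t : Vec Bool k) →
           Maybe (Asm P (cnt b (memSet a t)) (cnt b t))
restrict b a t =
  mkAsm (sel b (memSet a t) (Vec.map (rankIn b t) (blk a))) (sel b t (ps a))

disc : ∀ {P : ℕ → Set} → P 1 → (n : ℕ) → Maybe (Asm P n n)
disc e n = mkAsm (Vec.tabulate toℕ) (Vec.replicate n (1 , e))

single : ∀ {P : ℕ → Set} (n : ℕ) → P n → Maybe (Asm P n 1)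
single n ω = mkAsm (Vec.replicate n 0) ((n , ω) ∷ [])

etaBar : ∀ {O : ℕ → Set} (η : ∀ {m k} → Asm O m k → O k → O m) →
         ∀ {m k l} → Asm O m k → Asm O k l → Maybe (Asm O m l)
etaBar {O} η {m} {k} {l} a b =
  seqM (List.map comp (List.allFin l)) >>= λ ps′ →
  mkAsmL (Vec.map (lookupOr 0 (blk b)) (blk a)) ps′ l
  where
  comp : Fin l → Maybe (Σ ℕ O)
  comp d =
    let t = Vec.map (λ x → x ≡ᵇ toℕ d) (blk b)
        w = Vec.lookup (ps b) d
    in restrict true a t >>= λ ad →
       castM O (cnt true t) (proj₂ w) >>= λ w′ →
       just (cnt true (memSet a t) , η ad w′)

relabelSub : ∀ {n} → (Fin n → Fin n) → Vec Bool n → Vec Bool n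
relabelSub σ s = Vec.tabulate (λ j → lookupOr false s (invℕ σ (toℕ j)))

-- map induced by σ from the b-part of s onto the b-part of relabelSub σ s
inducedSub : ∀ {n} (σ : Fin n → Fin n) (b : Bool) (s : Vec Bool n) →
             Fin (cnt b s) → Fin (cnt b s)
inducedSub σ b s i =
  toFinOr (rankIn b (relabelSub σ s) (liftℕ σ (embℕ b s (toℕ i)))) i

relabelLab : ∀ {P : ℕ → Set} {n k} → (Fin n → Fin n) → Asm P n k → Vec ℕ n × List ℕ
relabelLab σ a = canon (Vec.tabulate (λ j → lookupOr 0 (blk a) (invℕ σ (toℕ j))))

blockPerm : ∀ {P : ℕ → Set} {n k} → (Fin n → Fin n) → Asm P n k → Fin k → Fin k
blockPerm σ a c = toFinOr (indexOr (toℕ c) (proj₂ (relabelLab σ a))) c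

relabelAsm : ∀ {P : ℕ → Set} {n k} →
             (∀ {m} → (Fin m → Fin m) → P m → P m) →
             (Fin n → Fin n) → Asm P n k → Maybe (Asm P n k)
relabelAsm {P} {n} {k} actP σ a =
  seqM (List.map newBlock (List.upTo (List.length order))) >>= λ ps′ →
  mkAsmL blk′ ps′ k
  where
  blk′  = proj₁ (relabelLab σ a)
  order = proj₂ (relabelLab σ a)
  newVec : ℕ → Vec Bool n
  newVec d = Vec.map (λ x → x ≡ᵇ d) blk′
  newBlock : ℕ → Maybe (Σ ℕ P)
  newBlock d with lookupL 0 order d
  ... | c with lookupM (ps a) c
  ...   | nothing = nothing
  ...   | just (sz , p) =
            just (sz , actP (λ i → toFinOr (rankIn true (newVec d)
                                (liftℕ σ (embℕ true (blockVec a c) (toℕ i)))) i) p)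

-- disjoint union a₁ ⊔ a₂ of assemblies on the two parts of s,
-- together with the induced decomposition of its set of members
unionAsm : ∀ {P : ℕ → Set} {n k₁ k₂} (s : Vec Bool n) →
           Asm P (cnt true s) k₁ → Asm P (cnt false s) k₂ →
           Maybe (Asm P n (k₁ + k₂)) × Vec Bool (k₁ + k₂)
unionAsm {P} {n} {k₁} {k₂} s a₁ a₂ =
  (seqM (List.map pick order) >>= λ ps′ → mkAsmL blk′ ps′ (k₁ + k₂)) ,
  Vec.tabulate (λ d → lookupL 0 order (toℕ d) <ᵇ k₁)
  where
  lab : Vec ℕ n
  lab = Vec.tabulate (λ i →
          if Vec.lookup s i
          then lookupOr 0 (blk a₁) (rankIn true s (toℕ i))
          else k₁ + lookupOr 0 (blk a₂) (rankIn false s (toℕ i)))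
  blk′  = proj₁ (canon lab)
  order = proj₂ (canon lab)
  pick : ℕ → Maybe (Σ ℕ P)
  pick c = if c <ᵇ k₁ then lookupM (ps a₁) c else lookupM (ps a₂) (c ∸ k₁)

unionLift : ∀ {n} (s : Vec Bool n) → Vec Bool (cnt false s) → Vec Bool n
unionLift [] v = []
unionLift (true ∷ s) v = true ∷ unionLift s v
unionLift (false ∷ s) (x ∷ v) = x ∷ unionLift s v

record CMonop (Msp Osp : Species) : Set where
  open Species Msp renaming (F to M; act to actM)
  open Species Osp renaming (F to O; act to actO)
  field
    ν  : ∀ {n} (s : Vec Bool n) → M (cnt true s) → M (cnt false s) → M n
    𝔢  : M 0
    ν-natural : ∀ {n} (σ : Fin n → Fin n) → Injective′ σ →
      ∀ (s : Vec Bool n) m₁ m₂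
        (e₁ : cnt true s ≡ cnt true (relabelSub σ s))
        (e₂ : cnt false s ≡ cnt false (relabelSub σ s)) →
      ν (relabelSub σ s) (subst M e₁ (actM (inducedSub σ true s) m₁))
                         (subst M e₂ (actM (inducedSub σ false s) m₂))
        ≡ actM σ (ν s m₁ m₂)
    ν-assoc : ∀ {n} (s : Vec Bool n) (s′ : Vec Bool (cnt false s))
      (m₁ : M (cnt true s)) (m₂ : M (cnt true s′)) (m₃ : M (cnt false s′))
      (e₁ : cnt true s ≡ cnt true (sel true (unionLift s s′) s))
      (e₂ : cnt true s′ ≡ cnt false (sel true (unionLift s s′) s))
      (e₃ : cnt false s′ ≡ cnt false (unionLift s s′)) →
      ν (unionLift s s′) (ν (sel true (unionLift s s′) s) (subst M e₁ m₁) (subst M e₂ m₂))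
                         (subst M e₃ m₃)
        ≡ ν s m₁ (ν s′ m₂ m₃)
    ν-unitʳ : ∀ n (m : M n)
      (e₁ : n ≡ cnt true (Vec.replicate n true)) (e₂ : 0 ≡ cnt false (Vec.replicate n true)) →
      ν (Vec.replicate n true) (subst M e₁ m) (subst M e₂ 𝔢) ≡ m
    ν-unitˡ : ∀ n (m : M n)
      (e₁ : 0 ≡ cnt true (Vec.replicate n false)) (e₂ : n ≡ cnt false (Vec.replicate n false)) →
      ν (Vec.replicate n false) (subst M e₁ 𝔢) (subst M e₂ m) ≡ m
    O-positive : O 0 → ⊥
    η  : ∀ {n k} → Asm O n k → O k → O n
    e  : O 1
    η-natural : ∀ {n k} (σ : Fin n → Fin n) → Injective′ σ →
      ∀ (a : Asm O n k) (w : O k) (a′ : Asm O n k) → relabelAsm actO σ a ≡ just a′ →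
      η a′ (actO (blockPerm σ a) w) ≡ actO σ (η a w)
    η-assoc : ∀ {n k l} (a : Asm O n k) (b : Asm O k l) (ω : O l) (c : Asm O n l) →
      etaBar η a b ≡ just c → η c ω ≡ η a (η b ω)
    η-unitˡ : ∀ n (ω : O n) (d : Asm O n n) → disc e n ≡ just d → η d ω ≡ ω
    η-unitʳ : ∀ n (ω : O n) (d : Asm O n 1) → single n ω ≡ just d → η d e ≡ ω
    τ  : ∀ {n k} → Asm O n k → M k → M n
    τ-natural : ∀ {n k} (σ : Fin n → Fin n) → Injective′ σ →
      ∀ (a : Asm O n k) (m : M k) (a′ : Asm O n k) → relabelAsm actO σ a ≡ just a′ →
      τ a′ (actM (blockPerm σ a) m) ≡ actM σ (τ a m)
    τ-assoc : ∀ {n k l} (a : Asm O n k) (b : Asm O k l) (m : M l) (c : Asm O n l) →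
      etaBar η a b ≡ just c → τ c m ≡ τ a (τ b m)
    τ-unit : ∀ n (m : M n) (d : Asm O n n) → disc e n ≡ just d → τ d m ≡ m
    compat : ∀ {n k₁ k₂} (s : Vec Bool n)
      (a₁ : Asm O (cnt true s) k₁) (a₂ : Asm O (cnt false s) k₂) (m₁ : M k₁) (m₂ : M k₂)
      (c : Asm O n (k₁ + k₂)) → proj₁ (unionAsm s a₁ a₂) ≡ just c →
      (e₁ : k₁ ≡ cnt true (proj₂ (unionAsm s a₁ a₂)))
      (e₂ : k₂ ≡ cnt false (proj₂ (unionAsm s a₁ a₂))) →
      ν s (τ a₁ m₁) (τ a₂ m₂)
        ≡ τ c (ν (proj₂ (unionAsm s a₁ a₂)) (subst M e₁ m₁) (subst M e₂ m₂))
    M∅-unique : ∀ (m : M 0) → m ≡ 𝔢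
    ν-cancel  : ∀ {n} (s : Vec Bool n) m₁ m₂ m₂′ → ν s m₁ m₂ ≡ ν s m₁ m₂′ → m₂ ≡ m₂′
    O1-unique : ∀ (o : O 1) → o ≡ e
    η-cancel  : ∀ {n k} (a : Asm O n k) ω ω′ → η a ω ≡ η a ω′ → ω ≡ ω′
    τ-cancel  : ∀ {n k} (a : Asm O n k) m m′ → τ a m ≡ τ a m′ → m ≡ m′

-- elements (m , a) of (M · E(O))[n]:  s decomposes [n] = V₁ + V₂,
-- m ∈ M[V₁], a ∈ E(O)[V₂]
record PP (Msp Osp : Species) (n : ℕ) : Set where
  constructor pp
  field
    sub   : Vec Bool n
    mpart : Species.F Msp (cnt true sub)
    apart : E (Species.F Osp) (cnt false sub)

members : ∀ {Msp Osp n} → PP Msp Osp n → ℕ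
members x = proj₁ (PP.apart x)

module _ {Msp Osp : Species} where
  private
    M = Species.F Msp
    O = Species.F Osp

  module _ (S : CMonop Msp Osp) where
    open CMonop S

    -- ρ̄((m₁,a₁),(m₂′,a₂′)) for the decomposition π = π₁ + π₂ given by t
    rhoBar : ∀ {n} (x : PP Msp Osp n) (t : Vec Bool (members x)) →
             M (cnt true t) → E O (cnt false t) → Maybe (PP Msp Osp n)
    rhoBar {n} (pp s m₁ (k , a₁)) t m₂′ (l , a₂′) =
      restrict true a₁ t >>= λ a₁¹ →
      castM M {cnt true s} (cnt true s*) m₁ >>= λ m₁* →
      castM M {cnt true V₁} (cnt false s*) (τ a₁¹ m₂′) >>= λ mτ* →
      restrict false a₁ t >>= λ a₁² →
      etaBar η a₁² a₂′ >>= λ c →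
      castM (λ z → Asm O z l) {cnt false V₁} (cnt false S′) c >>= λ c* →
      just (pp S′ (ν s* m₁* mτ*) (l , c*))
      where
      V₁ = memSet a₁ t
      S′ = unionLift s V₁
      s* = sel true S′ s

    _≤P_ : ∀ {n} → PP Msp Osp n → PP Msp Osp n → Set
    x ≤P y = Σ (Vec Bool (members x)) λ t →
             Σ (M (cnt true t)) λ m₂′ →
             Σ (E O (cnt false t)) λ a₂′ → rhoBar x t m₂′ a₂′ ≡ just y

    hat0 : (n : ℕ) → Maybe (PP Msp Osp n)
    hat0 n =
      castM M {0} (cnt true s) 𝔢 >>= λ m →
      disc e (cnt false s) >>= λ d →
      just (pp s m (cnt false s , d))
      where s = Vec.replicate n false

record FinEnum (A : Set) : Set where
  field
    elems    : List A
    complete : ∀ x → x ∈ elems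
    unique   : Unique elems
    deq      : DecidableEquality A

sumℤ : List ℤ → ℤ
sumℤ = List.foldr ℤ._+_ 0ℤ

module Möbius {A : Set} (En : FinEnum A) (_≤_ : A → A → Set)
              (_≤?_ : ∀ x y → Dec (x ≤ y)) (z : Maybe A) where
  open FinEnum En

  isZeroM : Maybe A → A → Bool
  isZeroM (just z′) x = does (deq x z′)
  isZeroM nothing   x = false

  isZero : A → Bool
  isZero = isZeroM z

  -- μ(0̂, x) via  μ(0̂,0̂) = 1,  μ(0̂,x) = - Σ_{0̂ ≤ y < x} μ(0̂,y)
  -- (fuel = |A| + 1 exceeds the length of every chain)
  μf : ℕ → A → ℤ
  μf zero x = 0ℤ
  μf (suc f) x =
    if isZero x then 1ℤ
    else ℤ.- sumℤ (List.map (μf f)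
                    (filterB (λ y → does (y ≤? x) ∧ not (does (deq y x))) elems))

  μ₀ : A → ℤ
  μ₀ = μf (suc (List.length elems))

  μsize : (A → Bool) → ℤ
  μsize p = sumℤ (List.map μ₀ (filterB p elems))

  size : (A → Bool) → ℕ
  size p = List.length (filterB p elems)

module Matrices {Msp Osp : Species} (S : CMonop Msp Osp)
                (En : ∀ n → FinEnum (PP Msp Osp n))
                (dec : ∀ n (x y : PP Msp Osp n) → Dec (_≤P_ S x y)) where

  Cnk : ℕ → ℕ → ℤ
  Cnk n k = ℤ.+ Möbius.size (En n) (_≤P_ S) (dec n) (hat0 S n) (λ x → members x ≡ᵇ k)

  Ĉnk : ℕ → ℕ → ℤ
  Ĉnk n k = Möbius.μsize (En n) (_≤P_ S) (dec n) (hat0 S n) (λ x → members x ≡ᵇ k)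

sumFromTo : ℕ → ℕ → (ℕ → ℤ) → ℤ
sumFromTo j n f = sumℤ (List.map (λ i → f (j + i)) (List.upTo (suc (n ∸ j))))

δ : ℕ → ℕ → ℤ
δ n j = if n ≡ᵇ j then 1ℤ else 0ℤ

-- Formal power series (ordinary coefficients, over ℚ) and Riordan arrays

Series : Set
Series = ℕ → ℚ

sumℚ : List ℚ → ℚ
sumℚ = List.foldr ℚ._+_ 0ℚ

sumTo : ℕ → (ℕ → ℚ) → ℚ
sumTo n f = sumℚ (List.map f (List.upTo (suc n)))

invℚ : ℚ → ℚ
invℚ q with q ℚ.≟ 0ℚ
... | yes _ = 0ℚ
... | no p  = ℚ.1/_ q {{ℚ.≢-nonZero p}}

ℤ→ℚ : ℤ → ℚ
ℤ→ℚ z = z ℚ./ 1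

oneS : Series
oneS n = if n ≡ᵇ 0 then 1ℚ else 0ℚ

mulS : Series → Series → Series
mulS f g n = sumTo n (λ i → f i ℚ.* g (n ∸ i))

powS : Series → ℕ → Series
powS f zero    = oneS
powS f (suc k) = mulS f (powS f k)

egf : (ℕ → ℕ) → Series
egf a n = ℚ._/_ (ℤ.+ a n) (fact n) {{n !≢0}}

egfCoeff : Series → ℕ → ℚ
egfCoeff H n = ℤ→ℚ (ℤ.+ fact n) ℚ.* H n

riordan : Series → Series → ℕ → ℕ → ℚ
riordan F G n k =
  egfCoeff (mulS F (powS G k)) n ℚ.* ℚ._/_ (ℤ.+ 1) (fact k) {{k !≢0}}

fromL : List ℚ → Series
fromL L n = lookupL 0ℚ L n

-- compositional inverse G^{⟨-1⟩} of G (G(0) = 0, G'(0) ≠ 0):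
-- coefficients h₀ … hₙ of H with G(H(x)) = x
compInvStep : Series → ℕ → List ℚ → List ℚ
compInvStep g n L =
  L ++ (ℚ.- (invℚ (g 1) ℚ.*
          sumℚ (List.map (λ i → g (2 + i) ℚ.* powS (fromL L) (2 + i) (suc (suc n)))
                         (List.upTo (suc n)))) ∷ [])

compInvList : Series → ℕ → List ℚ
compInvList g zero = 0ℚ ∷ []
compInvList g (suc zero) = 0ℚ ∷ invℚ (g 1) ∷ []
compInvList g (suc (suc n)) = compInvStep g n (compInvList g (suc n))

compInv : Series → Series
compInv g n = lookupL 0ℚ (compInvList g n) n

-- multiplicative inverse 1/A (A(0) ≠ 0)
recipStep : Series → ℕ → List ℚ → List ℚ
recipStep a n L =
  L ++ (ℚ.- (invℚ (a 0) ℚ.*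
          sumℚ (List.map (λ i → a (suc i) ℚ.* lookupL 0ℚ L (n ∸ i)) (List.upTo (suc n)))) ∷ [])

recipList : Series → ℕ → List ℚ
recipList a zero = invℚ (a 0) ∷ []
recipList a (suc n) = recipStep a n (recipList a n)

recip : Series → Series
recip a n = lookupL 0ℚ (recipList a n) n

-- A(H(x)) for H(0) = 0
compose : Series → Series → Series
compose A H n = sumTo n (λ k → A k ℚ.* powS H k n)

invPairF : Series → Series → Series
invPairF F G = recip (compose F (compInv G))

invPairG : Series → Series → Series
invPairG F G = compInv G

{-# OPTIONS --safe #-}
-- For x with k members, (m′, a′) ↦ ρ̄(x, (m′, a′)) is a bijection from P[k] onto the elements above x which
-- preserves the number of members: left cancellation gives injectivity.  By the unit laws it sends the only
-- element of P[k] with k members to x itself, so the number of members strictly drops along the order.  Hence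
--   Σ_k Ĉ(n,k) C(k,j) = Σ_x μ(0̂,x) #{y ≥ x : |y| = j} = Σ_{|y| = j} Σ_{x ≤ y} μ(0̂,x) = δ(n,j),
-- i.e. Ĉ is a left inverse of C.
-- Removing the block of the least element gives γ_k(O)′ = O′ · γ_{k-1}(O), which is also the recursion of
-- O(x)^k / k!; so C is the Riordan array of (M(x), O(x)).  The array R of the inverse pair satisfies R C = 1
-- because composition with O^⟨-1⟩ is multiplicative.  Finally C is lower triangular with invertible
-- diagonal, so X C = 0 forces X = 0: applied to Ĉ - R and to C Ĉ - 1 this gives the two remaining claims.

module Submission where

open import Defs
open import Algebra.Structures using (IsCommutativeRing)
open import Data.Bool using (Bool; true; false; T; if_then_else_; _∧_; not)
open import Data.Bool.Properties using (T-irrelevant; T-∧; T?)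
open import Data.Fin as Fin using (Fin; toℕ)
open import Data.Fin.Permutation using (↔⇒≡)
open import Data.Fin.Properties using (toℕ-fromℕ<; toℕ<n; +↔⊎; *↔×)
open import Data.Integer as ℤ using (ℤ; 0ℤ; 1ℤ)
import Data.Integer.Properties as ℤ
open import Data.List as List using (List; []; _∷_; _++_; upTo)
open import Data.List.Membership.Propositional using (_∈_)
open import Data.List.Membership.Propositional.Properties using (∈-lookup; ∈-filter⁺; ∈-filter⁻; ∈-upTo⁺; ∈-upTo⁻)
import Data.List.Properties as List
import Data.List.Relation.Unary.All as ListAll
open import Data.List.Relation.Unary.Any as Any using (here; there)
open import Data.List.Relation.Unary.Any.Properties using (lookup-index)
open import Data.List.Relation.Unary.Unique.Propositional using (Unique; []; _∷_)
import Data.List.Relation.Unary.Unique.Propositional.Properties as Unique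
open import Data.Maybe using (Maybe; just; _>>=_)
open import Data.Maybe.Properties using (just-injective)
open import Data.Nat using (ℕ; zero; suc; _+_; _*_; _∸_; _≤_; _<_; z≤n; s≤s; z<s; s<s; s≤s⁻¹; s<s⁻¹; _≡ᵇ_; _<ᵇ_; NonZero; _!)
open import Data.Nat.Properties
open import Data.Product using (Σ; _×_; _,_; proj₁; proj₂; ∃)
open import Data.Product.Function.NonDependent.Propositional using (_×-↔_)
open import Data.Product.Properties using (,-injectiveʳ-UIP)
open import Data.Rational as ℚ using (ℚ; 0ℚ; 1ℚ)
import Data.Rational.Properties as ℚ
open import Data.Rational.Solver using (module +-*-Solver)
open import Data.Rational.Unnormalised as ℚᵘ using (mkℚᵘ; *≡*)
import Data.Rational.Unnormalised.Properties as ℚᵘ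
open import Data.Sum using (_⊎_; inj₁; inj₂)
open import Data.Sum.Function.Propositional using (_⊎-↔_)
open import Data.Vec as Vec using (Vec; []; _∷_; lookup; replicate; tabulate; toList)
import Data.Vec.Membership.Propositional as Vec
open import Data.Vec.Properties using (length-toList; toList-injective; cast-is-id; lookup∘tabulate; lookup-replicate; lookup-map; tabulate-cong)
open import Data.Vec.Relation.Unary.All using (All; []; _∷_)
open import Data.Vec.Relation.Unary.Any using (here; there)
open import Function using (_∘_; id)
open import Function.Bundles using (Equivalence; _↔_; mk↔ₛ′)
open import Function.Properties.Inverse using (↔-sym; ↔-trans)
open import Relation.Binary.Definitions using (tri<; tri≈; tri>)
open import Relation.Binary.PropositionalEquality
open import Relation.Nullary using (Dec; yes; no; does; contradiction; ¬_)
open import Relation.Nullary.Decidable using (dec-true)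
open +-*-Solver using (solve; _:+_; _:*_; _:=_; :-_; con)

-- The operations behind the order are computed with checks and return `Maybe`, so the laws of the
-- monop apply only once these checks are known to succeed. The combinatorics before `up` serves
-- this purpose: Boolean validity becomes the inductive predicate `RGF`, restricting and merging
-- blocks are shown to preserve it, and `restrictT`, `etaBarT` and `up` are total versions on which
-- the cancellation laws act directly. Cancellation removes a left factor, so counting the elements
-- above x yields Ĉ C and not C Ĉ; the other order has to come from linear algebra. All counting
-- follows the least element instead of using binomial coefficients: choosing its side is the
-- Leibniz rule and choosing its block is the power rule, so series are compared through their
-- derivatives. As |M[∅]| = 1 and |O[{v}]| = 1, the leading coefficients are 1 and every division in
-- the recursively defined inverse series is by 1.

-- Restricted growth words

-- w continues a restricted growth word with s blocks so far; there are k blocks in the end.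
data RGF (k : ℕ) : ℕ → ∀ {n} → Vec ℕ n → Set where
  done : RGF k k []
  old  : ∀ {s n x} {w : Vec ℕ n} → x < s → RGF k s w → RGF k s (x ∷ w)
  new  : ∀ {s n} {w : Vec ℕ n} → RGF k (suc s) w → RGF k s (s ∷ w)

rgfOK⇒RGF : ∀ {n} s (w : Vec ℕ n) k → T (rgfOK s w k) → RGF k s w
rgfOK⇒RGF s [] k p with ≡ᵇ⇒≡ s k p
... | refl = done
rgfOK⇒RGF s (x ∷ w) k p with x <ᵇ s in lt
... | true = old (<ᵇ⇒< x s (subst T (sym lt) _)) (rgfOK⇒RGF s w k p)
... | false with x ≡ᵇ s in eq
...   | true with ≡ᵇ⇒≡ x s (subst T (sym eq) _)
...     | refl = new (rgfOK⇒RGF (suc s) w k p)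

T⇒≡true : ∀ {b} → T b → b ≡ true
T⇒≡true {true} _ = refl

≡ᵇ-refl : ∀ n → (n ≡ᵇ n) ≡ true
≡ᵇ-refl n = T⇒≡true (≡⇒≡ᵇ n n refl)

<ᵇ-irrefl : ∀ n → (n <ᵇ n) ≡ false
<ᵇ-irrefl zero    = refl
<ᵇ-irrefl (suc n) = <ᵇ-irrefl n

≢⇒≡ᵇ-false : ∀ {m n} → m ≢ n → (m ≡ᵇ n) ≡ false
≢⇒≡ᵇ-false {m} {n} m≢n with m ≡ᵇ n in eq
... | true  = contradiction (≡ᵇ⇒≡ m n (subst T (sym eq) _)) m≢n
... | false = refl

RGF⇒rgfOK : ∀ {n s k} {w : Vec ℕ n} → RGF k s w → T (rgfOK s w k)
RGF⇒rgfOK {k = k} done = ≡⇒≡ᵇ k k refl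
RGF⇒rgfOK (old x<s r) rewrite T⇒≡true (<⇒<ᵇ x<s) = RGF⇒rgfOK r
RGF⇒rgfOK {s = s} (new r) rewrite <ᵇ-irrefl s | ≡ᵇ-refl s = RGF⇒rgfOK r

RGF-≤ : ∀ {n s k} {w : Vec ℕ n} → RGF k s w → s ≤ k
RGF-≤ done      = ≤-refl
RGF-≤ (old _ r) = RGF-≤ r
RGF-≤ (new r)   = <⇒≤ (RGF-≤ r)

RGF-bound : ∀ {n s k} {w : Vec ℕ n} → RGF k s w → All (_< k) w
RGF-bound done        = []
RGF-bound (old x<s r) = <-≤-trans x<s (RGF-≤ r) ∷ RGF-bound r
RGF-bound (new r)     = RGF-≤ r ∷ RGF-bound r

-- The block count climbs from `s` to `k` in steps of one, and each step writes the current count as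
-- a letter. Letters below `s` belong to the part already read, hence the bound `s ≤ c`.
RGF-surjective : ∀ {n s k} {w : Vec ℕ n} → RGF k s w → ∀ {c} → s ≤ c → c < k → c Vec.∈ w
RGF-surjective done s≤c c<k = contradiction c<k (≤⇒≯ s≤c)
RGF-surjective (old _ r) s≤c c<k = there (RGF-surjective r s≤c c<k)
RGF-surjective {s = s} (new r) {c} s≤c c<k with s ≟ c
... | yes refl = here refl
... | no s≢c   = there (RGF-surjective r (≤∧≢⇒< s≤c s≢c) c<k)

RGF-length : ∀ {n s k} {w : Vec ℕ n} → RGF k s w → k ≤ s + n
RGF-length {s = s} done = ≤-reflexive (sym (+-identityʳ s))
RGF-length {suc n} {s} (old _ r) = ≤-trans (RGF-length r) (+-monoʳ-≤ s (n≤1+n n))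
RGF-length {suc n} {s} (new r) = ≤-trans (RGF-length r) (≤-reflexive (sym (+-suc s n)))

-- Gaining as many blocks as there are letters leaves no room for an `old` letter, so every letter
-- is the block count at its position.
RGF-discrete : ∀ {n s k} {w : Vec ℕ n} → RGF k s w → k ≡ s + n → ∀ i → lookup w i ≡ s + toℕ i
RGF-discrete {suc n} {s} (old _ r) k≡ i =
  contradiction (≤-trans (≤-reflexive (trans (sym (+-suc s n)) (sym k≡))) (RGF-length r)) (<-irrefl refl)
RGF-discrete {s = s} (new r) k≡ Fin.zero = sym (+-identityʳ s)
RGF-discrete {suc n} {s} (new r) k≡ (Fin.suc i) =
  trans (RGF-discrete r (trans k≡ (+-suc s n)) i) (sym (+-suc s (toℕ i)))

-- Subsets

lookupOr-toℕ : ∀ {A : Set} {n} (d : A) (xs : Vec A n) i → lookupOr d xs (toℕ i) ≡ lookup xs i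
lookupOr-toℕ d (x ∷ xs) Fin.zero    = refl
lookupOr-toℕ d (x ∷ xs) (Fin.suc i) = lookupOr-toℕ d xs i

lookupOr-map : ∀ {A B : Set} {n} (f : A → B) a b (xs : Vec A n) {i} → i < n →
               lookupOr b (Vec.map f xs) i ≡ f (lookupOr a xs i)
lookupOr-map f a b (x ∷ xs) {zero}  _   = refl
lookupOr-map f a b (x ∷ xs) {suc i} i<n = lookupOr-map f a b xs (s<s⁻¹ i<n)

lookupOr-replicate : ∀ {A : Set} n (d : A) i → lookupOr d (replicate n d) i ≡ d
lookupOr-replicate zero    d i       = refl
lookupOr-replicate (suc n) d zero    = refl
lookupOr-replicate (suc n) d (suc i) = lookupOr-replicate n d i

eqB-refl : ∀ b → eqB b b ≡ true
eqB-refl true  = refl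
eqB-refl false = refl

eqB-≡ : ∀ b c → eqB b c ≡ true → c ≡ b
eqB-≡ true  true  _ = refl
eqB-≡ false false _ = refl

cnt-true+false : ∀ {n} (t : Vec Bool n) → cnt true t + cnt false t ≡ n
cnt-true+false []          = refl
cnt-true+false (true ∷ t)  = cong suc (cnt-true+false t)
cnt-true+false (false ∷ t) = trans (+-suc _ _) (cong suc (cnt-true+false t))

cnt-false≤ : ∀ {n} (t : Vec Bool n) → cnt false t ≤ n
cnt-false≤ t = ≤-trans (m≤n+m _ (cnt true t)) (≤-reflexive (cnt-true+false t))

cnt-replicate : ∀ b n → cnt b (replicate n b) ≡ n
cnt-replicate b zero = refl
cnt-replicate b (suc n) rewrite eqB-refl b = cong suc (cnt-replicate b n)

cnt-false-full : ∀ {n} (t : Vec Bool n) → cnt false t ≡ n → t ≡ replicate n false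
cnt-false-full [] _ = refl
cnt-false-full (true ∷ t) eq = contradiction (cnt-false≤ t) (<⇒≱ (≤-reflexive (sym eq)))
cnt-false-full (false ∷ t) eq = cong (false ∷_) (cnt-false-full t (suc-injective eq))

rankIn-length : ∀ b {n} (t : Vec Bool n) → rankIn b t n ≡ cnt b t
rankIn-length b [] = refl
rankIn-length b (y ∷ t) with eqB b y
... | true  = cong suc (rankIn-length b t)
... | false = rankIn-length b t

rankIn-0 : ∀ b {n} (t : Vec Bool n) → rankIn b t 0 ≡ 0
rankIn-0 b []      = refl
rankIn-0 b (x ∷ t) = refl

-- `rankIn` recurses from the front of the subset, while reading a growth word moves the threshold
-- at the far end; this is the recursion at that end.
rankIn-suc : ∀ b {n} (t : Vec Bool n) {x} → x < n →
             rankIn b t (suc x) ≡ (if eqB b (lookupOr false t x) then 1 else 0) + rankIn b t x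
rankIn-suc b (y ∷ t) {zero}  x<n = cong (_ +_) (rankIn-0 b t)
rankIn-suc b (y ∷ t) {suc x} x<n rewrite rankIn-suc b t (s<s⁻¹ x<n) =
  swap (if eqB b y then 1 else 0) (if eqB b (lookupOr false t x) then 1 else 0) (rankIn b t x)
  where
  swap : ∀ p q r → p + (q + r) ≡ q + (p + r)
  swap p q r = trans (sym (+-assoc p q r)) (trans (cong (_+ r) (+-comm p q)) (+-assoc q p r))

rankIn-mono : ∀ b {n} (t : Vec Bool n) {x y} → x ≤ y → rankIn b t x ≤ rankIn b t y
rankIn-mono b []      x≤y = ≤-refl
rankIn-mono b (_ ∷ t) z≤n = z≤n
rankIn-mono b (_ ∷ t) (s≤s x≤y) = +-monoʳ-≤ _ (rankIn-mono b t x≤y)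

rankIn-strict : ∀ b {n} (t : Vec Bool n) {x y} → x < y → x < n →
                lookupOr false t x ≡ b → rankIn b t x < rankIn b t y
rankIn-strict b t {x} x<y x<n refl =
  ≤-trans (≤-reflexive (sym (trans (rankIn-suc b t x<n) (cong (λ c → (if c then 1 else 0) + rankIn b t x) (eqB-refl b)))))
          (rankIn-mono b t x<y)

rankIn-injective : ∀ b {n} (t : Vec Bool n) {x y} → x < n → y < n →
                   lookupOr false t x ≡ b → lookupOr false t y ≡ b →
                   rankIn b t x ≡ rankIn b t y → x ≡ y
rankIn-injective b t {x} {y} x<n y<n tx ty eq with <-cmp x y
... | tri< x<y _ _ = contradiction eq (<⇒≢ (rankIn-strict b t x<y x<n tx))
... | tri≈ _ x≡y _ = x≡y
... | tri> _ _ y<x = contradiction (sym eq) (<⇒≢ (rankIn-strict b t y<x y<n ty))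

rankIn-replicate : ∀ b n {x} → x ≤ n → rankIn b (replicate n b) x ≡ x
rankIn-replicate b zero z≤n = refl
rankIn-replicate b (suc n) {zero} _ = refl
rankIn-replicate b (suc n) {suc x} x≤n rewrite eqB-refl b = cong suc (rankIn-replicate b n (s≤s⁻¹ x≤n))

emb : ∀ b {n} (t : Vec Bool n) → Fin (cnt b t) → Fin n
emb b (y ∷ t) i with eqB b y
emb b (y ∷ t) Fin.zero    | true  = Fin.zero
emb b (y ∷ t) (Fin.suc i) | true  = Fin.suc (emb b t i)
emb b (y ∷ t) i           | false = Fin.suc (emb b t i)

lookup-emb : ∀ b {n} (t : Vec Bool n) i → lookup t (emb b t i) ≡ b
lookup-emb b (y ∷ t) i with eqB b y in eq
lookup-emb b (y ∷ t) Fin.zero    | true  = eqB-≡ b y eq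
lookup-emb b (y ∷ t) (Fin.suc i) | true  = lookup-emb b t i
lookup-emb b (y ∷ t) i           | false = lookup-emb b t i

lookup-sel : ∀ {A : Set} b {n} (t : Vec Bool n) (xs : Vec A n) i → lookup (sel b t xs) i ≡ lookup xs (emb b t i)
lookup-sel b (y ∷ t) (x ∷ xs) i with eqB b y
lookup-sel b (y ∷ t) (x ∷ xs) Fin.zero    | true  = refl
lookup-sel b (y ∷ t) (x ∷ xs) (Fin.suc i) | true  = lookup-sel b t xs i
lookup-sel b (y ∷ t) (x ∷ xs) i           | false = lookup-sel b t xs i

rankIn-emb : ∀ b {n} (t : Vec Bool n) i → rankIn b t (toℕ (emb b t i)) ≡ toℕ i
rankIn-emb b (y ∷ t) i with eqB b y in eq
rankIn-emb b (y ∷ t) Fin.zero    | true = refl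
rankIn-emb b (y ∷ t) (Fin.suc i) | true rewrite eq = cong suc (rankIn-emb b t i)
rankIn-emb b (y ∷ t) i           | false rewrite eq = rankIn-emb b t i

subword : ∀ (b : Bool) {n k} (t : Vec Bool k) (w : Vec ℕ n) → Vec ℕ (cnt b (Vec.map (lookupOr false t) w))
subword b t w = sel b (Vec.map (lookupOr false t) w) (Vec.map (rankIn b t) w)

RGF-cong : ∀ {n k k′ s s′} {w : Vec ℕ n} → k ≡ k′ → s ≡ s′ → RGF k s w → RGF k′ s′ w
RGF-cong refl refl r = r

RGF-new : ∀ {n k s x} {w : Vec ℕ n} → x ≡ s → RGF k (suc s) w → RGF k s (x ∷ w)
RGF-new refl r = new r

-- `rankIn b t s` counts the kept blocks among the first `s`, so it is the block count of the
-- subword. A kept new block has exactly this rank as its number, and a kept old block has a smaller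
-- one.
RGF-subword : ∀ b {n k s} (t : Vec Bool k) {w : Vec ℕ n} → RGF k s w →
              RGF (cnt b t) (rankIn b t s) (subword b t w)
RGF-subword b t done = RGF-cong refl (sym (rankIn-length b t)) done
RGF-subword b t {x ∷ w} (old x<s r) with eqB b (lookupOr false t x) in eq
... | true  = old (rankIn-strict b t x<s (<-≤-trans x<s (RGF-≤ r)) (eqB-≡ b _ eq)) (RGF-subword b t r)
... | false = RGF-subword b t r
RGF-subword b t {x ∷ w} (new r) with eqB b (lookupOr false t x) in eq
... | true  = new (RGF-cong refl (trans (rankIn-suc b t (RGF-≤ r)) (cong (λ c → (if c then 1 else 0) + rankIn b t x) eq)) (RGF-subword b t r))
... | false = RGF-cong refl (trans (rankIn-suc b t (RGF-≤ r)) (cong (λ c → (if c then 1 else 0) + rankIn b t x) eq)) (RGF-subword b t r)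

-- A kept block keeps all its elements, since rank is injective on kept blocks.
countVal-subword : ∀ b {n k} (t : Vec Bool k) {w : Vec ℕ n} → All (_< k) w → ∀ i →
                   countVal (toℕ i) (subword b t w) ≡ countVal (toℕ (emb b t i)) w
countVal-subword b t [] i = refl
countVal-subword b t {x ∷ w} (x<k ∷ bd) i with eqB b (lookupOr false t x) in eq
... | true = cong₂ (λ c r → if c then suc r else r) head≡ (countVal-subword b t bd i)
  where
  head≡ : (rankIn b t x ≡ᵇ toℕ i) ≡ (x ≡ᵇ toℕ (emb b t i))
  head≡ with x ≟ toℕ (emb b t i)
  ... | yes refl = trans (cong (_≡ᵇ toℕ i) (rankIn-emb b t i)) (trans (≡ᵇ-refl (toℕ i)) (sym (≡ᵇ-refl x)))
  ... | no x≢ = trans (≢⇒≡ᵇ-false λ r → x≢ (rankIn-injective b t x<k (toℕ<n (emb b t i)) (eqB-≡ b _ eq)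
                        (trans (lookupOr-toℕ false t (emb b t i)) (lookup-emb b t i)) (trans r (sym (rankIn-emb b t i)))))
                      (sym (≢⇒≡ᵇ-false x≢))
-- A dropped letter differs from `emb b t i`, because `t` takes the value `b` there.
... | false rewrite ≢⇒≡ᵇ-false {x} {toℕ (emb b t i)} (λ { refl → contradiction
                      (trans (sym eq) (trans (cong (eqB b) (trans (lookupOr-toℕ false t (emb b t i)) (lookup-emb b t i))) (eqB-refl b))) λ () })
            = countVal-subword b t bd i

-- f s, f (1 + s), …, f (k ∸ 1) continues a restricted growth word with q blocks so far and l in the end.
data Walk (f : ℕ → ℕ) (k l : ℕ) : ℕ → ℕ → Set where
  end  : Walk f k l k l
  stay : ∀ {s q} → f s < q → Walk f k l (suc s) q → Walk f k l s q
  step : ∀ {s q} → f s ≡ q → Walk f k l (suc s) (suc q) → Walk f k l s q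

Walk-≤ : ∀ {f k l s q} → Walk f k l s q → s ≤ k
Walk-≤ end        = ≤-refl
Walk-≤ (stay _ v) = <⇒≤ (Walk-≤ v)
Walk-≤ (step _ v) = <⇒≤ (Walk-≤ v)

RGF⇒Walk : ∀ (f : ℕ → ℕ) {n k l s q} {w : Vec ℕ n} → s + n ≡ k → (∀ i → lookup w i ≡ f (s + toℕ i)) →
           RGF l q w → Walk f k l s q
RGF⇒Walk f {s = s} s+n≡k f≡ done with trans (sym (+-identityʳ s)) s+n≡k
... | refl = end
RGF⇒Walk f {suc n} {s = s} s+n≡k f≡ (old x<q r) =
  stay (subst (_< _) (trans (f≡ Fin.zero) (cong f (+-identityʳ s))) x<q)
       (RGF⇒Walk f (trans (sym (+-suc s n)) s+n≡k) (λ i → trans (f≡ (Fin.suc i)) (cong f (+-suc s (toℕ i)))) r)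
RGF⇒Walk f {suc n} {s = s} s+n≡k f≡ (new r) =
  step (sym (trans (f≡ Fin.zero) (cong f (+-identityʳ s))))
       (RGF⇒Walk f (trans (sym (+-suc s n)) s+n≡k) (λ i → trans (f≡ (Fin.suc i)) (cong f (+-suc s (toℕ i)))) r)

-- Blocks of the word first appear in the order s, 1 + s, ..., so each `new` letter advances the
-- walk of `f` by one place. A repeated block has an image that is already below `q`.
RGF-map : ∀ {f : ℕ → ℕ} {n k l s q} {w : Vec ℕ n} → RGF k s w → Walk f k l s q →
          (∀ {x} → x < s → f x < q) → RGF l q (Vec.map f w)
RGF-map done end _ = done
RGF-map done (stay _ v) _ = contradiction (Walk-≤ v) (<-irrefl refl)
RGF-map done (step _ v) _ = contradiction (Walk-≤ v) (<-irrefl refl)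
RGF-map (old x<s r) v below = old (below x<s) (RGF-map r v below)
RGF-map (new r) end below = contradiction (RGF-≤ r) (<-irrefl refl)
RGF-map {f} {s = s} (new r) (stay fs<q v) below = old fs<q (RGF-map r v below′)
  where
  below′ : ∀ {x} → x < suc s → f x < _
  below′ {x} x<1+s with x ≟ s
  ... | yes refl = fs<q
  ... | no x≢s   = below (≤∧≢⇒< (s≤s⁻¹ x<1+s) x≢s)
RGF-map {f} {s = s} {q = q} (new r) (step fs≡q v) below = RGF-new fs≡q (RGF-map r v below′)
  where
  below′ : ∀ {x} → x < suc s → f x < suc q
  below′ {x} x<1+s with x ≟ s
  ... | yes refl = s≤s (≤-reflexive fs≡q)
  ... | no x≢s   = m<n⇒m<1+n (below (≤∧≢⇒< (s≤s⁻¹ x<1+s) x≢s))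

-- Numbering blocks by their minima is compatible with merging blocks, which is why `etaBar` needs
-- no renumbering.
RGF-compose : ∀ {n k l} {v : Vec ℕ n} {w : Vec ℕ k} → RGF k 0 v → RGF l 0 w → RGF l 0 (Vec.map (lookupOr 0 w) v)
RGF-compose {w = w} r r′ = RGF-map r (RGF⇒Walk (lookupOr 0 w) refl (λ i → sym (lookupOr-toℕ 0 w i)) r′) λ ()

countVal-cnt : ∀ c {n} (w : Vec ℕ n) → countVal c w ≡ cnt true (Vec.map (_≡ᵇ c) w)
countVal-cnt c [] = refl
countVal-cnt c (x ∷ w) with x ≡ᵇ c
... | true  = cong suc (countVal-cnt c w)
... | false = countVal-cnt c w

countVal-compose : ∀ c {n k} (w : Vec ℕ k) {v : Vec ℕ n} → All (_< k) v →
                   countVal c (Vec.map (lookupOr 0 w) v) ≡ cnt true (Vec.map (lookupOr false (Vec.map (_≡ᵇ c) w)) v)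
countVal-compose c w [] = refl
countVal-compose c w {x ∷ v} (x<k ∷ bd) rewrite lookupOr-map (_≡ᵇ c) 0 false w x<k with lookupOr 0 w x ≡ᵇ c
... | true  = cong suc (countVal-compose c w bd)
... | false = countVal-compose c w bd

lookup-ext : ∀ {A : Set} {n} {xs ys : Vec A n} → (∀ i → lookup xs i ≡ lookup ys i) → xs ≡ ys
lookup-ext {xs = []} {[]} _ = refl
lookup-ext {xs = _ ∷ _} {_ ∷ _} eq = cong₂ _∷_ (eq Fin.zero) (lookup-ext (eq ∘ Fin.suc))

map-≡⇒ : ∀ {A B : Set} {n} {f g : A → B} {xs : Vec A n} → Vec.map f xs ≡ Vec.map g xs → ∀ {x} → x Vec.∈ xs → f x ≡ g x
map-≡⇒ eq (here refl) = cong Vec.head eq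
map-≡⇒ eq (there x∈)  = map-≡⇒ (cong Vec.tail eq) x∈

-- Every block number occurs in `w`, so data on blocks are determined by their pullback to elements.
-- With numbers as data this recovers a partition of the blocks, with Booleans a subset of them.
map-lookupOr-injective : ∀ {A : Set} {n k} (d : A) {w : Vec ℕ n} → RGF k 0 w → (u v : Vec A k) →
                         Vec.map (lookupOr d u) w ≡ Vec.map (lookupOr d v) w → u ≡ v
map-lookupOr-injective d r u v eq = lookup-ext λ i →
  trans (sym (lookupOr-toℕ d u i))
        (trans (map-≡⇒ eq (RGF-surjective r z≤n (toℕ<n i))) (lookupOr-toℕ d v i))

-- Assemblies

sizesOK⇒ : ∀ {P : ℕ → Set} {n k} j (w : Vec ℕ n) (ps : Vec (Σ ℕ P) k) → T (sizesOK j w ps) →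
           ∀ i → proj₁ (lookup ps i) ≡ countVal (j + toℕ i) w
sizesOK⇒ j w ((s , _) ∷ ps) p Fin.zero =
  trans (≡ᵇ⇒≡ s _ (proj₁ (Equivalence.to T-∧ p))) (cong (λ z → countVal z w) (sym (+-identityʳ j)))
sizesOK⇒ j w ((s , _) ∷ ps) p (Fin.suc i) =
  trans (sizesOK⇒ (suc j) w ps (proj₂ (Equivalence.to (T-∧ {s ≡ᵇ countVal j w}) p)) i)
        (cong (λ z → countVal z w) (sym (+-suc j (toℕ i))))

⇒sizesOK : ∀ {P : ℕ → Set} {n k} j (w : Vec ℕ n) (ps : Vec (Σ ℕ P) k) →
           (∀ i → proj₁ (lookup ps i) ≡ countVal (j + toℕ i) w) → T (sizesOK j w ps)
⇒sizesOK j w [] _ = _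
⇒sizesOK j w ((s , _) ∷ ps) h = Equivalence.from T-∧
  ( ≡⇒≡ᵇ s _ (trans (h Fin.zero) (cong (λ z → countVal z w) (+-identityʳ j)))
  , ⇒sizesOK (suc j) w ps λ i → trans (h (Fin.suc i)) (cong (λ z → countVal z w) (+-suc j (toℕ i))))

module _ {P : ℕ → Set} where

  asm-RGF : ∀ {n k} (a : Asm P n k) → RGF k 0 (blk a)
  asm-RGF a = rgfOK⇒RGF 0 (blk a) _ (proj₁ (Equivalence.to T-∧ (ok a)))

  asm-size : ∀ {n k} (a : Asm P n k) i → proj₁ (lookup (ps a) i) ≡ countVal (toℕ i) (blk a)
  asm-size {k = k} a = sizesOK⇒ 0 (blk a) (ps a) (proj₂ (Equivalence.to (T-∧ {rgfOK 0 (blk a) k}) (ok a)))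

  valid : ∀ {n k} (w : Vec ℕ n) (ps : Vec (Σ ℕ P) k) → RGF k 0 w →
          (∀ i → proj₁ (lookup ps i) ≡ countVal (toℕ i) w) → T (validAsm w ps)
  valid w ps r h = Equivalence.from T-∧ (RGF⇒rgfOK r , ⇒sizesOK 0 w ps h)

  asm-≡ : ∀ {n k} {a b : Asm P n k} → blk a ≡ blk b → ps a ≡ ps b → a ≡ b
  asm-≡ {a = asm w ps p} {asm _ _ q} refl refl = cong (asm w ps) (T-irrelevant p q)

  mkAsm-just : ∀ {n k} {w : Vec ℕ n} {ps : Vec (Σ ℕ P) k} (p : T (validAsm w ps)) → mkAsm w ps ≡ just (asm w ps p)
  mkAsm-just {w = w} {ps} p with T? (validAsm w ps)
  ... | yes q = cong (just ∘ asm w ps) (T-irrelevant q p)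
  ... | no ¬p = contradiction p ¬p

  members≤ : ∀ {n k} → Asm P n k → k ≤ n
  members≤ a = RGF-length (asm-RGF a)

  restrictT : ∀ b {n k} (a : Asm P n k) (t : Vec Bool k) → Asm P (cnt b (memSet a t)) (cnt b t)
  restrictT b a t = asm (subword b t (blk a)) (sel b t (ps a))
    (valid _ (sel b t (ps a)) (RGF-cong refl (rankIn-0 b t) (RGF-subword b t (asm-RGF a))) λ i →
      trans (cong proj₁ (lookup-sel b t (ps a) i))
        (trans (asm-size a (emb b t i)) (sym (countVal-subword b t (RGF-bound (asm-RGF a)) i))))

  restrict-just : ∀ b {n k} (a : Asm P n k) (t : Vec Bool k) → restrict b a t ≡ just (restrictT b a t)
  restrict-just b a t = mkAsm-just _

bind-just : ∀ {A B : Set} {m : Maybe A} {x} {f : A → Maybe B} {r} → m ≡ just x → f x ≡ r → (m >>= f) ≡ r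
bind-just refl eq = eq

castM-just : ∀ (A : ℕ → Set) {m} n (p : m ≡ n) (x : A m) → castM A n x ≡ just (subst A p x)
castM-just A {m} n p x with m ≟ n
... | yes q = cong (λ e → just (subst A e x)) (≡-irrelevant q p)
... | no ¬p = contradiction p ¬p

seqM-just : ∀ {A B : Set} (f : A → Maybe B) (g : A → B) → (∀ x → f x ≡ just (g x)) →
            ∀ xs → seqM (List.map f xs) ≡ just (List.map g xs)
seqM-just f g f≡ [] = refl
seqM-just f g f≡ (x ∷ xs) rewrite f≡ x | seqM-just f g f≡ xs = refl

fromList-toList : ∀ {A : Set} {n} (v : Vec A n) → Σ (List.length (toList v) ≡ n) λ e →
                  subst (Vec A) e (Vec.fromList (toList v)) ≡ v
fromList-toList [] = refl , refl
fromList-toList {A} (x ∷ v) with fromList-toList v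
... | e , eq = cong suc e , trans (lemma e (Vec.fromList (toList v))) (cong (x ∷_) eq)
  where
  lemma : ∀ {m n} (p : m ≡ n) (u : Vec A m) → subst (Vec A) (cong suc p) (x ∷ u) ≡ x ∷ subst (Vec A) p u
  lemma refl u = refl

toList-tabulate : ∀ {A : Set} {n} (f : Fin n → A) → toList (tabulate f) ≡ List.tabulate f
toList-tabulate {n = zero}  f = refl
toList-tabulate {n = suc n} f = cong (f Fin.zero ∷_) (toList-tabulate (f ∘ Fin.suc))

-- `mkAsmL` turns a list into a vector by comparing lengths; for the list of values of `f` the cast
-- vector is `tabulate f`.
mkAsmL-just : ∀ {P : ℕ → Set} {n k} {w : Vec ℕ n} (f : Fin k → Σ ℕ P) (p : T (validAsm w (tabulate f))) →
              mkAsmL w (List.map f (List.allFin k)) k ≡ just (asm w (tabulate f) p)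
mkAsmL-just {P} {k = k} {w} f p
  rewrite trans (List.map-tabulate id f) (sym (toList-tabulate f)) with fromList-toList (tabulate f)
... | e , eq = bind-just (trans (castM-just (Vec (Σ ℕ P)) k e (Vec.fromList (toList (tabulate f)))) (cong just eq)) (mkAsm-just p)

-- The sources `m` and `m′` may differ: two assemblies record the sizes of their members
-- independently, and only the sizes computed from the word coincide.
Σ-subst-injective : ∀ {A : ℕ → Set} {m m′ n} {x : A m} {y : A m′} (p : m ≡ n) (q : m′ ≡ n) →
                    subst A p x ≡ subst A q y → (m , x) ≡ (m′ , y)
Σ-subst-injective refl refl refl = refl

module _ {P : ℕ → Set} (η : ∀ {m k} → Asm P m k → P k → P m) where

  fibre : ∀ {k l} → Asm P k l → Fin l → Vec Bool k
  fibre b d = Vec.map (λ x → x ≡ᵇ toℕ d) (blk b)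

  fibre-size : ∀ {k l} (b : Asm P k l) d → proj₁ (lookup (ps b) d) ≡ cnt true (fibre b d)
  fibre-size b d = trans (asm-size b d) (countVal-cnt (toℕ d) (blk b))

  etaComponent : ∀ {m k l} → Asm P m k → Asm P k l → Fin l → Σ ℕ P
  etaComponent a b d = cnt true (memSet a (fibre b d)) ,
    η (restrictT true a (fibre b d)) (subst P (fibre-size b d) (proj₂ (lookup (ps b) d)))

  etaBarT : ∀ {m k l} → Asm P m k → Asm P k l → Asm P m l
  etaBarT a b = asm (Vec.map (lookupOr 0 (blk b)) (blk a)) (tabulate (etaComponent a b))
    (valid _ (tabulate (etaComponent a b)) (RGF-compose (asm-RGF a) (asm-RGF b)) λ d →
      trans (cong proj₁ (lookup∘tabulate (etaComponent a b) d))
            (sym (countVal-compose (toℕ d) (blk b) (RGF-bound (asm-RGF a)))))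

  etaBar-just : ∀ {m k l} (a : Asm P m k) (b : Asm P k l) → etaBar η a b ≡ just (etaBarT a b)
  etaBar-just {l = l} a b = bind-just
    (seqM-just _ (etaComponent a b)
      (λ d → bind-just (restrict-just true a (fibre b d))
               (bind-just (castM-just P (cnt true (fibre b d)) (fibre-size b d) (proj₂ (lookup (ps b) d))) refl))
      (List.allFin l))
    (mkAsmL-just (etaComponent a b) (ok (etaBarT a b)))

  -- The merged word determines the word of `b`. The fibres then agree, so both sides apply η to the
  -- same restriction of `a` and cancellation works one member at a time.
  etaBarT-injective : (∀ {n k} (a : Asm P n k) ω ω′ → η a ω ≡ η a ω′ → ω ≡ ω′) →
                      ∀ {m k l} (a : Asm P m k) (b b′ : Asm P k l) → etaBarT a b ≡ etaBarT a b′ → b ≡ b′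
  etaBarT-injective η-cancel a b@(asm w qs v) b′@(asm w′ qs′ v′) eq
    with map-lookupOr-injective 0 (asm-RGF a) w w′ (cong blk eq)
  ... | refl = asm-≡ refl (lookup-ext λ d → Σ-subst-injective (fibre-size b d) (fibre-size b′ d)
                 (η-cancel (restrictT true a (fibre b d)) _ _ (pair-injective
                   (trans (sym (lookup∘tabulate (etaComponent a b) d))
                     (trans (cong (λ c → lookup (ps c) d) eq) (lookup∘tabulate (etaComponent a b′) d))))))
    where
    pair-injective : ∀ {m} {x y : P m} → _≡_ {A = Σ ℕ P} (m , x) (m , y) → x ≡ y
    pair-injective refl = refl

-- Refined decompositions of the ground set

sel-cnt-true : ∀ {n} (s : Vec Bool n) (v : Vec Bool (cnt false s)) → cnt true s ≡ cnt true (sel true (unionLift s v) s)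
sel-cnt-true [] v = refl
sel-cnt-true (true ∷ s) v = cong suc (sel-cnt-true s v)
sel-cnt-true (false ∷ s) (true ∷ v) = sel-cnt-true s v
sel-cnt-true (false ∷ s) (false ∷ v) = sel-cnt-true s v

sel-cnt-false : ∀ {n} (s : Vec Bool n) (v : Vec Bool (cnt false s)) → cnt true v ≡ cnt false (sel true (unionLift s v) s)
sel-cnt-false [] [] = refl
sel-cnt-false (true ∷ s) v = sel-cnt-false s v
sel-cnt-false (false ∷ s) (true ∷ v) = cong suc (sel-cnt-false s v)
sel-cnt-false (false ∷ s) (false ∷ v) = sel-cnt-false s v

unionLift-cnt-false : ∀ {n} (s : Vec Bool n) (v : Vec Bool (cnt false s)) → cnt false v ≡ cnt false (unionLift s v)
unionLift-cnt-false [] [] = refl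
unionLift-cnt-false (true ∷ s) v = unionLift-cnt-false s v
unionLift-cnt-false (false ∷ s) (true ∷ v) = unionLift-cnt-false s v
unionLift-cnt-false (false ∷ s) (false ∷ v) = cong suc (unionLift-cnt-false s v)

unionLift-injective : ∀ {n} (s : Vec Bool n) (u v : Vec Bool (cnt false s)) → unionLift s u ≡ unionLift s v → u ≡ v
unionLift-injective [] [] [] eq = refl
unionLift-injective (true ∷ s) u v eq = unionLift-injective s u v (cong Vec.tail eq)
unionLift-injective (false ∷ s) (x ∷ u) (y ∷ v) eq =
  cong₂ _∷_ (cong Vec.head eq) (unionLift-injective s u v (cong Vec.tail eq))

unionLift-false : ∀ {n} (s : Vec Bool n) → unionLift s (replicate _ false) ≡ s
unionLift-false [] = refl
unionLift-false (true ∷ s) = cong (true ∷_) (unionLift-false s)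
unionLift-false (false ∷ s) = cong (false ∷_) (unionLift-false s)

sel-self : ∀ {n} (s : Vec Bool n) → sel true s s ≡ replicate _ true
sel-self [] = refl
sel-self (true ∷ s) = cong (true ∷_) (sel-self s)
sel-self (false ∷ s) = sel-self s

map-const : ∀ {A B : Set} {n} {f : A → B} {b} → (∀ x → f x ≡ b) → (xs : Vec A n) → Vec.map f xs ≡ replicate n b
map-const f≡ []       = refl
map-const f≡ (x ∷ xs) = cong₂ _∷_ (f≡ x) (map-const f≡ xs)

map-id-on : ∀ {n} {Q : ℕ → Set} {f : ℕ → ℕ} {w : Vec ℕ n} → (∀ {x} → Q x → f x ≡ x) → All Q w → Vec.map f w ≡ w
map-id-on f≡ []        = refl
map-id-on f≡ (q ∷ qs)  = cong₂ _∷_ (f≡ q) (map-id-on f≡ qs)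

toList-sel-full : ∀ {A : Set} b {n} (xs : Vec A n) → toList (sel b (replicate n b) xs) ≡ toList xs
toList-sel-full b [] = refl
toList-sel-full b (x ∷ xs) rewrite eqB-refl b = cong (x ∷_) (toList-sel-full b xs)

-- The words and member vectors of the two sides have different types. Lists forget the lengths, and
-- the length of the member list returns `k ≡ l`.
E-ext : ∀ {P : ℕ → Set} {m n k l} (e : m ≡ n) (a : Asm P m k) (b : Asm P n l) →
        toList (blk a) ≡ toList (blk b) → toList (ps a) ≡ toList (ps b) → subst (E P) e (k , a) ≡ (l , b)
E-ext {k = k} {l} refl a b w≡ ps≡ with k≡l
  where
  k≡l : k ≡ l
  k≡l = trans (sym (length-toList (ps a))) (trans (cong List.length ps≡) (length-toList (ps b)))
... | refl = cong (k ,_) (asm-≡ (toList-inj w≡) (toList-inj ps≡))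
  where
  toList-inj : ∀ {A : Set} {n} {xs ys : Vec A n} → toList xs ≡ toList ys → xs ≡ ys
  toList-inj {xs = xs} {ys} eq = trans (sym (cast-is-id refl xs)) (toList-injective refl xs ys eq)

sel-singleton : ∀ {A : Set} {n} (t : Vec Bool n) (xs : Vec A n) (d : Fin n) →
                (∀ i → lookup t i ≡ (toℕ i ≡ᵇ toℕ d)) → toList (sel true t xs) ≡ lookup xs d ∷ []
sel-singleton (b ∷ t) (x ∷ xs) Fin.zero h with refl ← h Fin.zero
  = cong (x ∷_) (none t xs (h ∘ Fin.suc))
  where
  none : ∀ {A : Set} {n} (t : Vec Bool n) (xs : Vec A n) → (∀ i → lookup t i ≡ false) → toList (sel true t xs) ≡ []
  none [] [] _ = refl
  none (b ∷ t) (x ∷ xs) h with refl ← h Fin.zero = none t xs (h ∘ Fin.suc)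
sel-singleton (b ∷ t) (x ∷ xs) (Fin.suc d) h with refl ← h Fin.zero = sel-singleton t xs d (h ∘ Fin.suc)

restrictT-all : ∀ {P : ℕ → Set} {n k} (a : Asm P n k) →
                toList (blk (restrictT false a (replicate k false))) ≡ toList (blk a)
restrictT-all {k = k} a
  rewrite map-const (lookupOr-replicate k false) (blk a)
        | map-id-on (λ {x} x<k → rankIn-replicate false k {x} (<⇒≤ x<k)) (RGF-bound (asm-RGF a))
  = toList-sel-full false (blk a)

-- Translation by an element of the poset

module _ {Msp Osp : Species} (S : CMonop Msp Osp) where
  open CMonop S
  open Species Msp using () renaming (F to M)
  open Species Osp using () renaming (F to O)

  -- A single member forces `k` to be 1, so `w` is the unit `e`, and the right unit law of the
  -- operad applies. The result is a pair because the recorded size equals `n` only propositionally.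
  η-single : ∀ {n k} (a : Asm O n k) (w : O k) {p} → toList (ps a) ≡ p ∷ [] → _≡_ {A = Σ ℕ O} (n , η a w) p
  η-single {n} a@(asm v ((sz , ω) ∷ []) valid-a) w refl = lemma v≡0 (trans (asm-size a Fin.zero) (trans (cong (countVal 0) v≡0) (countVal-0 n))) valid-a
    where
    all0 : ∀ {n} {v : Vec ℕ n} → All (_< 1) v → v ≡ replicate n 0
    all0 [] = refl
    all0 (z<s ∷ bd) = cong (0 ∷_) (all0 bd)
    v≡0 : v ≡ replicate n 0
    v≡0 = all0 (RGF-bound (asm-RGF a))
    countVal-0 : ∀ n → countVal 0 (replicate n 0) ≡ n
    countVal-0 zero    = refl
    countVal-0 (suc n) = cong suc (countVal-0 n)
    lemma : ∀ {v sz} {ω : O sz} → v ≡ replicate n 0 → sz ≡ n → (p : T (validAsm {O} v ((sz , ω) ∷ []))) →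
            _≡_ {A = Σ ℕ O} (n , η (asm v ((sz , ω) ∷ []) p) w) (sz , ω)
    lemma {ω = ω} refl refl p = cong (n ,_) (trans (cong (η _) (O1-unique w)) (η-unitʳ n ω _ (mkAsm-just p)))

  -- With as many blocks as points `b` is discrete, so each fibre selects one member of `a` and
  -- `η-single` returns that member.
  etaBarT-discrete : ∀ {m k l} (a : Asm O m k) (b : Asm O k l) → l ≡ k → (l , etaBarT η a b) ≡ (k , a)
  etaBarT-discrete {k = k} a b refl = cong (k ,_) (asm-≡ (map-id-on blk-id (RGF-bound (asm-RGF a))) (lookup-ext λ d →
      trans (lookup∘tabulate (etaComponent η a b) d)
            (η-single (restrictT true a (fibre η b d)) _ (sel-singleton (fibre η b d) (ps a) d λ i →
              trans (lookup-map i (_≡ᵇ toℕ d) (blk b)) (cong (_≡ᵇ toℕ d) (blk≡ i))))))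
    where
    blk≡ : ∀ i → lookup (blk b) i ≡ toℕ i
    blk≡ = RGF-discrete (asm-RGF b) refl
    blk-id : ∀ {x} → x < k → lookupOr 0 (blk b) x ≡ x
    blk-id x<k = trans (cong (lookupOr 0 (blk b)) (sym (toℕ-fromℕ< x<k)))
      (trans (lookupOr-toℕ 0 (blk b) _) (trans (blk≡ _) (toℕ-fromℕ< x<k)))

  up : ∀ {n} (x : PP Msp Osp n) → PP Msp Osp (members x) → PP Msp Osp n
  up (pp s m (k , a)) (pp t m′ (l , b)) = pp (unionLift s (memSet a t))
    (ν (sel true (unionLift s (memSet a t)) s)
       (subst M (sel-cnt-true s (memSet a t)) m)
       (subst M (sel-cnt-false s (memSet a t)) (τ (restrictT true a t) m′)))
    (l , subst (λ z → Asm O z l) (unionLift-cnt-false s (memSet a t)) (etaBarT η (restrictT false a t) b))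

  rhoBar-just : ∀ {n} (x : PP Msp Osp n) t m′ c → rhoBar S x t m′ c ≡ just (up x (pp t m′ c))
  rhoBar-just (pp s m (k , a)) t m′ (l , b) =
    bind-just (restrict-just true a t)
    (bind-just (castM-just M _ (sel-cnt-true s (memSet a t)) _)
    (bind-just (castM-just M _ (sel-cnt-false s (memSet a t)) _)
    (bind-just (restrict-just false a t)
    (bind-just (etaBar-just η (restrictT false a t) b)
    (bind-just (castM-just (λ z → Asm O z l) _ (unionLift-cnt-false s (memSet a t)) _) refl)))))

  ≤P⇒up : ∀ {n} {x y : PP Msp Osp n} → _≤P_ S x y → ∃ λ z → up x z ≡ y
  ≤P⇒up {x = x} (t , m′ , c , eq) = pp t m′ c , just-injective (trans (sym (rhoBar-just x t m′ c)) eq)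

  up⇒≤P : ∀ {n} (x : PP Msp Osp n) z → _≤P_ S x (up x z)
  up⇒≤P x (pp t m′ c) = t , m′ , c , rhoBar-just x t m′ c

  pp-injective : ∀ {n} {s : Vec Bool n} {m m′ : M (cnt true s)} {c c′ : E O (cnt false s)} →
                 pp {Msp} {Osp} s m c ≡ pp s m′ c′ → m ≡ m′ × c ≡ c′
  pp-injective refl = refl , refl

  -- Layers are peeled from outside: the lifted subset gives `t`, cancelling ν and then τ gives the
  -- `M`-part, and cancelling η member by member gives the assembly.
  up-injective : ∀ {n} (x : PP Msp Osp n) z z′ → up x z ≡ up x z′ → z ≡ z′
  up-injective (pp s m (k , a)) (pp t m₁ (l , b)) (pp t′ m₁′ (l′ , b′)) eq
    with map-lookupOr-injective false (asm-RGF a) t t′ (unionLift-injective s _ _ (cong PP.sub eq)) | cong members eq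
  ... | refl | refl = cong₂ (λ m c → pp t m (l , c)) m≡ b≡
    where
    m≡ : m₁ ≡ m₁′
    m≡ = τ-cancel (restrictT true a t) m₁ m₁′ (subst-injective (sel-cnt-false s (memSet a t))
           (ν-cancel (sel true (unionLift s (memSet a t)) s) (subst M (sel-cnt-true s (memSet a t)) m) _ _ (proj₁ (pp-injective eq))))
    b≡ : b ≡ b′
    b≡ = etaBarT-injective η η-cancel (restrictT false a t) b b′ (subst-injective (unionLift-cnt-false s (memSet a t))
           (,-injectiveʳ-UIP ≡-irrelevant (proj₂ (pp-injective eq))))

  members≤n : ∀ {n} (z : PP Msp Osp n) → members z ≤ n
  members≤n (pp t _ (_ , b)) = ≤-trans (members≤ b) (cnt-false≤ t)

  -- The complement of a full subset is empty, so `m′` is a transported `𝔢` and the right unit law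
  -- applies.
  ν-full : ∀ {N n} (u : Vec Bool n) → u ≡ replicate n true → (N≡n : N ≡ n) (e : N ≡ cnt true u)
           (m : M N) (m′ : M (cnt false u)) → ν u (subst M e m) m′ ≡ subst M N≡n m
  ν-full {n = n} _ refl refl e m m′ = trans (cong (ν _ (subst M e m)) (empty cnt-false-0 m′)) (ν-unitʳ n m e (sym cnt-false-0))
    where
    cnt-false-0 : cnt false (replicate n true) ≡ 0
    cnt-false-0 = +-cancelˡ-≡ n _ _ (trans (cong (_+ cnt false (replicate n true)) (sym (cnt-replicate true n)))
                                      (trans (cnt-true+false (replicate n true)) (sym (+-identityʳ n))))
    empty : ∀ {N} (N≡0 : N ≡ 0) (m : M N) → m ≡ subst M (sym N≡0) 𝔢
    empty refl m = M∅-unique m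

  pp-≡ : ∀ {n} {s s′ : Vec Bool n} {m m′ c c′} (e : s ≡ s′) → m ≡ subst M (cong (cnt true) (sym e)) m′ →
         subst (E O) (cong (cnt false) e) c ≡ c′ → pp {Msp} {Osp} s m c ≡ pp s′ m′ c′
  pp-≡ refl refl refl = refl

  up-discrete : ∀ {n} (x : PP Msp Osp n) z → members z ≡ members x → up x z ≡ x
  up-discrete (pp s m (k , a)) (pp t m′ (l , b)) l≡k
    -- Here k = l ≤ `cnt false t` ≤ k, so `t` leaves every member of `x` in the second part.
    with cnt-false-full t (≤-antisym (cnt-false≤ t) (≤-trans (≤-reflexive (sym l≡k)) (members≤ b)))
  ... | refl = pp-≡ S≡ (ν-full _ s*≡ _ _ m _)
                 (E-ext-subst (unionLift-cnt-false s V) (cong (cnt false) S≡)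
                   (trans (cong (λ c → toList (blk (proj₂ c))) η≡) (restrictT-all a))
                   (trans (cong (λ c → toList (ps (proj₂ c))) η≡) (toList-sel-full false (ps a))))
    where
    V = memSet a (replicate k false)
    S≡ : unionLift s V ≡ s
    S≡ = trans (cong (unionLift s) (map-const (lookupOr-replicate k false) (blk a))) (unionLift-false s)
    s*≡ : sel true (unionLift s V) s ≡ replicate _ true
    s*≡ = subst (λ S′ → sel true S′ s ≡ replicate _ true) (sym S≡) (sel-self s)
    η≡ : (l , etaBarT η (restrictT false a (replicate k false)) b) ≡ (cnt false (replicate k false) , restrictT false a (replicate k false))
    η≡ = etaBarT-discrete (restrictT false a (replicate k false)) b (trans l≡k (sym (cnt-replicate false k)))
    E-ext-subst : ∀ {p q r k l} {a : Asm O p k} {b : Asm O r l} (e : p ≡ q) (e′ : q ≡ r) →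
                  toList (blk a) ≡ toList (blk b) → toList (ps a) ≡ toList (ps b) →
                  subst (E O) e′ (k , subst (λ z → Asm O z k) e a) ≡ (l , b)
    E-ext-subst refl e′ = E-ext e′ _ _

  discT : ∀ n → Asm O n n
  discT n = asm (tabulate toℕ) (replicate n (1 , e))
    (valid _ (replicate n (1 , e)) (rgf n 0) λ i → trans (cong proj₁ (lookup-replicate i (1 , e))) (sym (count n 0 (toℕ i) (toℕ<n i))))
    where
    -- The offset `s` makes the induction possible: the tail of the identity word is the identity
    -- word started one later.
    rgf : ∀ n s → RGF (s + n) s (tabulate {n = n} (λ i → s + toℕ i))
    rgf zero s = RGF-cong (sym (+-identityʳ s)) refl done
    rgf (suc n) s = RGF-new (+-identityʳ s) (subst₂ (λ z (w : Vec ℕ n) → RGF z (suc s) w) (sym (+-suc s n))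
                      (tabulate-cong λ i → sym (+-suc s (toℕ i))) (rgf n (suc s)))
    none : ∀ n s c → c < s → countVal c (tabulate {n = n} (λ i → s + toℕ i)) ≡ 0
    none zero s c c<s = refl
    none (suc n) s c c<s rewrite +-identityʳ s | ≢⇒≡ᵇ-false (>⇒≢ c<s) =
      trans (cong (countVal c) (tabulate-cong {n} λ i → +-suc s (toℕ i))) (none n (suc s) c (m<n⇒m<1+n c<s))
    count : ∀ n s i → i < n → countVal (s + i) (tabulate {n = n} (λ j → s + toℕ j)) ≡ 1
    count (suc n) s zero i<n rewrite +-identityʳ s | ≡ᵇ-refl s =
      cong suc (trans (cong (countVal s) (tabulate-cong {n} λ i → +-suc s (toℕ i))) (none n (suc s) s ≤-refl))
    count (suc n) s (suc i) i<n rewrite ≢⇒≡ᵇ-false {s + 0} {s + suc i} (λ eq → 0≢1+n (+-cancelˡ-≡ s _ _ eq)) =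
      trans (cong₂ (λ c (w : Vec ℕ n) → countVal c w) (+-suc s i) (tabulate-cong {n} λ i → +-suc s (toℕ i))) (count n (suc s) i (s<s⁻¹ i<n))

  disc-just : ∀ n → disc e n ≡ just (discT n)
  disc-just n = mkAsm-just (ok (discT n))

  bottom : ∀ n → ∃ λ z → hat0 S n ≡ just z × members z ≡ n
  bottom n = pp s (subst M cnt-true-0 𝔢) (cnt false s , discT (cnt false s)) ,
             bind-just (castM-just M _ cnt-true-0 𝔢) (bind-just (disc-just (cnt false s)) refl) , cnt-replicate false n
    where
    s = replicate n false
    cnt-true-0 : 0 ≡ cnt true s
    cnt-true-0 = sym (+-cancelʳ-≡ n _ _ (trans (cong (cnt true s +_) (sym (cnt-replicate false n))) (cnt-true+false s)))

-- Finite sums in a commutative ring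

module Sum {A : Set} {_⊕_ _⊛_ : A → A → A} {⊖_ : A → A} {0# 1# : A}
           (R : IsCommutativeRing _≡_ _⊕_ _⊛_ ⊖_ 0# 1#) where

  open IsCommutativeRing R using (zeroʳ; distribˡ) renaming (+-identityˡ to ⊕-identityˡ; +-identityʳ to ⊕-identityʳ; +-assoc to ⊕-assoc; +-comm to ⊕-comm; *-comm to ⊛-comm)
  open ≡-Reasoning

  -- Over the integers and the rationals this unfolds to `sumℤ (List.map f xs)` and
  -- `sumℚ (List.map f xs)`, so sums in the statement match without conversion.
  ∑ : ∀ {B : Set} → List B → (B → A) → A
  ∑ xs f = List.foldr _⊕_ 0# (List.map f xs)

  ∑-cong∈ : ∀ {B : Set} (xs : List B) {f g : B → A} → (∀ {x} → x ∈ xs → f x ≡ g x) → ∑ xs f ≡ ∑ xs g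
  ∑-cong∈ []       f≡g = refl
  ∑-cong∈ (x ∷ xs) f≡g = cong₂ _⊕_ (f≡g (here refl)) (∑-cong∈ xs (f≡g ∘ there))

  ∑-cong : ∀ {B : Set} (xs : List B) {f g : B → A} → (∀ x → f x ≡ g x) → ∑ xs f ≡ ∑ xs g
  ∑-cong xs f≡g = ∑-cong∈ xs λ {x} _ → f≡g x

  ∑-zero : ∀ {B : Set} (xs : List B) → ∑ xs (λ _ → 0#) ≡ 0#
  ∑-zero []       = refl
  ∑-zero (x ∷ xs) = trans (⊕-identityˡ _) (∑-zero xs)

  ⊕-interchange : ∀ a b c d → (a ⊕ b) ⊕ (c ⊕ d) ≡ (a ⊕ c) ⊕ (b ⊕ d)
  ⊕-interchange a b c d = begin
    (a ⊕ b) ⊕ (c ⊕ d)  ≡⟨ ⊕-assoc a b (c ⊕ d) ⟩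
    a ⊕ (b ⊕ (c ⊕ d))  ≡⟨ cong (a ⊕_) (⊕-assoc b c d) ⟨
    a ⊕ ((b ⊕ c) ⊕ d)  ≡⟨ cong (λ z → a ⊕ (z ⊕ d)) (⊕-comm b c) ⟩
    a ⊕ ((c ⊕ b) ⊕ d)  ≡⟨ cong (a ⊕_) (⊕-assoc c b d) ⟩
    a ⊕ (c ⊕ (b ⊕ d))  ≡⟨ ⊕-assoc a c (b ⊕ d) ⟨
    (a ⊕ c) ⊕ (b ⊕ d)  ∎

  ∑-⊕ : ∀ {B : Set} (xs : List B) (f g : B → A) → ∑ xs (λ x → f x ⊕ g x) ≡ ∑ xs f ⊕ ∑ xs g
  ∑-⊕ []       f g = sym (⊕-identityˡ 0#)
  ∑-⊕ (x ∷ xs) f g = trans (cong ((f x ⊕ g x) ⊕_) (∑-⊕ xs f g)) (⊕-interchange (f x) (g x) (∑ xs f) (∑ xs g))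

  ∑-*ˡ : ∀ {B : Set} (xs : List B) (c : A) (f : B → A) → ∑ xs (λ x → c ⊛ f x) ≡ c ⊛ ∑ xs f
  ∑-*ˡ []       c f = sym (zeroʳ c)
  ∑-*ˡ (x ∷ xs) c f = trans (cong ((c ⊛ f x) ⊕_) (∑-*ˡ xs c f)) (sym (distribˡ c (f x) (∑ xs f)))

  ∑-*ʳ : ∀ {B : Set} (xs : List B) (c : A) (f : B → A) → ∑ xs (λ x → f x ⊛ c) ≡ ∑ xs f ⊛ c
  ∑-*ʳ xs c f = trans (∑-cong xs λ x → ⊛-comm (f x) c) (trans (∑-*ˡ xs c f) (⊛-comm c (∑ xs f)))

  ∑-swap : ∀ {B C : Set} (xs : List B) (ys : List C) (f : B → C → A) →
           ∑ xs (λ x → ∑ ys (f x)) ≡ ∑ ys (λ y → ∑ xs λ x → f x y)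
  ∑-swap []       ys f = sym (∑-zero ys)
  ∑-swap (x ∷ xs) ys f = trans (cong (∑ ys (f x) ⊕_) (∑-swap xs ys f)) (sym (∑-⊕ ys (f x) λ y → ∑ xs λ x → f x y))

  ∑-filterB : ∀ {B : Set} (p : B → Bool) (xs : List B) (f : B → A) →
              ∑ (filterB p xs) f ≡ ∑ xs (λ x → if p x then f x else 0#)
  ∑-filterB p []       f = refl
  ∑-filterB p (x ∷ xs) f with p x
  ... | true  = cong (f x ⊕_) (∑-filterB p xs f)
  ... | false = trans (∑-filterB p xs f) (sym (⊕-identityˡ _))

  ∑-point : ∀ {B : Set} (p : B → Bool) {xs : List B} {x} (f : B → A) → Unique xs → x ∈ xs →
            p x ≡ true → (∀ y → p y ≡ true → y ≡ x) → ∑ xs (λ y → if p y then f y else 0#) ≡ f x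
  ∑-point p {x = x} f (x∉ ∷ u) (here {xs = xs} refl) px p! rewrite px =
    trans (cong (f x ⊕_) (trans (∑-cong∈ xs off) (∑-zero xs))) (⊕-identityʳ (f x))
    where
    off : ∀ {y} → y ∈ xs → (if p y then f y else 0#) ≡ 0#
    off {y} y∈ with p y in py
    ... | true  = contradiction (sym (p! y py)) (ListAll.lookup x∉ y∈)
    ... | false = refl
  ∑-point p {y ∷ xs} f (y∉ ∷ u) (there x∈) px p! with p y in py
  ... | true  = contradiction (p! y py) (ListAll.lookup y∉ x∈)
  ... | false = trans (⊕-identityˡ _) (∑-point p f u x∈ px p!)

  ∑-upTo-suc : ∀ n (f : ℕ → A) → ∑ (upTo (suc n)) f ≡ f 0 ⊕ ∑ (upTo n) (f ∘ suc)
  ∑-upTo-suc n f = cong (λ l → f 0 ⊕ List.foldr _⊕_ 0# l)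
    (trans (List.map-applyUpTo suc f n) (sym (List.map-upTo (f ∘ suc) n)))

  ∑-upTo-last : ∀ n (f : ℕ → A) → ∑ (upTo (suc n)) f ≡ ∑ (upTo n) f ⊕ f n
  ∑-upTo-last zero    f = ⊕-comm (f 0) 0#
  ∑-upTo-last (suc n) f = begin
    ∑ (upTo (suc (suc n))) f                 ≡⟨ ∑-upTo-suc (suc n) f ⟩
    f 0 ⊕ ∑ (upTo (suc n)) (f ∘ suc)         ≡⟨ cong (f 0 ⊕_) (∑-upTo-last n (f ∘ suc)) ⟩
    f 0 ⊕ (∑ (upTo n) (f ∘ suc) ⊕ f (suc n)) ≡⟨ ⊕-assoc (f 0) _ (f (suc n)) ⟨
    (f 0 ⊕ ∑ (upTo n) (f ∘ suc)) ⊕ f (suc n) ≡⟨ cong (_⊕ f (suc n)) (∑-upTo-suc n f) ⟨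
    ∑ (upTo (suc n)) f ⊕ f (suc n)           ∎

  ∑-drop : ∀ j m {f : ℕ → A} → (∀ {i} → i < j → f i ≡ 0#) → ∑ (upTo (j + m)) f ≡ ∑ (upTo m) (λ i → f (j + i))
  ∑-drop zero    m f≡0 = refl
  ∑-drop (suc j) m {f} f≡0 = trans (∑-upTo-suc (j + m) f)
    (trans (cong₂ _⊕_ (f≡0 z<s) (∑-drop j m (f≡0 ∘ s<s))) (⊕-identityˡ _))

-- Möbius function

filterB≡filter : ∀ {A : Set} (p : A → Bool) xs → filterB p xs ≡ List.filter (T? ∘ p) xs
filterB≡filter p [] = refl
filterB≡filter p (x ∷ xs) with p x
... | true  = cong (x ∷_) (filterB≡filter p xs)
... | false = filterB≡filter p xs

∈-filterB⁺ : ∀ {A : Set} (p : A → Bool) {xs x} → x ∈ xs → T (p x) → x ∈ filterB p xs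
∈-filterB⁺ p {xs} x∈ px = subst (_ ∈_) (sym (filterB≡filter p xs)) (∈-filter⁺ (T? ∘ p) x∈ px)

∈-filterB⁻ : ∀ {A : Set} (p : A → Bool) {xs x} → x ∈ filterB p xs → x ∈ xs × T (p x)
∈-filterB⁻ p {xs} x∈ = ∈-filter⁻ (T? ∘ p) (subst (_ ∈_) (filterB≡filter p xs) x∈)

lookup-injective : ∀ {A : Set} {xs : List A} → Unique xs → ∀ i j → List.lookup xs i ≡ List.lookup xs j → i ≡ j
lookup-injective (_ ∷ _) Fin.zero Fin.zero eq = refl
lookup-injective (x∉ ∷ u) Fin.zero (Fin.suc j) eq = contradiction eq (ListAll.lookup x∉ (∈-lookup j))
lookup-injective (x∉ ∷ u) (Fin.suc i) Fin.zero eq = contradiction (sym eq) (ListAll.lookup x∉ (∈-lookup i))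
lookup-injective (x∉ ∷ u) (Fin.suc i) (Fin.suc j) eq = cong Fin.suc (lookup-injective u i j eq)

T-subtype-≡ : ∀ {A : Set} {p : A → Bool} {x y : Σ A (T ∘ p)} → proj₁ x ≡ proj₁ y → x ≡ y
T-subtype-≡ {x = _ , px} {_ , py} refl = cong (_ ,_) (T-irrelevant px py)

size↔ : ∀ {A : Set} (En : FinEnum A) (p : A → Bool) →
        Σ A (T ∘ p) ↔ Fin (List.length (filterB p (FinEnum.elems En)))
size↔ En p = mk↔ₛ′ to from to∘from from∘to
  where
  open FinEnum En
  l = filterB p elems
  u : Unique l
  u = subst Unique (sym (filterB≡filter p elems)) (Unique.filter⁺ (T? ∘ p) unique)
  to : Σ _ (T ∘ p) → Fin (List.length l)
  to (x , px) = Any.index (∈-filterB⁺ p (complete x) px)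
  from : Fin (List.length l) → Σ _ (T ∘ p)
  from i = List.lookup l i , proj₂ (∈-filterB⁻ p {elems} (∈-lookup i))
  to∘from : ∀ i → to (from i) ≡ i
  to∘from i = lookup-injective u _ _ (sym (lookup-index (∈-filterB⁺ p (complete _) (proj₂ (from i)))))
  from∘to : ∀ x → from (to x) ≡ x
  from∘to (x , px) = T-subtype-≡ (sym (lookup-index (∈-filterB⁺ p (complete x) px)))

size-bijection : ∀ {A B : Set} (EnA : FinEnum A) (EnB : FinEnum B) (p : A → Bool) (q : B → Bool) (f : A → B) →
                 (∀ a a′ → f a ≡ f a′ → a ≡ a′) → (∀ a → T (p a) → T (q (f a))) →
                 (∀ b → T (q b) → Σ A λ a → f a ≡ b × T (p a)) →
                 List.length (filterB p (FinEnum.elems EnA)) ≡ List.length (filterB q (FinEnum.elems EnB))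
size-bijection EnA EnB p q f f-inj p⇒q preimage =
  ↔⇒≡ (↔-trans (↔-sym (size↔ EnA p)) (↔-trans (mk↔ₛ′ to from to∘from from∘to) (size↔ EnB q)))
  where
  to : Σ _ (T ∘ p) → Σ _ (T ∘ q)
  to (a , pa) = f a , p⇒q a pa
  from : Σ _ (T ∘ q) → Σ _ (T ∘ p)
  from (b , qb) = proj₁ (preimage b qb) , proj₂ (proj₂ (preimage b qb))
  to∘from : ∀ b → to (from b) ≡ b
  to∘from (b , qb) = T-subtype-≡ (proj₁ (proj₂ (preimage b qb)))
  from∘to : ∀ a → from (to a) ≡ a
  from∘to (a , pa) = T-subtype-≡ (f-inj _ a (proj₁ (proj₂ (preimage (f a) (p⇒q a pa)))))

filterB-length≤ : ∀ {A : Set} (p : A → Bool) xs → List.length (filterB p xs) ≤ List.length xs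
filterB-length≤ p [] = z≤n
filterB-length≤ p (x ∷ xs) with p x
... | true  = s≤s (filterB-length≤ p xs)
... | false = m≤n⇒m≤1+n (filterB-length≤ p xs)

filterB-mono : ∀ {A : Set} (p q : A → Bool) → (∀ x → T (p x) → T (q x)) → ∀ xs →
               List.length (filterB p xs) ≤ List.length (filterB q xs)
filterB-mono p q p⇒q [] = z≤n
filterB-mono p q p⇒q (x ∷ xs) with p x | q x | p⇒q x
... | true  | true  | _ = s≤s (filterB-mono p q p⇒q xs)
... | true  | false | h = contradiction (h _) λ ()
... | false | true  | _ = m≤n⇒m≤1+n (filterB-mono p q p⇒q xs)
... | false | false | _ = filterB-mono p q p⇒q xs

filterB-strict : ∀ {A : Set} (p q : A → Bool) → (∀ x → T (p x) → T (q x)) → ∀ {xs x} → x ∈ xs →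
                 ¬ T (p x) → T (q x) → List.length (filterB p xs) < List.length (filterB q xs)
filterB-strict p q p⇒q {x ∷ xs} (here refl) ¬px qx with p x | q x
... | true  | _    = contradiction _ ¬px
... | false | true = s≤s (filterB-mono p q p⇒q xs)
filterB-strict p q p⇒q {x ∷ xs} (there x∈) ¬px qx with p x | q x | p⇒q x
... | true  | true  | _ = s≤s (filterB-strict p q p⇒q x∈ ¬px qx)
... | true  | false | h = contradiction (h _) λ ()
... | false | true  | _ = m≤n⇒m≤1+n (filterB-strict p q p⇒q x∈ ¬px qx)
... | false | false | _ = filterB-strict p q p⇒q x∈ ¬px qx

-- The number of members will serve as `h`. It drops strictly along the order and is maximal at the
-- bottom `z`, so it controls descending chains.
module _ {A : Set} (En : FinEnum A) (_≼_ : A → A → Set) (_≼?_ : ∀ x y → Dec (x ≼ y)) (z : A)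
         (h : A → ℕ) (≼-refl : ∀ x → x ≼ x) (≼-strict : ∀ {x y} → x ≼ y → x ≢ y → h y < h x)
         (h≤ : ∀ x → h x ≤ h z) where

  open Sum ℤ.+-*-isCommutativeRing
  open FinEnum En
  open Möbius En _≼_ _≼?_ (just z)

  below : A → A → Bool
  below x y = does (y ≼? x) ∧ not (does (deq y x))

  below⇒ : ∀ {x y} → T (below x y) → h x < h y
  below⇒ {x} {y} b with y ≼? x | deq y x
  ... | yes y≼x | no y≢x = ≼-strict y≼x y≢x

  -- The fuel of `μ₀` is one more than the number of elements, so the recursion measure must not
  -- exceed that number. Values of `h` carry no such bound; counting the elements with larger `h`
  -- does.
  depth : A → ℕ
  depth x = List.length (filterB (λ y → h x <ᵇ h y) elems)

  -- h bounds chains, so the recursion for μf stops before the fuel runs out.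
  depth-below : ∀ {x y} → T (below x y) → depth y < depth x
  depth-below {x} {y} b = filterB-strict (λ w → h y <ᵇ h w) (λ w → h x <ᵇ h w)
    (λ w p → <⇒<ᵇ (<-trans (below⇒ b) (<ᵇ⇒< (h y) (h w) p))) (complete y)
    (λ p → <-irrefl refl (<ᵇ⇒< (h y) (h y) p)) (<⇒<ᵇ (below⇒ b))

  μf-stable : ∀ f f′ x → depth x < f → depth x < f′ → μf f x ≡ μf f′ x
  μf-stable (suc f) (suc f′) x d<f d<f′ with isZero x
  ... | true  = refl
  ... | false = cong ℤ.-_ (∑-cong∈ (filterB (below x) elems) λ {y} y∈ →
    let d = depth-below {x} {y} (proj₂ (∈-filterB⁻ (below x) {elems} y∈)) in
    μf-stable f f′ y (<-≤-trans d (s≤s⁻¹ d<f)) (<-≤-trans d (s≤s⁻¹ d<f′)))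

  -- Unfolding once leaves fuel `List.length elems`, which still exceeds the depth of every element
  -- strictly below `x`; so the remaining values are again `μ₀`.
  μ₀-rec : ∀ x → μ₀ x ≡ (if isZero x then 1ℤ else ℤ.- ∑ (filterB (below x) elems) μ₀)
  μ₀-rec x with isZero x
  ... | true  = refl
  ... | false = cong ℤ.-_ (∑-cong∈ (filterB (below x) elems) λ {y} y∈ →
    let d = <-≤-trans (depth-below {x} {y} (proj₂ (∈-filterB⁻ (below x) {elems} y∈)))
                      (filterB-length≤ (λ y → h x <ᵇ h y) elems) in
    μf-stable (List.length elems) (suc (List.length elems)) y d (m<n⇒m<1+n d))

  deq-refl : ∀ x → does (deq x x) ≡ true
  deq-refl x = dec-true (deq x x) refl

  ∑-below : ∀ x → ∑ elems (λ y → if does (y ≼? x) then μ₀ y else 0ℤ) ≡ ∑ (filterB (below x) elems) μ₀ ℤ.+ μ₀ x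
  ∑-below x = begin
    ∑ elems (λ y → if does (y ≼? x) then μ₀ y else 0ℤ)
      ≡⟨ ∑-cong elems split ⟩
    ∑ elems (λ y → (if below x y then μ₀ y else 0ℤ) ℤ.+ (if does (deq y x) then μ₀ y else 0ℤ))
      ≡⟨ ∑-⊕ elems _ _ ⟩
    ∑ elems (λ y → if below x y then μ₀ y else 0ℤ) ℤ.+ ∑ elems (λ y → if does (deq y x) then μ₀ y else 0ℤ)
      ≡⟨ cong₂ ℤ._+_ (sym (∑-filterB (below x) elems μ₀))
                     (∑-point (λ y → does (deq y x)) μ₀ unique (complete x) (deq-refl x) deq-true) ⟩
    ∑ (filterB (below x) elems) μ₀ ℤ.+ μ₀ x ∎
    where
    open ≡-Reasoning
    deq-true : ∀ y → does (deq y x) ≡ true → y ≡ x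
    deq-true y eq with deq y x
    ... | yes y≡x = y≡x
    split : ∀ y → (if does (y ≼? x) then μ₀ y else 0ℤ)
                  ≡ (if below x y then μ₀ y else 0ℤ) ℤ.+ (if does (deq y x) then μ₀ y else 0ℤ)
    split y with y ≼? x | deq y x
    ... | yes _   | yes _    = sym (ℤ.+-identityˡ (μ₀ y))
    ... | yes _   | no _     = sym (ℤ.+-identityʳ (μ₀ y))
    ... | no ¬y≼x | yes refl = contradiction (≼-refl x) ¬y≼x
    ... | no _    | no _     = refl

  -- Away from `z` the recursion makes `μ₀ x` cancel the sum strictly below `x`. At `z` that sum is
  -- empty, since an element strictly below would have `h` larger than `h z`.
  ∑-μ₀ : ∀ x → ∑ elems (λ y → if does (y ≼? x) then μ₀ y else 0ℤ) ≡ (if does (deq x z) then 1ℤ else 0ℤ)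
  ∑-μ₀ x rewrite ∑-below x | μ₀-rec x with deq x z
  ... | yes refl = cong (ℤ._+ 1ℤ) (trans (∑-filterB (below x) elems μ₀) (trans (∑-cong elems none) (∑-zero elems)))
    where
    none : ∀ y → (if below x y then μ₀ y else 0ℤ) ≡ 0ℤ
    none y with below x y in eq
    ... | true  = contradiction (below⇒ (subst T (sym eq) _)) (≤⇒≯ (h≤ y))
    ... | false = refl
  ... | no _ = ℤ.+-inverseʳ (∑ (filterB (below x) elems) μ₀)

-- The signed count as a left inverse

module _ {Msp Osp : Species} (S : CMonop Msp Osp) (En : ∀ n → FinEnum (PP Msp Osp n))
         (dec : ∀ n (x y : PP Msp Osp n) → Dec (_≤P_ S x y)) where
  open Matrices S En dec
  open FinEnum using (elems; complete; unique; deq)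
  open Sum ℤ.+-*-isCommutativeRing

  length-filterB : ∀ {A : Set} (p : A → Bool) xs → ℤ.+ List.length (filterB p xs) ≡ ∑ xs (λ x → if p x then 1ℤ else 0ℤ)
  length-filterB p [] = refl
  length-filterB p (x ∷ xs) with p x
  ... | true  = cong (ℤ._+_ 1ℤ) (length-filterB p xs)
  ... | false = trans (length-filterB p xs) (sym (ℤ.+-identityˡ _))

  -- up x is a bijection from PP (members x) onto the elements above x.
  Cnk-above : ∀ {n} (x : PP Msp Osp n) j →
              Cnk (members x) j ≡ ∑ (elems (En n)) (λ y → if does (dec n x y) ∧ (members y ≡ᵇ j) then 1ℤ else 0ℤ)
  Cnk-above {n} x j = trans
    (cong ℤ.+_ (size-bijection (En (members x)) (En n) (λ z → members z ≡ᵇ j) above (up S x) (up-injective S x)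
      (λ z p → Equivalence.from T-∧ (subst T (sym (dec-true (dec n x (up S x z)) (up⇒≤P S x z))) _ , p)) preimage))
    (length-filterB above (elems (En n)))
    where
    above : PP Msp Osp n → Bool
    above y = does (dec n x y) ∧ (members y ≡ᵇ j)
    does⇒ : ∀ {y} → T (does (dec n x y)) → _≤P_ S x y
    does⇒ {y} p with dec n x y
    ... | yes x≤y = x≤y
    preimage : ∀ y → T (above y) → Σ (PP Msp Osp (members x)) λ z → up S x z ≡ y × T (members z ≡ᵇ j)
    preimage y p = let (x≤y , y≡j) = Equivalence.to (T-∧ {does (dec n x y)} {members y ≡ᵇ j}) p
                       (z , eq) = ≤P⇒up S {x = x} {y} (does⇒ {y} x≤y)
                   in z , eq , subst (λ y → T (members y ≡ᵇ j)) (sym eq) y≡j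

  -- Of the bottom element on the set of members of `x` only its number of members matters here:
  -- `up-discrete` says that translating it by `x` gives `x`.
  ≤P-refl : ∀ {n} (x : PP Msp Osp n) → _≤P_ S x x
  ≤P-refl x with bottom S (members x)
  ... | z , _ , z≡k = subst (_≤P_ S x) (up-discrete S x z z≡k) (up⇒≤P S x z)

  ≤P-strict : ∀ {n} {x y : PP Msp Osp n} → _≤P_ S x y → x ≢ y → members y < members x
  ≤P-strict {x = x} {y} x≤y x≢y =
    let (z , eq) = ≤P⇒up S {x = x} {y} x≤y
    in subst (λ y → members y < members x) eq
         (≤∧≢⇒< (members≤n S z) λ z≡x → x≢y (trans (sym (up-discrete S x z z≡x)) eq))

  Ĉ*C : ∀ n j → ∑ (upTo (suc n)) (λ k → Ĉnk n k ℤ.* Cnk k j) ≡ δ n j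
  Ĉ*C n j with bottom S n
  ... | z , hat0≡ , z≡n = lemma (hat0 S n) hat0≡
    where
    open ≡-Reasoning
    es = elems (En n)
    μ = Möbius.μ₀ (En n) (_≤P_ S) (dec n) (just z)
    leq : PP Msp Osp n → PP Msp Osp n → Bool
    leq x y = does (dec n x y)
    expand : ∀ k x → (if members x ≡ᵇ k then μ x else 0ℤ) ℤ.* Cnk k j ≡ (if members x ≡ᵇ k then μ x ℤ.* Cnk k j else 0ℤ)
    expand k x with members x ≡ᵇ k
    ... | true  = refl
    ... | false = refl
    regroup : ∀ y → ∑ es (λ x → μ x ℤ.* (if leq x y ∧ (members y ≡ᵇ j) then 1ℤ else 0ℤ))
                    ≡ (if does (deq (En n) y z) then (if members y ≡ᵇ j then 1ℤ else 0ℤ) else 0ℤ)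
    regroup y with members y ≡ᵇ j
    ... | true = trans (∑-cong es ind)
                   (∑-μ₀ (En n) (_≤P_ S) (dec n) z members ≤P-refl ≤P-strict (λ x → ≤-trans (members≤n S x) (≤-reflexive (sym z≡n))) y)
      where
      ind : ∀ x → μ x ℤ.* (if leq x y ∧ true then 1ℤ else 0ℤ) ≡ (if leq x y then μ x else 0ℤ)
      ind x with leq x y
      ... | true  = ℤ.*-identityʳ (μ x)
      ... | false = ℤ.*-zeroʳ (μ x)
    ... | false = trans (∑-cong es ind) (trans (∑-zero es) (sym if-const))
      where
      ind : ∀ x → μ x ℤ.* (if leq x y ∧ false then 1ℤ else 0ℤ) ≡ 0ℤ
      ind x with leq x y
      ... | true  = ℤ.*-zeroʳ (μ x)
      ... | false = ℤ.*-zeroʳ (μ x)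
      if-const : (if does (deq (En n) y z) then 0ℤ else 0ℤ) ≡ 0ℤ
      if-const with does (deq (En n) y z)
      ... | true  = refl
      ... | false = refl
    deq-true : ∀ y → does (deq (En n) y z) ≡ true → y ≡ z
    deq-true y eq with deq (En n) y z
    ... | yes y≡z = y≡z
    -- `hat0 S n` is a `Maybe` on which the Möbius function depends; a variable in its place lets
    -- the equation with `just z` be matched.
    lemma : ∀ w → w ≡ just z → ∑ (upTo (suc n)) (λ k → Möbius.μsize (En n) (_≤P_ S) (dec n) w (λ x → members x ≡ᵇ k) ℤ.* Cnk k j) ≡ δ n j
    lemma _ refl = begin
      ∑ (upTo (suc n)) (λ k → ∑ (filterB (λ x → members x ≡ᵇ k) es) μ ℤ.* Cnk k j)
        ≡⟨ ∑-cong (upTo (suc n)) (λ k → trans (cong (ℤ._* Cnk k j) (∑-filterB (λ x → members x ≡ᵇ k) es μ))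
             (trans (sym (∑-*ʳ es (Cnk k j) (λ x → if members x ≡ᵇ k then μ x else 0ℤ))) (∑-cong es (expand k)))) ⟩
      ∑ (upTo (suc n)) (λ k → ∑ es λ x → if members x ≡ᵇ k then μ x ℤ.* Cnk k j else 0ℤ)
        ≡⟨ ∑-swap (upTo (suc n)) es (λ k x → if members x ≡ᵇ k then μ x ℤ.* Cnk k j else 0ℤ) ⟩
      ∑ es (λ x → ∑ (upTo (suc n)) λ k → if members x ≡ᵇ k then μ x ℤ.* Cnk k j else 0ℤ)
        -- Each `x` contributes to the single index k = `members x`, which is in range because it is
        -- at most `n`.
        ≡⟨ ∑-cong es (λ x → ∑-point (members x ≡ᵇ_) (λ k → μ x ℤ.* Cnk k j) (Unique.upTo⁺ (suc n)) (∈-upTo⁺ (s≤s (members≤n S x)))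
             (≡ᵇ-refl (members x)) λ k eq → sym (≡ᵇ⇒≡ (members x) k (subst T (sym eq) _))) ⟩
      ∑ es (λ x → μ x ℤ.* Cnk (members x) j)
        ≡⟨ ∑-cong es (λ x → trans (cong (μ x ℤ.*_) (Cnk-above x j)) (sym (∑-*ˡ es (μ x) (λ y → if leq x y ∧ (members y ≡ᵇ j) then 1ℤ else 0ℤ)))) ⟩
      ∑ es (λ x → ∑ es λ y → μ x ℤ.* (if leq x y ∧ (members y ≡ᵇ j) then 1ℤ else 0ℤ))
        ≡⟨ ∑-swap es es (λ x y → μ x ℤ.* (if leq x y ∧ (members y ≡ᵇ j) then 1ℤ else 0ℤ)) ⟩
      ∑ es (λ y → ∑ es λ x → μ x ℤ.* (if leq x y ∧ (members y ≡ᵇ j) then 1ℤ else 0ℤ))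
        ≡⟨ ∑-cong es regroup ⟩
      ∑ es (λ y → if does (deq (En n) y z) then (if members y ≡ᵇ j then 1ℤ else 0ℤ) else 0ℤ)
        ≡⟨ ∑-point (λ y → does (deq (En n) y z)) (λ y → if members y ≡ᵇ j then 1ℤ else 0ℤ) (unique (En n)) (complete (En n) z)
             (dec-true (deq (En n) z z) refl) deq-true ⟩
      (if members z ≡ᵇ j then 1ℤ else 0ℤ)
        ≡⟨ cong (λ m → if m ≡ᵇ j then 1ℤ else 0ℤ) z≡n ⟩
      δ n j ∎

-- Counting assemblies

-- This is the binomial sum of C(n,i) f(i, n - i), organised by Pascal's rule: the two summands
-- place the first element in the first or in the second part.
splitCount : (ℕ → ℕ → ℕ) → ℕ → ℕ
splitCount f zero    = f 0 0
splitCount f (suc n) = splitCount (λ i j → f (suc i) j) n + splitCount (λ i j → f i (suc j)) n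

subset↔ : ∀ (B : ℕ → ℕ → Set) (f : ℕ → ℕ → ℕ) → (∀ i j → B i j ↔ Fin (f i j)) →
          ∀ n → Σ (Vec Bool n) (λ s → B (cnt true s) (cnt false s)) ↔ Fin (splitCount f n)
subset↔ B f B↔ zero = ↔-trans (mk↔ₛ′ (λ { ([] , b) → b }) ([] ,_) (λ _ → refl) λ { ([] , b) → refl }) (B↔ 0 0)
subset↔ B f B↔ (suc n) =
  ↔-trans (mk↔ₛ′ to from to∘from from∘to)
  (↔-trans (subset↔ (λ i j → B (suc i) j) (λ i j → f (suc i) j) (λ i j → B↔ (suc i) j) n
            ⊎-↔ subset↔ (λ i j → B i (suc j)) (λ i j → f i (suc j)) (λ i j → B↔ i (suc j)) n)
           (↔-sym +↔⊎))
  where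
  Bs : Bool → Set
  Bs b = Σ (Vec Bool n) λ s → B (cnt true (b ∷ s)) (cnt false (b ∷ s))
  to : Σ (Vec Bool (suc n)) (λ s → B (cnt true s) (cnt false s)) → Bs true ⊎ Bs false
  to (true ∷ s , b)  = inj₁ (s , b)
  to (false ∷ s , b) = inj₂ (s , b)
  from : Bs true ⊎ Bs false → Σ (Vec Bool (suc n)) (λ s → B (cnt true s) (cnt false s))
  from (inj₁ (s , b)) = true ∷ s , b
  from (inj₂ (s , b)) = false ∷ s , b
  to∘from : ∀ y → to (from y) ≡ y
  to∘from (inj₁ _) = refl
  to∘from (inj₂ _) = refl
  from∘to : ∀ x → from (to x) ≡ x
  from∘to (true ∷ s , b)  = refl
  from∘to (false ∷ s , b) = refl

-- A word is encoded by the set of its zeros and its nonzero letters, lowered by one.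

unzero : ∀ {n} → Vec ℕ n → Σ (Vec Bool n) λ s → Vec ℕ (cnt false s)
unzero [] = [] , []
unzero (zero ∷ w)  = let (s , v) = unzero w in true ∷ s , v
unzero (suc x ∷ w) = let (s , v) = unzero w in false ∷ s , x ∷ v

rezero : ∀ {n} (s : Vec Bool n) → Vec ℕ (cnt false s) → Vec ℕ n
rezero [] _ = []
rezero (true ∷ s) v = zero ∷ rezero s v
rezero (false ∷ s) (x ∷ v) = suc x ∷ rezero s v

rezero∘unzero : ∀ {n} (w : Vec ℕ n) → rezero (proj₁ (unzero w)) (proj₂ (unzero w)) ≡ w
rezero∘unzero [] = refl
rezero∘unzero (zero ∷ w)  = cong (zero ∷_) (rezero∘unzero w)
rezero∘unzero (suc x ∷ w) = cong (suc x ∷_) (rezero∘unzero w)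

unzero∘rezero : ∀ {n} (s : Vec Bool n) v → unzero (rezero s v) ≡ (s , v)
unzero∘rezero [] [] = refl
unzero∘rezero (true ∷ s) v rewrite unzero∘rezero s v = refl
unzero∘rezero (false ∷ s) (x ∷ v) rewrite unzero∘rezero s v = refl

-- Once block 0 is open, a zero is always accepted, and any other letter is judged like its
-- predecessor with one block fewer.
rgfOK-rezero : ∀ {n} (s : Vec Bool n) v q k → rgfOK (suc q) (rezero s v) (suc k) ≡ rgfOK q v k
rgfOK-rezero [] [] q k = refl
rgfOK-rezero (true ∷ s) v q k = rgfOK-rezero s v q k
rgfOK-rezero (false ∷ s) (x ∷ v) q k with x <ᵇ q
... | true  = rgfOK-rezero s v q k
... | false with x ≡ᵇ q
...   | true  = rgfOK-rezero s v (suc q) k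
...   | false = refl

countVal-rezero-0 : ∀ {n} (s : Vec Bool n) v → countVal 0 (rezero s v) ≡ cnt true s
countVal-rezero-0 [] [] = refl
countVal-rezero-0 (true ∷ s) v = cong suc (countVal-rezero-0 s v)
countVal-rezero-0 (false ∷ s) (x ∷ v) = countVal-rezero-0 s v

countVal-rezero-suc : ∀ {n} (s : Vec Bool n) v j → countVal (suc j) (rezero s v) ≡ countVal j v
countVal-rezero-suc [] [] j = refl
countVal-rezero-suc (true ∷ s) v j = countVal-rezero-suc s v j
countVal-rezero-suc (false ∷ s) (x ∷ v) j with x ≡ᵇ j
... | true  = cong suc (countVal-rezero-suc s v j)
... | false = countVal-rezero-suc s v j

module _ {P : ℕ → Set} where

  sizesOK-rezero : ∀ {n k} (s : Vec Bool n) v j (ps : Vec (Σ ℕ P) k) →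
                   sizesOK (suc j) (0 ∷ rezero s v) ps ≡ sizesOK j v ps
  sizesOK-rezero s v j [] = refl
  sizesOK-rezero s v j ((sz , _) ∷ ps) =
    cong₂ (λ c r → (sz ≡ᵇ c) ∧ r) (countVal-rezero-suc s v j) (sizesOK-rezero s v (suc j) ps)

  -- The leading 0 opens block 0, and the `suc` in the size of this block counts the least element
  -- itself.
  valid-rezero : ∀ {n k} (s : Vec Bool n) v o (ps : Vec (Σ ℕ P) k) →
                 validAsm (0 ∷ rezero s v) ((suc (cnt true s) , o) ∷ ps) ≡ validAsm v ps
  valid-rezero {k = k} s v o ps
    rewrite rgfOK-rezero s v 0 k | countVal-rezero-0 s v | ≡ᵇ-refl (cnt true s) | sizesOK-rezero s v 0 ps = refl

  Rooted : ℕ → ℕ → Set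
  Rooted n k = Σ (Vec Bool n) λ s → P (suc (cnt true s)) × Asm P (cnt false s) k

  -- s holds the companions of the least element in its block.
  graft : ∀ {n k} → Rooted n k → Asm P (suc n) (suc k)
  graft (s , o , asm v ps p) =
    asm (0 ∷ rezero s v) ((suc (cnt true s) , o) ∷ ps) (subst T (sym (valid-rezero s v o ps)) p)

  graft-injective : ∀ {n k} (x y : Rooted n k) → graft x ≡ graft y → x ≡ y
  graft-injective (s , o , asm v ps p) (s′ , o′ , asm v′ ps′ p′) eq
    with trans (sym (unzero∘rezero s v)) (trans (cong (unzero ∘ Vec.tail ∘ blk) eq) (unzero∘rezero s′ v′))
  ... | refl with cong (Vec.head ∘ Asm.ps) eq | cong (Vec.tail ∘ Asm.ps) eq
  ...   | refl | refl = cong (λ q → s , o , asm v ps q) (T-irrelevant p p′)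

  graft-surjective : ∀ {n k} (a : Asm P (suc n) (suc k)) → Σ (Rooted n k) λ x → graft x ≡ a
  -- A restricted growth word starts with 0, so this validity proof has an empty type.
  graft-surjective {n} {k} (asm (suc x ∷ w) (_ ∷ ps) ())
  graft-surjective {n} {k} a@(asm (zero ∷ w) ((sz , o) ∷ ps) p) =
    -- The word and the recorded size are generalised together with the validity proof, so that both
    -- can be replaced by the values that `graft` produces.
    lemma (proj₁ (unzero w)) (proj₂ (unzero w)) (sym (rezero∘unzero w))
          (trans (asm-size a Fin.zero) (cong (suc ∘ countVal 0) (sym (rezero∘unzero w)))) p
    where
    lemma : ∀ s v {w sz} {o : P sz} → w ≡ rezero s v → sz ≡ suc (countVal 0 (rezero s v)) →
            (p : T (validAsm (zero ∷ w) ((sz , o) ∷ ps))) → Σ (Rooted n k) λ x → graft x ≡ asm (zero ∷ w) ((sz , o) ∷ ps) p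
    lemma s v {o = o} refl sz≡ p with trans sz≡ (cong suc (countVal-rezero-0 s v))
    ... | refl = (s , o , asm v ps (subst T (valid-rezero s v o ps) p)) , asm-≡ refl refl

  graft↔ : ∀ n k → Asm P (suc n) (suc k) ↔ Rooted n k
  graft↔ n k = ↔-sym (mk↔ₛ′ graft (proj₁ ∘ graft-surjective) (proj₂ ∘ graft-surjective)
                 λ x → graft-injective _ x (proj₂ (graft-surjective (graft x))))

-- The numerical form of `graft↔`: `i` companions share the block of the least element. The number
-- of members comes first so that `asmCount o k` is a sequence to which `egf` applies.
asmCount : (ℕ → ℕ) → ℕ → ℕ → ℕ
asmCount o zero    zero    = 1
asmCount o zero    (suc n) = 0
asmCount o (suc k) zero    = 0
asmCount o (suc k) (suc n) = splitCount (λ i j → o (suc i) * asmCount o k j) n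

empty↔ : ∀ {A : Set} → ¬ A → A ↔ Fin 0
empty↔ ¬a = mk↔ₛ′ (λ a → contradiction a ¬a) (λ ()) (λ ()) (λ a → contradiction a ¬a)

×-count : ∀ {A B : Set} {m n} → A ↔ Fin m → B ↔ Fin n → (A × B) ↔ Fin (m * n)
×-count A↔ B↔ = ↔-trans (A↔ ×-↔ B↔) (↔-sym *↔×)

asm↔ : ∀ {P : ℕ → Set} {o : ℕ → ℕ} → (∀ n → P n ↔ Fin (o n)) → ∀ k n → Asm P n k ↔ Fin (asmCount o k n)
asm↔ P↔ zero zero = mk↔ₛ′ (λ _ → Fin.zero) (λ _ → asm [] [] _) (λ { Fin.zero → refl ; (Fin.suc ()) }) (λ { (asm [] [] _) → refl })
asm↔ P↔ zero (suc n) = empty↔ λ a → no-block (RGF-bound (asm-RGF a))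
  where
  no-block : ∀ {n} {w : Vec ℕ (suc n)} → ¬ All (_< 0) w
  no-block (() ∷ _)
asm↔ P↔ (suc k) zero = empty↔ λ a → contradiction (members≤ a) λ ()
asm↔ {P} P↔ (suc k) (suc n) = ↔-trans (graft↔ n k)
  (subset↔ (λ i j → P (suc i) × Asm P j k) _ (λ i j → ×-count (P↔ (suc i)) (asm↔ P↔ k j)) n)

module _ {Msp Osp : Species} (S : CMonop Msp Osp) (En : ∀ n → FinEnum (PP Msp Osp n))
         (dec : ∀ n (x y : PP Msp Osp n) → Dec (_≤P_ S x y)) where
  open Species Msp using () renaming (F to M; card to cardM; finite to finiteM)
  open Species Osp using () renaming (F to O; card to cardO; finite to finiteO)

  Cnk-count : ∀ n k → Matrices.Cnk S En dec n k ≡ ℤ.+ splitCount (λ i j → cardM i * asmCount cardO k j) n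
  Cnk-count n k = cong ℤ.+_ (↔⇒≡ (↔-trans (↔-sym (size↔ (En n) (λ x → members x ≡ᵇ k)))
    (↔-trans (mk↔ₛ′ to from to∘from from∘to)
      (subset↔ (λ i j → M i × Asm O j k) _ (λ i j → ×-count (finiteM i) (asm↔ finiteO k j)) n))))
    where
    to : Σ (PP Msp Osp n) (λ x → T (members x ≡ᵇ k)) → Σ (Vec Bool n) (λ s → M (cnt true s) × Asm O (cnt false s) k)
    to (pp s m (l , a) , p) = s , m , subst (Asm O (cnt false s)) (≡ᵇ⇒≡ l k p) a
    from : Σ (Vec Bool n) (λ s → M (cnt true s) × Asm O (cnt false s) k) → Σ (PP Msp Osp n) (λ x → T (members x ≡ᵇ k))
    from (s , m , a) = pp s m (k , a) , ≡⇒≡ᵇ k k refl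
    to∘from : ∀ y → to (from y) ≡ y
    to∘from (s , m , a) = cong (λ e → s , m , subst (Asm O (cnt false s)) e a) (≡-irrelevant (≡ᵇ⇒≡ k k (≡⇒≡ᵇ k k refl)) refl)
    from∘to : ∀ x → from (to x) ≡ x
    from∘to (pp s m (l , a) , p) = T-subtype-≡ (cong (pp s m) (lemma (≡ᵇ⇒≡ l k p)))
      where
      lemma : ∀ {l} {a : Asm O (cnt false s) l} (e : l ≡ k) → (k , subst (Asm O (cnt false s)) e a) ≡ (l , a)
      lemma refl = refl

module ∑ℤ = Sum ℤ.+-*-isCommutativeRing
open Sum ℚ.+-*-isCommutativeRing

-- Formal power series

-- Rationals are kept in lowest terms, which obscures sums of fractions; the identity is checked
-- among unnormalised fractions, up to their equivalence.
fromℚᵘ-homo-+ : ∀ p q → ℚ.fromℚᵘ (p ℚᵘ.+ q) ≡ ℚ.fromℚᵘ p ℚ.+ ℚ.fromℚᵘ q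
fromℚᵘ-homo-+ p q = ℚ.toℚᵘ-injective (ℚᵘ.≃-trans (ℚ.toℚᵘ-fromℚᵘ (p ℚᵘ.+ q))
  (ℚᵘ.≃-sym (ℚᵘ.≃-trans (ℚ.toℚᵘ-homo-+ (ℚ.fromℚᵘ p) (ℚ.fromℚᵘ q)) (ℚᵘ.+-cong (ℚ.toℚᵘ-fromℚᵘ p) (ℚ.toℚᵘ-fromℚᵘ q)))))

fromℚᵘ-homo-* : ∀ p q → ℚ.fromℚᵘ (p ℚᵘ.* q) ≡ ℚ.fromℚᵘ p ℚ.* ℚ.fromℚᵘ q
fromℚᵘ-homo-* p q = ℚ.toℚᵘ-injective (ℚᵘ.≃-trans (ℚ.toℚᵘ-fromℚᵘ (p ℚᵘ.* q))
  (ℚᵘ.≃-sym (ℚᵘ.≃-trans (ℚ.toℚᵘ-homo-* (ℚ.fromℚᵘ p) (ℚ.fromℚᵘ q)) (ℚᵘ.*-cong (ℚ.toℚᵘ-fromℚᵘ p) (ℚ.toℚᵘ-fromℚᵘ q)))))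

ℤ→ℚ-+ : ∀ a b → ℤ→ℚ (a ℤ.+ b) ≡ ℤ→ℚ a ℚ.+ ℤ→ℚ b
ℤ→ℚ-+ a b = trans (cong ℤ→ℚ (sym (cong₂ ℤ._+_ (ℤ.*-identityʳ a) (ℤ.*-identityʳ b)))) (fromℚᵘ-homo-+ (mkℚᵘ a 0) (mkℚᵘ b 0))

ℤ→ℚ-* : ∀ a b → ℤ→ℚ (a ℤ.* b) ≡ ℤ→ℚ a ℚ.* ℤ→ℚ b
ℤ→ℚ-* a b = fromℚᵘ-homo-* (mkℚᵘ a 0) (mkℚᵘ b 0)

ℤ→ℚ-injective : ∀ {a b} → ℤ→ℚ a ≡ ℤ→ℚ b → a ≡ b
ℤ→ℚ-injective {a} {b} eq with ℚ./-injective-≃ (mkℚᵘ a 0) (mkℚᵘ b 0) eq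
... | *≡* a*1≡b*1 = trans (sym (ℤ.*-identityʳ a)) (trans a*1≡b*1 (ℤ.*-identityʳ b))

/-* : ∀ a d .{{_ : NonZero d}} → a ℚ./ d ≡ ℤ→ℚ a ℚ.* (ℤ.+ 1 ℚ./ d)
/-* a (suc d) = trans (ℚ.fromℚᵘ-cong {mkℚᵘ a d} {mkℚᵘ a 0 ℚᵘ.* mkℚᵘ (ℤ.+ 1) d}
    (*≡* (cong₂ ℤ._*_ (sym (ℤ.*-identityʳ a)) (cong (λ z → ℤ.+ suc z) (+-identityʳ d)))))
  (fromℚᵘ-homo-* (mkℚᵘ a 0) (mkℚᵘ (ℤ.+ 1) d))

ℕ→ℚ : ℕ → ℚ
ℕ→ℚ n = ℤ→ℚ (ℤ.+ n)

ℕ→ℚ-+ : ∀ m n → ℕ→ℚ (m + n) ≡ ℕ→ℚ m ℚ.+ ℕ→ℚ n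
ℕ→ℚ-+ m n = ℤ→ℚ-+ (ℤ.+ m) (ℤ.+ n)

ℕ→ℚ-* : ∀ m n → ℕ→ℚ (m * n) ≡ ℕ→ℚ m ℚ.* ℕ→ℚ n
ℕ→ℚ-* m n = trans (cong ℤ→ℚ (ℤ.pos-* m n)) (ℤ→ℚ-* (ℤ.+ m) (ℤ.+ n))

*-1/ : ∀ d .{{_ : NonZero d}} → ℕ→ℚ d ℚ.* (ℤ.+ 1 ℚ./ d) ≡ 1ℚ
*-1/ d@(suc d-1) = trans (sym (/-* (ℤ.+ d) d))
  (ℚ.fromℚᵘ-cong {mkℚᵘ (ℤ.+ d) d-1} {mkℚᵘ (ℤ.+ 1) 0} (*≡* (trans (ℤ.*-identityʳ (ℤ.+ d)) (sym (ℤ.*-identityˡ (ℤ.+ d))))))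

1/! : ℕ → ℚ
1/! n = ℚ._/_ (ℤ.+ 1) (n !) {{n !≢0}}

!*1/! : ∀ n → ℕ→ℚ (n !) ℚ.* 1/! n ≡ 1ℚ
!*1/! n = *-1/ (n !) {{n !≢0}}

suc*1/! : ∀ n → ℕ→ℚ (suc n) ℚ.* 1/! (suc n) ≡ 1/! n
suc*1/! n = begin
  s ℚ.* f′                    ≡⟨ ℚ.*-identityˡ _ ⟨
  1ℚ ℚ.* (s ℚ.* f′)           ≡⟨ cong (ℚ._* (s ℚ.* f′)) (!*1/! n) ⟨
  (g ℚ.* f) ℚ.* (s ℚ.* f′)    ≡⟨ solve 4 (λ s f f′ g → (g :* f) :* (s :* f′) := f :* ((s :* g) :* f′)) refl s f f′ g ⟩
  f ℚ.* ((s ℚ.* g) ℚ.* f′)    ≡⟨ cong (λ z → f ℚ.* (z ℚ.* f′)) (ℕ→ℚ-* (suc n) (n !)) ⟨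
  f ℚ.* (ℕ→ℚ (suc n !) ℚ.* f′) ≡⟨ cong (f ℚ.*_) (!*1/! (suc n)) ⟩
  f ℚ.* 1ℚ                    ≡⟨ ℚ.*-identityʳ f ⟩
  f                           ∎
  where
  open ≡-Reasoning
  s = ℕ→ℚ (suc n)
  f = 1/! n
  f′ = 1/! (suc n)
  g = ℕ→ℚ (n !)

suc-cancel : ∀ n {p q} → ℕ→ℚ (suc n) ℚ.* p ≡ ℕ→ℚ (suc n) ℚ.* q → p ≡ q
suc-cancel n {p} {q} eq = trans (lemma p) (trans (cong (u ℚ.*_) eq) (sym (lemma q)))
  where
  u = ℤ.+ 1 ℚ./ suc n
  lemma : ∀ p → p ≡ u ℚ.* (ℕ→ℚ (suc n) ℚ.* p)
  lemma p = trans (sym (ℚ.*-identityˡ p)) (trans (cong (ℚ._* p) (sym (*-1/ (suc n))))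
    (solve 3 (λ u s p → (s :* u) :* p := u :* (s :* p)) refl u (ℕ→ℚ (suc n)) p))

infix 4 _≐_

_≐_ : Series → Series → Set
f ≐ g = ∀ n → f n ≡ g n

tailS : Series → Series
tailS f n = f (suc n)

addS : Series → Series → Series
addS f g n = f n ℚ.+ g n

scaleS : ℚ → Series → Series
scaleS c f n = c ℚ.* f n

mulS-0 : ∀ f g → mulS f g 0 ≡ f 0 ℚ.* g 0
mulS-0 f g = ℚ.+-identityʳ _

mulS-suc : ∀ f g n → mulS f g (suc n) ≡ f 0 ℚ.* g (suc n) ℚ.+ mulS (tailS f) g n
mulS-suc f g n = ∑-upTo-suc (suc n) (λ i → f i ℚ.* g (suc n ∸ i))

mulS-cong≤ : ∀ {f f′ g g′} n → (∀ i → i ≤ n → f i ≡ f′ i) → (∀ i → i ≤ n → g i ≡ g′ i) → mulS f g n ≡ mulS f′ g′ n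
mulS-cong≤ n f≡ g≡ = ∑-cong∈ (upTo (suc n)) λ {i} i∈ → cong₂ ℚ._*_ (f≡ i (s≤s⁻¹ (∈-upTo⁻ i∈))) (g≡ (n ∸ i) (m∸n≤m n i))

mulS-congˡ : ∀ {f f′} g → f ≐ f′ → mulS f g ≐ mulS f′ g
mulS-congˡ {f} {f′} g f≡ n = mulS-cong≤ {f} {f′} {g} {g} n (λ i _ → f≡ i) (λ _ _ → refl)

mulS-congʳ : ∀ f {g g′} → g ≐ g′ → mulS f g ≐ mulS f g′
mulS-congʳ f {g} {g′} g≡ n = mulS-cong≤ {f} {f} {g} {g′} n (λ _ _ → refl) (λ i _ → g≡ i)

mulS-suc′ : ∀ f g n → mulS f g (suc n) ≡ mulS f (tailS g) n ℚ.+ f (suc n) ℚ.* g 0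
mulS-suc′ f g n = trans (∑-upTo-last (suc n) (λ i → f i ℚ.* g (suc n ∸ i))) (cong₂ ℚ._+_
  (∑-cong∈ (upTo (suc n)) λ {i} i∈ → cong (λ z → f i ℚ.* g z) (∸-suc (s≤s⁻¹ (∈-upTo⁻ i∈))))
  (cong (λ z → f (suc n) ℚ.* g z) (n∸n≡0 n)))
  where
  ∸-suc : ∀ {i n} → i ≤ n → suc n ∸ i ≡ suc (n ∸ i)
  ∸-suc i≤n = +-∸-assoc 1 i≤n

mulS-comm : ∀ f g → mulS f g ≐ mulS g f
mulS-comm f g zero    = trans (mulS-0 f g) (trans (ℚ.*-comm (f 0) (g 0)) (sym (mulS-0 g f)))
mulS-comm f g (suc n) = begin
  mulS f g (suc n)                              ≡⟨ mulS-suc f g n ⟩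
  f 0 ℚ.* g (suc n) ℚ.+ mulS (tailS f) g n      ≡⟨ cong₂ ℚ._+_ (ℚ.*-comm (f 0) (g (suc n))) (mulS-comm (tailS f) g n) ⟩
  g (suc n) ℚ.* f 0 ℚ.+ mulS g (tailS f) n      ≡⟨ ℚ.+-comm (g (suc n) ℚ.* f 0) (mulS g (tailS f) n) ⟩
  mulS g (tailS f) n ℚ.+ g (suc n) ℚ.* f 0      ≡⟨ mulS-suc′ g f n ⟨
  mulS g f (suc n)                              ∎
  where open ≡-Reasoning

mulS-addˡ : ∀ f g h → mulS (addS f g) h ≐ addS (mulS f h) (mulS g h)
mulS-addˡ f g h n = trans (∑-cong (upTo (suc n)) λ i → ℚ.*-distribʳ-+ (h (n ∸ i)) (f i) (g i)) (∑-⊕ (upTo (suc n)) (λ i → f i ℚ.* h (n ∸ i)) (λ i → g i ℚ.* h (n ∸ i)))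

mulS-scaleˡ : ∀ c f g → mulS (scaleS c f) g ≐ scaleS c (mulS f g)
mulS-scaleˡ c f g n = trans (∑-cong (upTo (suc n)) λ i → ℚ.*-assoc c (f i) (g (n ∸ i))) (∑-*ˡ (upTo (suc n)) c _)

mulS-scaleʳ : ∀ c f g → mulS f (scaleS c g) ≐ scaleS c (mulS f g)
mulS-scaleʳ c f g n = trans (mulS-comm f (scaleS c g) n) (trans (mulS-scaleˡ c g f n) (cong (c ℚ.*_) (mulS-comm g f n)))

mulS-zeroˡ : ∀ {f} g → (∀ n → f n ≡ 0ℚ) → ∀ n → mulS f g n ≡ 0ℚ
mulS-zeroˡ g f≡0 n = trans (∑-cong (upTo (suc n)) λ i → trans (cong (ℚ._* g (n ∸ i)) (f≡0 i)) (ℚ.*-zeroˡ (g (n ∸ i)))) (∑-zero (upTo (suc n)))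

mulS-oneˡ : ∀ f → mulS oneS f ≐ f
mulS-oneˡ f zero    = trans (mulS-0 oneS f) (ℚ.*-identityˡ (f 0))
mulS-oneˡ f (suc n) = trans (mulS-suc oneS f n)
  (trans (cong₂ ℚ._+_ (ℚ.*-identityˡ (f (suc n))) (mulS-zeroˡ f (λ _ → refl) n)) (ℚ.+-identityʳ (f (suc n))))

mulS-oneʳ : ∀ f → mulS f oneS ≐ f
mulS-oneʳ f n = trans (mulS-comm f oneS n) (mulS-oneˡ f n)

mulS-assoc : ∀ f g h → mulS (mulS f g) h ≐ mulS f (mulS g h)
mulS-assoc f g h zero = trans (mulS-0 (mulS f g) h) (trans (cong (ℚ._* h 0) (mulS-0 f g))
  (trans (ℚ.*-assoc (f 0) (g 0) (h 0)) (sym (trans (mulS-0 f (mulS g h)) (cong (f 0 ℚ.*_) (mulS-0 g h))))))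
mulS-assoc f g h (suc n) = begin
  mulS (mulS f g) h (suc n)
    ≡⟨ mulS-suc (mulS f g) h n ⟩
  mulS f g 0 ℚ.* h (suc n) ℚ.+ mulS (tailS (mulS f g)) h n
    ≡⟨ cong₂ ℚ._+_ (cong (ℚ._* h (suc n)) (mulS-0 f g)) (mulS-congˡ h (mulS-suc f g) n) ⟩
  (f 0 ℚ.* g 0) ℚ.* h (suc n) ℚ.+ mulS (addS (scaleS (f 0) (tailS g)) (mulS (tailS f) g)) h n
    ≡⟨ cong ((f 0 ℚ.* g 0) ℚ.* h (suc n) ℚ.+_) (trans (mulS-addˡ (scaleS (f 0) (tailS g)) (mulS (tailS f) g) h n)
         (cong₂ ℚ._+_ (mulS-scaleˡ (f 0) (tailS g) h n) (mulS-assoc (tailS f) g h n))) ⟩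
  (f 0 ℚ.* g 0) ℚ.* h (suc n) ℚ.+ (f 0 ℚ.* mulS (tailS g) h n ℚ.+ mulS (tailS f) (mulS g h) n)
    ≡⟨ solve 5 (λ a b c d e → (a :* b) :* c :+ (a :* d :+ e) := a :* (b :* c :+ d) :+ e) refl
         (f 0) (g 0) (h (suc n)) (mulS (tailS g) h n) (mulS (tailS f) (mulS g h) n) ⟩
  f 0 ℚ.* (g 0 ℚ.* h (suc n) ℚ.+ mulS (tailS g) h n) ℚ.+ mulS (tailS f) (mulS g h) n
    ≡⟨ cong (λ z → f 0 ℚ.* z ℚ.+ mulS (tailS f) (mulS g h) n) (mulS-suc g h n) ⟨
  f 0 ℚ.* mulS g h (suc n) ℚ.+ mulS (tailS f) (mulS g h) n
    ≡⟨ mulS-suc f (mulS g h) n ⟨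
  mulS f (mulS g h) (suc n) ∎
  where open ≡-Reasoning

-- The Euler operator x d/dx. It keeps degrees, so its product rule is the termwise identity n = i +
-- (n - i); shifting it gives the derivative `D`.
θ : Series → Series
θ f n = ℕ→ℚ n ℚ.* f n

D : Series → Series
D f = tailS (θ f)

θ-mulS : ∀ f g n → θ (mulS f g) n ≡ mulS (θ f) g n ℚ.+ mulS f (θ g) n
θ-mulS f g n = begin
  ℕ→ℚ n ℚ.* mulS f g n
    ≡⟨ ∑-*ˡ (upTo (suc n)) (ℕ→ℚ n) (λ i → f i ℚ.* g (n ∸ i)) ⟨
  ∑ (upTo (suc n)) (λ i → ℕ→ℚ n ℚ.* (f i ℚ.* g (n ∸ i)))
    ≡⟨ ∑-cong∈ (upTo (suc n)) (λ {i} i∈ → trans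
         (cong (ℚ._* (f i ℚ.* g (n ∸ i))) (trans (cong ℕ→ℚ (sym (m+[n∸m]≡n (s≤s⁻¹ (∈-upTo⁻ i∈))))) (ℕ→ℚ-+ i (n ∸ i))))
         (solve 4 (λ a b c d → (a :+ b) :* (c :* d) := (a :* c) :* d :+ c :* (b :* d)) refl (ℕ→ℚ i) (ℕ→ℚ (n ∸ i)) (f i) (g (n ∸ i)))) ⟩
  ∑ (upTo (suc n)) (λ i → θ f i ℚ.* g (n ∸ i) ℚ.+ f i ℚ.* θ g (n ∸ i))
    ≡⟨ ∑-⊕ (upTo (suc n)) (λ i → θ f i ℚ.* g (n ∸ i)) (λ i → f i ℚ.* θ g (n ∸ i)) ⟩
  mulS (θ f) g n ℚ.+ mulS f (θ g) n ∎
  where open ≡-Reasoning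

D-mulS : ∀ f g n → D (mulS f g) n ≡ mulS (D f) g n ℚ.+ mulS f (D g) n
D-mulS f g n = trans (θ-mulS f g (suc n)) (cong₂ ℚ._+_
  (trans (mulS-suc (θ f) g n) (trans (cong (ℚ._+ mulS (D f) g n) (trans (cong (ℚ._* g (suc n)) (ℚ.*-zeroˡ (f 0))) (ℚ.*-zeroˡ (g (suc n)))))
    (ℚ.+-identityˡ (mulS (D f) g n))))
  (trans (mulS-suc′ f (θ g) n) (trans (cong (mulS f (D g) n ℚ.+_) (trans (cong (f (suc n) ℚ.*_) (ℚ.*-zeroˡ (g 0))) (ℚ.*-zeroʳ (f (suc n)))))
    (ℚ.+-identityʳ (mulS f (D g) n)))))

D-ext : ∀ {f g} → f 0 ≡ g 0 → D f ≐ D g → f ≐ g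
D-ext f0≡g0 Df≡Dg zero    = f0≡g0
D-ext f0≡g0 Df≡Dg (suc n) = suc-cancel n (Df≡Dg n)

D-powS : ∀ g k → D (powS g (suc k)) ≐ scaleS (ℕ→ℚ (suc k)) (mulS (D g) (powS g k))
D-powS g zero n = begin
  D (mulS g oneS) n                            ≡⟨ D-mulS g oneS n ⟩
  mulS (D g) oneS n ℚ.+ mulS g (D oneS) n      ≡⟨ cong (mulS (D g) oneS n ℚ.+_) (trans (mulS-comm g (D oneS) n) (mulS-zeroˡ g (λ m → ℚ.*-zeroʳ (ℕ→ℚ (suc m))) n)) ⟩
  mulS (D g) oneS n ℚ.+ 0ℚ                     ≡⟨ ℚ.+-identityʳ _ ⟩
  mulS (D g) oneS n                            ≡⟨ ℚ.*-identityˡ _ ⟨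
  1ℚ ℚ.* mulS (D g) oneS n                     ∎
  where open ≡-Reasoning
D-powS g (suc k) n = begin
  D (mulS g (powS g (suc k))) n
    ≡⟨ D-mulS g (powS g (suc k)) n ⟩
  X ℚ.+ mulS g (D (powS g (suc k))) n
    ≡⟨ cong (X ℚ.+_) (mulS-congʳ g (D-powS g k) n) ⟩
  X ℚ.+ mulS g (scaleS (ℕ→ℚ (suc k)) (mulS (D g) (powS g k))) n
    ≡⟨ cong (X ℚ.+_) (mulS-scaleʳ (ℕ→ℚ (suc k)) g (mulS (D g) (powS g k)) n) ⟩
  X ℚ.+ ℕ→ℚ (suc k) ℚ.* mulS g (mulS (D g) (powS g k)) n
    ≡⟨ cong (λ z → X ℚ.+ ℕ→ℚ (suc k) ℚ.* z) swap ⟩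
  X ℚ.+ ℕ→ℚ (suc k) ℚ.* X
    ≡⟨ solve 2 (λ x s → x :+ s :* x := (con 1ℚ :+ s) :* x) refl X (ℕ→ℚ (suc k)) ⟩
  (1ℚ ℚ.+ ℕ→ℚ (suc k)) ℚ.* X
    ≡⟨ cong (ℚ._* X) (ℕ→ℚ-+ 1 (suc k)) ⟨
  ℕ→ℚ (suc (suc k)) ℚ.* X ∎
  where
  open ≡-Reasoning
  X = mulS (D g) (powS g (suc k)) n
  swap : mulS g (mulS (D g) (powS g k)) n ≡ X
  swap = trans (sym (mulS-assoc g (D g) (powS g k) n))
    (trans (mulS-congˡ (powS g k) (mulS-comm g (D g)) n) (mulS-assoc (D g) g (powS g k) n))

egf-split : ∀ a n → egf a n ≡ ℕ→ℚ (a n) ℚ.* 1/! n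
egf-split a n = /-* (ℤ.+ a n) (n !) {{n !≢0}}

D-egf : ∀ a → D (egf a) ≐ egf (a ∘ suc)
D-egf a n = begin
  ℕ→ℚ (suc n) ℚ.* egf a (suc n)                          ≡⟨ cong (ℕ→ℚ (suc n) ℚ.*_) (egf-split a (suc n)) ⟩
  ℕ→ℚ (suc n) ℚ.* (ℕ→ℚ (a (suc n)) ℚ.* 1/! (suc n))      ≡⟨ solve 3 (λ s x f → s :* (x :* f) := x :* (s :* f)) refl (ℕ→ℚ (suc n)) (ℕ→ℚ (a (suc n))) (1/! (suc n)) ⟩
  ℕ→ℚ (a (suc n)) ℚ.* (ℕ→ℚ (suc n) ℚ.* 1/! (suc n))      ≡⟨ cong (ℕ→ℚ (a (suc n)) ℚ.*_) (suc*1/! n) ⟩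
  ℕ→ℚ (a (suc n)) ℚ.* 1/! n                              ≡⟨ egf-split (a ∘ suc) n ⟨
  egf (a ∘ suc) n                                        ∎
  where open ≡-Reasoning

egf-+ : ∀ a b n → egf (λ n → a n + b n) n ≡ egf a n ℚ.+ egf b n
egf-+ a b n = trans (egf-split (λ n → a n + b n) n) (trans (cong (ℚ._* 1/! n) (ℕ→ℚ-+ (a n) (b n)))
  (trans (ℚ.*-distribʳ-+ (1/! n) (ℕ→ℚ (a n)) (ℕ→ℚ (b n))) (sym (cong₂ ℚ._+_ (egf-split a n) (egf-split b n)))))

-- Differentiation turns the choice of a side for the least element into the Leibniz rule.
egf-splitCount : ∀ a b → egf (splitCount (λ i j → a i * b j)) ≐ mulS (egf a) (egf b)
egf-splitCount a b zero = begin
  egf (splitCount (λ i j → a i * b j)) 0            ≡⟨ egf-split (splitCount (λ i j → a i * b j)) 0 ⟩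
  ℕ→ℚ (a 0 * b 0) ℚ.* 1ℚ                            ≡⟨ cong (ℚ._* 1ℚ) (ℕ→ℚ-* (a 0) (b 0)) ⟩
  (ℕ→ℚ (a 0) ℚ.* ℕ→ℚ (b 0)) ℚ.* 1ℚ                  ≡⟨ solve 2 (λ x y → (x :* y) :* con 1ℚ := (x :* con 1ℚ) :* (y :* con 1ℚ)) refl (ℕ→ℚ (a 0)) (ℕ→ℚ (b 0)) ⟩
  (ℕ→ℚ (a 0) ℚ.* 1ℚ) ℚ.* (ℕ→ℚ (b 0) ℚ.* 1ℚ)         ≡⟨ cong₂ ℚ._*_ (egf-split a 0) (egf-split b 0) ⟨
  egf a 0 ℚ.* egf b 0                               ≡⟨ mulS-0 (egf a) (egf b) ⟨
  mulS (egf a) (egf b) 0                            ∎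
  where open ≡-Reasoning
egf-splitCount a b (suc n) = suc-cancel n (begin
  D (egf (splitCount (λ i j → a i * b j))) n
    ≡⟨ D-egf (splitCount (λ i j → a i * b j)) n ⟩
  egf (splitCount (λ i j → a i * b j) ∘ suc) n
    ≡⟨ egf-+ (splitCount (λ i j → a (suc i) * b j)) (splitCount (λ i j → a i * b (suc j))) n ⟩
  egf (splitCount (λ i j → a (suc i) * b j)) n ℚ.+ egf (splitCount (λ i j → a i * b (suc j))) n
    ≡⟨ cong₂ ℚ._+_ (egf-splitCount (a ∘ suc) b n) (egf-splitCount a (b ∘ suc) n) ⟩
  mulS (egf (a ∘ suc)) (egf b) n ℚ.+ mulS (egf a) (egf (b ∘ suc)) n
    ≡⟨ cong₂ ℚ._+_ (mulS-congˡ (egf b) (D-egf a) n) (mulS-congʳ (egf a) (D-egf b) n) ⟨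
  mulS (D (egf a)) (egf b) n ℚ.+ mulS (egf a) (D (egf b)) n
    ≡⟨ D-mulS (egf a) (egf b) n ⟨
  D (mulS (egf a) (egf b)) n ∎)
  where open ≡-Reasoning

powS-suc-0 : ∀ g → g 0 ≡ 0ℚ → ∀ k → powS g (suc k) 0 ≡ 0ℚ
powS-suc-0 g g0≡0 k = trans (mulS-0 g (powS g k)) (trans (cong (ℚ._* powS g k 0) g0≡0) (ℚ.*-zeroˡ (powS g k 0)))

egf-0 : ∀ a n → a n ≡ 0 → egf a n ≡ 0ℚ
egf-0 a n an≡0 = trans (egf-split a n) (trans (cong (λ z → ℕ→ℚ z ℚ.* 1/! n) an≡0) (ℚ.*-zeroˡ (1/! n)))

-- Both sides have derivative O′ times the case `k`; on the right the factor k + 1 of the power rule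
-- turns 1/(k + 1)! into 1/k!. The constant terms vanish, as there are no nonempty assemblies on the
-- empty set and `o 0` is 0.
egf-asmCount : ∀ o → o 0 ≡ 0 → ∀ k → egf (asmCount o k) ≐ scaleS (1/! k) (powS (egf o) k)
egf-asmCount o o0≡0 zero zero    = refl
egf-asmCount o o0≡0 zero (suc n) = trans (egf-0 (asmCount o 0) (suc n) refl) (sym (ℚ.*-zeroʳ 1ℚ))
egf-asmCount o o0≡0 (suc k) = D-ext
  (trans (egf-0 (asmCount o (suc k)) 0 refl)
    (sym (trans (cong (1/! (suc k) ℚ.*_) (powS-suc-0 (egf o) (egf-0 o 0 o0≡0) k)) (ℚ.*-zeroʳ (1/! (suc k))))))
  λ n → begin
    D (egf (asmCount o (suc k))) n
      ≡⟨ D-egf (asmCount o (suc k)) n ⟩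
    egf (splitCount (λ i j → o (suc i) * asmCount o k j)) n
      ≡⟨ egf-splitCount (o ∘ suc) (asmCount o k) n ⟩
    mulS (egf (o ∘ suc)) (egf (asmCount o k)) n
      ≡⟨ mulS-congʳ (egf (o ∘ suc)) (egf-asmCount o o0≡0 k) n ⟩
    mulS (egf (o ∘ suc)) (scaleS (1/! k) (powS (egf o) k)) n
      ≡⟨ mulS-scaleʳ (1/! k) (egf (o ∘ suc)) (powS (egf o) k) n ⟩
    1/! k ℚ.* mulS (egf (o ∘ suc)) (powS (egf o) k) n
      ≡⟨ cong (1/! k ℚ.*_) (mulS-congˡ (powS (egf o) k) (D-egf o) n) ⟨
    1/! k ℚ.* mulS (D (egf o)) (powS (egf o) k) n
      ≡⟨ cong (ℚ._* mulS (D (egf o)) (powS (egf o) k) n) (suc*1/! k) ⟨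
    (ℕ→ℚ (suc k) ℚ.* 1/! (suc k)) ℚ.* mulS (D (egf o)) (powS (egf o) k) n
      ≡⟨ solve 3 (λ s f x → (s :* f) :* x := f :* (s :* x)) refl (ℕ→ℚ (suc k)) (1/! (suc k)) (mulS (D (egf o)) (powS (egf o) k) n) ⟩
    1/! (suc k) ℚ.* (ℕ→ℚ (suc k) ℚ.* mulS (D (egf o)) (powS (egf o) k) n)
      ≡⟨ cong (1/! (suc k) ℚ.*_) (D-powS (egf o) k n) ⟨
    1/! (suc k) ℚ.* (ℕ→ℚ (suc n) ℚ.* powS (egf o) (suc k) (suc n))
      ≡⟨ solve 3 (λ f s x → f :* (s :* x) := s :* (f :* x)) refl (1/! (suc k)) (ℕ→ℚ (suc n)) (powS (egf o) (suc k) (suc n)) ⟩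
    D (scaleS (1/! (suc k)) (powS (egf o) (suc k))) n ∎
  where open ≡-Reasoning

riordan-count : ∀ m o → o 0 ≡ 0 → ∀ n k →
                ℕ→ℚ (splitCount (λ i j → m i * asmCount o k j) n) ≡ riordan (egf m) (egf o) n k
riordan-count m o o0≡0 n k = begin
  ℕ→ℚ c                                      ≡⟨ ℚ.*-identityʳ (ℕ→ℚ c) ⟨
  ℕ→ℚ c ℚ.* 1ℚ                               ≡⟨ cong (ℕ→ℚ c ℚ.*_) (!*1/! n) ⟨
  ℕ→ℚ c ℚ.* (ℕ→ℚ (n !) ℚ.* 1/! n)            ≡⟨ solve 3 (λ c g f → c :* (g :* f) := g :* (c :* f)) refl (ℕ→ℚ c) (ℕ→ℚ (n !)) (1/! n) ⟩
  ℕ→ℚ (n !) ℚ.* (ℕ→ℚ c ℚ.* 1/! n)            ≡⟨ cong (ℕ→ℚ (n !) ℚ.*_) coefficient ⟩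
  ℕ→ℚ (n !) ℚ.* (1/! k ℚ.* X)                ≡⟨ solve 3 (λ g f x → g :* (f :* x) := (g :* x) :* f) refl (ℕ→ℚ (n !)) (1/! k) X ⟩
  (ℕ→ℚ (n !) ℚ.* X) ℚ.* 1/! k                ∎
  where
  open ≡-Reasoning
  c = splitCount (λ i j → m i * asmCount o k j) n
  X = mulS (egf m) (powS (egf o) k) n
  coefficient : ℕ→ℚ c ℚ.* 1/! n ≡ 1/! k ℚ.* X
  coefficient = trans (sym (egf-split (splitCount (λ i j → m i * asmCount o k j)) n)) (trans (egf-splitCount m (asmCount o k) n)
    (trans (mulS-congʳ (egf m) (egf-asmCount o o0≡0 k) n) (mulS-scaleʳ (1/! k) (egf m) (powS (egf o) k) n)))

-- Composition of series

*-zero₁ : ∀ {p} q → p ≡ 0ℚ → p ℚ.* q ≡ 0ℚ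
*-zero₁ q refl = ℚ.*-zeroˡ q

*-zero₂ : ∀ p {q} → q ≡ 0ℚ → p ℚ.* q ≡ 0ℚ
*-zero₂ p refl = ℚ.*-zeroʳ p

∑-≡0 : ∀ n {f : ℕ → ℚ} → (∀ {i} → i < n → f i ≡ 0ℚ) → ∑ (upTo n) f ≡ 0ℚ
∑-≡0 n f≡0 = trans (∑-cong∈ (upTo n) λ i∈ → f≡0 (∈-upTo⁻ i∈)) (∑-zero (upTo n))

powS-vanish : ∀ h → h 0 ≡ 0ℚ → ∀ {k n} → n < k → powS h k n ≡ 0ℚ
powS-vanish h h0≡0 {suc k} {zero} _ = powS-suc-0 h h0≡0 k
powS-vanish h h0≡0 {suc k} {suc n} (s≤s n<k) = trans (mulS-suc h (powS h k) n)
  (cong₂ ℚ._+_ (*-zero₁ (powS h k (suc n)) h0≡0)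
    (∑-≡0 (suc n) λ {i} _ → *-zero₂ (h (suc i)) (powS-vanish h h0≡0 (≤-<-trans (m∸n≤m n i) n<k))))

-- The factor `h 0` annihilates coefficient `n` of the other series. This gain of one degree drives
-- the recursions below.
mulS-cong< : ∀ h → h 0 ≡ 0ℚ → ∀ {f g} n → (∀ {i} → i < n → f i ≡ g i) → mulS h f n ≡ mulS h g n
mulS-cong< h h0≡0 {f} {g} zero _ =
  trans (trans (mulS-0 h f) (*-zero₁ (f 0) h0≡0)) (sym (trans (mulS-0 h g) (*-zero₁ (g 0) h0≡0)))
mulS-cong< h h0≡0 {f} {g} (suc n) f≡g = trans (mulS-suc h f n) (trans
  (cong₂ ℚ._+_ (trans (*-zero₁ (f (suc n)) h0≡0) (sym (*-zero₁ (g (suc n)) h0≡0)))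
    (mulS-cong≤ {tailS h} {tailS h} {f} {g} n (λ _ _ → refl) (λ i i≤n → f≡g (s≤s i≤n))))
  (sym (mulS-suc h g n)))

∑-extend : ∀ {p n} {f : ℕ → ℚ} → p ≤ n → (∀ {i} → p ≤ i → f i ≡ 0ℚ) → ∑ (upTo p) f ≡ ∑ (upTo n) f
∑-extend {p} {zero}  z≤n f≡0 = refl
∑-extend {p} {suc n} {f} p≤1+n f≡0 with p ≟ suc n
... | yes refl = refl
... | no p≢    = trans (∑-extend p≤n f≡0) (sym (trans (∑-upTo-last n f)
                   (trans (cong (∑ (upTo n) f ℚ.+_) (f≡0 p≤n)) (ℚ.+-identityʳ (∑ (upTo n) f)))))
  where p≤n = s≤s⁻¹ (≤∧≢⇒< p≤1+n p≢)

module _ {h : Series} (h0≡0 : h 0 ≡ 0ℚ) where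

  -- The sum defining a coefficient of the composite stops at its own index. A common upper bound
  -- for all indices up to `n` allows sums to be exchanged.
  compose-extend : ∀ a {p n} → p ≤ n → compose a h p ≡ ∑ (upTo (suc n)) (λ k → a k ℚ.* powS h k p)
  compose-extend a p≤n = ∑-extend (s≤s p≤n) λ {i} p<i → *-zero₂ (a i) (powS-vanish h h0≡0 p<i)

  -- The fundamental theorem of Riordan arrays before factorials are inserted: the array of (f, h)
  -- applied to the column `a` gives f · (a ∘ h).
  mulS-compose : ∀ f a n → ∑ (upTo (suc n)) (λ k → a k ℚ.* mulS f (powS h k) n) ≡ mulS f (compose a h) n
  mulS-compose f a n = begin
    ∑ (upTo (suc n)) (λ k → a k ℚ.* mulS f (powS h k) n)
      ≡⟨ ∑-cong (upTo (suc n)) (λ k → sym (∑-*ˡ (upTo (suc n)) (a k) (λ i → f i ℚ.* powS h k (n ∸ i)))) ⟩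
    ∑ (upTo (suc n)) (λ k → ∑ (upTo (suc n)) λ i → a k ℚ.* (f i ℚ.* powS h k (n ∸ i)))
      ≡⟨ ∑-swap (upTo (suc n)) (upTo (suc n)) (λ k i → a k ℚ.* (f i ℚ.* powS h k (n ∸ i))) ⟩
    ∑ (upTo (suc n)) (λ i → ∑ (upTo (suc n)) λ k → a k ℚ.* (f i ℚ.* powS h k (n ∸ i)))
      ≡⟨ ∑-cong (upTo (suc n)) (λ i → trans (∑-cong (upTo (suc n)) λ k →
           solve 3 (λ x y z → x :* (y :* z) := y :* (x :* z)) refl (a k) (f i) (powS h k (n ∸ i)))
           (∑-*ˡ (upTo (suc n)) (f i) (λ k → a k ℚ.* powS h k (n ∸ i)))) ⟩
    ∑ (upTo (suc n)) (λ i → f i ℚ.* ∑ (upTo (suc n)) λ k → a k ℚ.* powS h k (n ∸ i))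
      ≡⟨ ∑-cong (upTo (suc n)) (λ i → cong (f i ℚ.*_) (compose-extend a (m∸n≤m n i))) ⟨
    mulS f (compose a h) n ∎
    where open ≡-Reasoning

  -- Horner's rule for a power series.
  compose-unfold : ∀ a → compose a h ≐ addS (scaleS (a 0) oneS) (mulS h (compose (tailS a) h))
  compose-unfold a zero = cong (a 0 ℚ.* 1ℚ ℚ.+_) (sym (trans (mulS-0 h (compose (tailS a) h)) (*-zero₁ (compose (tailS a) h 0) h0≡0)))
  compose-unfold a (suc n) = trans (∑-upTo-suc (suc n) (λ k → a k ℚ.* powS h k (suc n))) (cong (a 0 ℚ.* 0ℚ ℚ.+_) (begin
    ∑ (upTo (suc n)) (λ k → a (suc k) ℚ.* mulS h (powS h k) (suc n))
      ≡⟨ ∑-cong (upTo (suc n)) (λ k → cong (a (suc k) ℚ.*_) (drop-head (powS h k))) ⟩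
    ∑ (upTo (suc n)) (λ k → a (suc k) ℚ.* mulS (tailS h) (powS h k) n)
      ≡⟨ mulS-compose (tailS h) (tailS a) n ⟩
    mulS (tailS h) (compose (tailS a) h) n
      ≡⟨ drop-head (compose (tailS a) h) ⟨
    mulS h (compose (tailS a) h) (suc n) ∎))
    where
    open ≡-Reasoning
    drop-head : ∀ f → mulS h f (suc n) ≡ mulS (tailS h) f n
    drop-head f = trans (mulS-suc h f n) (trans (cong (ℚ._+ mulS (tailS h) f n) (*-zero₁ (f (suc n)) h0≡0)) (ℚ.+-identityˡ (mulS (tailS h) f n)))

  compose-cong : ∀ {a b} → a ≐ b → compose a h ≐ compose b h
  compose-cong a≡b n = ∑-cong (upTo (suc n)) λ k → cong (ℚ._* powS h k n) (a≡b k)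

  compose-linear : ∀ c a b n → compose (addS (scaleS c a) b) h n ≡ c ℚ.* compose a h n ℚ.+ compose b h n
  compose-linear c a b n = trans (∑-cong (upTo (suc n)) λ k →
      solve 4 (λ c x y z → (c :* x :+ y) :* z := c :* (x :* z) :+ y :* z) refl c (a k) (b k) (powS h k n))
    (trans (∑-⊕ (upTo (suc n)) (λ k → c ℚ.* (a k ℚ.* powS h k n)) (λ k → b k ℚ.* powS h k n))
      (cong (ℚ._+ compose b h n) (∑-*ˡ (upTo (suc n)) c (λ k → a k ℚ.* powS h k n))))

  -- Both sides satisfy X(a) = a₀ (b ∘ h) + h X(tail a), which determines the coefficients recursively as h(0) = 0.
  compose-mulS : ∀ a b → compose (mulS a b) h ≐ mulS (compose a h) (compose b h)
  compose-mulS a b n = agree (suc n) a n ≤-refl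
    where
    open ≡-Reasoning
    -- `N` bounds the coefficient index, which drops with each factor `h`; `a` must vary because the
    -- recursion passes to its tail.
    agree : ∀ N a n → n < N → compose (mulS a b) h n ≡ mulS (compose a h) (compose b h) n
    agree (suc N) a n (s≤s n≤N) = begin
      compose (mulS a b) h n
        ≡⟨ compose-unfold (mulS a b) n ⟩
      mulS a b 0 ℚ.* oneS n ℚ.+ mulS h (compose (tailS (mulS a b)) h) n
        ≡⟨ cong₂ (λ x y → x ℚ.* oneS n ℚ.+ y) (mulS-0 a b) (mulS-congʳ h (λ m → trans (compose-cong (mulS-suc a b) m)
             (compose-linear (a 0) (tailS b) (mulS (tailS a) b) m)) n) ⟩
      (a 0 ℚ.* b 0) ℚ.* oneS n ℚ.+ mulS h (addS (scaleS (a 0) (compose (tailS b) h)) (compose (mulS (tailS a) b) h)) n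
        ≡⟨ cong ((a 0 ℚ.* b 0) ℚ.* oneS n ℚ.+_) (mulS-linearʳ (a 0) h (compose (tailS b) h) (compose (mulS (tailS a) b) h) n) ⟩
      (a 0 ℚ.* b 0) ℚ.* oneS n ℚ.+ (a 0 ℚ.* mulS h (compose (tailS b) h) n ℚ.+ mulS h (compose (mulS (tailS a) b) h) n)
        ≡⟨ solve 5 (λ x y z u v → (x :* y) :* z :+ (x :* u :+ v) := x :* (y :* z :+ u) :+ v) refl
             (a 0) (b 0) (oneS n) (mulS h (compose (tailS b) h) n) (mulS h (compose (mulS (tailS a) b) h) n) ⟩
      a 0 ℚ.* (b 0 ℚ.* oneS n ℚ.+ mulS h (compose (tailS b) h) n) ℚ.+ mulS h (compose (mulS (tailS a) b) h) n
        ≡⟨ cong₂ (λ x y → a 0 ℚ.* x ℚ.+ y) (sym (compose-unfold b n))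
             (mulS-cong< h h0≡0 n λ {i} i<n → agree N (tailS a) i (<-≤-trans i<n n≤N)) ⟩
      a 0 ℚ.* compose b h n ℚ.+ mulS h (mulS (compose (tailS a) h) (compose b h)) n
        ≡⟨ cong₂ (λ x y → a 0 ℚ.* x ℚ.+ y) (mulS-oneˡ (compose b h) n) (mulS-assoc h (compose (tailS a) h) (compose b h) n) ⟨
      a 0 ℚ.* mulS oneS (compose b h) n ℚ.+ mulS (mulS h (compose (tailS a) h)) (compose b h) n
        ≡⟨ cong (ℚ._+ mulS (mulS h (compose (tailS a) h)) (compose b h) n) (mulS-scaleˡ (a 0) oneS (compose b h) n) ⟨
      mulS (scaleS (a 0) oneS) (compose b h) n ℚ.+ mulS (mulS h (compose (tailS a) h)) (compose b h) n
        ≡⟨ mulS-addˡ (scaleS (a 0) oneS) (mulS h (compose (tailS a) h)) (compose b h) n ⟨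
      mulS (addS (scaleS (a 0) oneS) (mulS h (compose (tailS a) h))) (compose b h) n
        ≡⟨ mulS-congˡ (compose b h) (compose-unfold a) n ⟨
      mulS (compose a h) (compose b h) n ∎
      where
      mulS-linearʳ : ∀ c f g g′ n → mulS f (addS (scaleS c g) g′) n ≡ c ℚ.* mulS f g n ℚ.+ mulS f g′ n
      mulS-linearʳ c f g g′ n = trans (mulS-comm f (addS (scaleS c g) g′) n) (trans (mulS-addˡ (scaleS c g) g′ f n)
        (cong₂ ℚ._+_ (trans (mulS-scaleˡ c g f n) (cong (c ℚ.*_) (mulS-comm g f n))) (mulS-comm g′ f n)))

  compose-oneS : compose oneS h ≐ oneS
  compose-oneS n = trans (compose-unfold oneS n) (trans (cong₂ ℚ._+_ (ℚ.*-identityˡ (oneS n))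
      (trans (mulS-comm h (compose (tailS oneS) h) n) (mulS-zeroˡ h (λ m → ∑-≡0 (suc m) λ {i} _ → ℚ.*-zeroˡ (powS h i m)) n)))
    (ℚ.+-identityʳ (oneS n)))

  compose-powS : ∀ g k → compose (powS g k) h ≐ powS (compose g h) k
  compose-powS g zero    = compose-oneS
  compose-powS g (suc k) n = trans (compose-mulS g (powS g k) n) (mulS-congʳ (compose g h) (compose-powS g k) n)

-- Inverse series

lookupL-++ˡ : ∀ {A : Set} (d : A) xs ys {i} → i < List.length xs → lookupL d (xs ++ ys) i ≡ lookupL d xs i
lookupL-++ˡ d (x ∷ xs) ys {zero}  _   = refl
lookupL-++ˡ d (x ∷ xs) ys {suc i} i<n = lookupL-++ˡ d xs ys (s<s⁻¹ i<n)

lookupL-last : ∀ {A : Set} (d : A) xs y → lookupL d (xs ++ y ∷ []) (List.length xs) ≡ y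
lookupL-last d []       y = refl
lookupL-last d (x ∷ xs) y = lookupL-last d xs y

length-snoc : ∀ {A : Set} (xs : List A) y → List.length (xs ++ y ∷ []) ≡ suc (List.length xs)
length-snoc xs y = trans (List.length-++ xs) (+-comm (List.length xs) 1)

-- Truncations L n = (h 0 … h n), each extending the previous one, agree with their diagonal.
module _ (L : ℕ → List ℚ) (len : ∀ n → List.length (L n) ≡ suc n)
         (next : ℕ → ℚ) (extends : ∀ n → L (suc n) ≡ L n ++ next n ∷ []) where

  diagonal-stable : ∀ {i n} → i ≤ n → lookupL 0ℚ (L n) i ≡ lookupL 0ℚ (L i) i
  diagonal-stable {i} {zero} z≤n = refl
  diagonal-stable {i} {suc n} i≤1+n with i ≟ suc n
  ... | yes refl = refl
  ... | no i≢ = trans (cong (λ l → lookupL 0ℚ l i) (extends n))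
                  (trans (lookupL-++ˡ 0ℚ (L n) (next n ∷ []) (subst (i <_) (sym (len n)) (≤∧≢⇒< i≤1+n i≢)))
                         (diagonal-stable (s≤s⁻¹ (≤∧≢⇒< i≤1+n i≢))))

  diagonal-next : ∀ n → lookupL 0ℚ (L (suc n)) (suc n) ≡ next n
  diagonal-next n = trans (cong₂ (lookupL 0ℚ) (extends n) (sym (len n))) (lookupL-last 0ℚ (L n) (next n))

recipList-length : ∀ a n → List.length (recipList a n) ≡ suc n
recipList-length a zero    = refl
recipList-length a (suc n) = trans (length-snoc (recipList a n) _) (cong suc (recipList-length a n))

-- Each new coefficient is by definition minus the sum `X` of the other terms, divided by `a 0` = 1.
-- What remains is to replace truncated coefficients by those of `recip a`.
mulS-recip : ∀ a → a 0 ≡ 1ℚ → mulS a (recip a) ≐ oneS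
mulS-recip a a0≡1 zero = trans (mulS-0 a (recip a)) (cong₂ ℚ._*_ a0≡1 (cong invℚ a0≡1))
mulS-recip a a0≡1 (suc n) = begin
  mulS a (recip a) (suc n)
    ≡⟨ mulS-suc a (recip a) n ⟩
  a 0 ℚ.* recip a (suc n) ℚ.+ X
    ≡⟨ cong₂ (λ x y → x ℚ.* y ℚ.+ X) a0≡1 (diagonal-next (recipList a) (recipList-length a) next (λ _ → refl) n) ⟩
  1ℚ ℚ.* next n ℚ.+ X
    ≡⟨ cong₂ (λ x y → 1ℚ ℚ.* (ℚ.- (x ℚ.* y)) ℚ.+ X) (cong invℚ a0≡1)
         (∑-cong (upTo (suc n)) λ i → cong (a (suc i) ℚ.*_) (diagonal-stable (recipList a) (recipList-length a) next (λ _ → refl) (m∸n≤m n i))) ⟩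
  1ℚ ℚ.* (ℚ.- (1ℚ ℚ.* X)) ℚ.+ X
    ≡⟨ solve 1 (λ x → con 1ℚ :* (:- (con 1ℚ :* x)) :+ x := con 0ℚ) refl X ⟩
  0ℚ ∎
  where
  open ≡-Reasoning
  X = mulS (tailS a) (recip a) n
  next : ℕ → ℚ
  next n = ℚ.- (invℚ (a 0) ℚ.* sumℚ (List.map (λ i → a (suc i) ℚ.* lookupL 0ℚ (recipList a n) (n ∸ i)) (upTo (suc n))))

compInvList-length : ∀ g n → List.length (compInvList g n) ≡ suc n
compInvList-length g zero          = refl
compInvList-length g (suc zero)    = refl
compInvList-length g (suc (suc n)) = trans (length-snoc (compInvList g (suc n)) _) (cong suc (compInvList-length g (suc n)))

compInvNext : Series → ℕ → ℚ
compInvNext g zero    = invℚ (g 1)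
compInvNext g (suc n) = ℚ.- (invℚ (g 1) ℚ.*
  sumℚ (List.map (λ i → g (2 + i) ℚ.* powS (fromL (compInvList g (suc n))) (2 + i) (suc (suc n))) (upTo (suc n))))

compInvList-step : ∀ g n → compInvList g (suc n) ≡ compInvList g n ++ compInvNext g n ∷ []
compInvList-step g zero    = refl
compInvList-step g (suc n) = refl

powS-cong≤ : ∀ {f g} k n → (∀ i → i ≤ n → f i ≡ g i) → powS f k n ≡ powS g k n
powS-cong≤ zero n f≡g = refl
powS-cong≤ {f} {g} (suc k) n f≡g = mulS-cong≤ {f} {g} {powS f k} {powS g k} n f≡g λ i i≤n →
  powS-cong≤ k i λ j j≤i → f≡g j (≤-trans j≤i i≤n)

-- In a product of two or more series without constant term, a coefficient of degree n + 1 in one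
-- factor meets a zero. Hence the truncation used in `compInvStep` already has the correct higher
-- powers.
powS-cong< : ∀ {f g} → f 0 ≡ 0ℚ → g 0 ≡ 0ℚ → ∀ k n → (∀ i → i ≤ n → f i ≡ g i) →
             powS f (2 + k) (suc n) ≡ powS g (2 + k) (suc n)
powS-cong< {f} {g} f0≡0 g0≡0 k n f≡g = begin
  mulS f (powS f (suc k)) (suc n)
    ≡⟨ mulS-cong< f f0≡0 (suc n) (λ {i} i<1+n → powS-cong≤ (suc k) i λ j j≤i → f≡g j (≤-trans j≤i (s≤s⁻¹ i<1+n))) ⟩
  mulS f (powS g (suc k)) (suc n)
    ≡⟨ mulS-comm f (powS g (suc k)) (suc n) ⟩
  mulS (powS g (suc k)) f (suc n)
    ≡⟨ mulS-cong< (powS g (suc k)) (powS-suc-0 g g0≡0 k) (suc n) (λ {i} i<1+n → f≡g i (s≤s⁻¹ i<1+n)) ⟩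
  mulS (powS g (suc k)) g (suc n)
    ≡⟨ mulS-comm (powS g (suc k)) g (suc n) ⟩
  mulS g (powS g (suc k)) (suc n) ∎
  where open ≡-Reasoning

xS : Series
xS zero    = 0ℚ
xS (suc n) = oneS n

compose-compInv : ∀ g → g 0 ≡ 0ℚ → g 1 ≡ 1ℚ → compose g (compInv g) ≐ xS
compose-compInv g g0≡0 g1≡1 zero = trans (ℚ.+-identityʳ (g 0 ℚ.* 1ℚ)) (*-zero₁ 1ℚ g0≡0)
compose-compInv g g0≡0 g1≡1 (suc zero) =
  cong₂ ℚ._+_ (*-zero₁ 0ℚ g0≡0) (trans (ℚ.+-identityʳ (g 1 ℚ.* powS (compInv g) 1 1))
    (cong₂ ℚ._*_ g1≡1 (trans (mulS-oneʳ (compInv g) 1) (cong invℚ g1≡1))))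
compose-compInv g g0≡0 g1≡1 (suc (suc n)) = begin
  compose g h (2 + n)
    ≡⟨ trans (∑-upTo-suc (2 + n) term) (cong (term 0 ℚ.+_) (∑-upTo-suc (suc n) (term ∘ suc))) ⟩
  term 0 ℚ.+ (g 1 ℚ.* powS h 1 (2 + n) ℚ.+ X)
    ≡⟨ cong₂ (λ x y → x ℚ.+ (y ℚ.+ X)) (*-zero₁ 0ℚ g0≡0) (cong₂ ℚ._*_ g1≡1 (trans (mulS-oneʳ h (2 + n))
         (diagonal-next (compInvList g) (compInvList-length g) (compInvNext g) (compInvList-step g) (suc n)))) ⟩
  0ℚ ℚ.+ (1ℚ ℚ.* compInvNext g (suc n) ℚ.+ X)
    ≡⟨ cong₂ (λ x y → 0ℚ ℚ.+ (1ℚ ℚ.* (ℚ.- (x ℚ.* y)) ℚ.+ X)) (cong invℚ g1≡1)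
         -- Only the linear term contains the new coefficient of `h`; the powers from the second on
         -- see the truncated list alone.
         (∑-cong (upTo (suc n)) λ i → cong (g (2 + i) ℚ.*_) (powS-cong< (L-stable 0 z≤n) refl i (suc n) L-stable)) ⟩
  0ℚ ℚ.+ (1ℚ ℚ.* (ℚ.- (1ℚ ℚ.* X)) ℚ.+ X)
    ≡⟨ solve 1 (λ x → con 0ℚ :+ (con 1ℚ :* (:- (con 1ℚ :* x)) :+ x) := con 0ℚ) refl X ⟩
  0ℚ ∎
  where
  open ≡-Reasoning
  h = compInv g
  term : ℕ → ℚ
  term k = g k ℚ.* powS h k (2 + n)
  X = ∑ (upTo (suc n)) (λ i → g (2 + i) ℚ.* powS h (2 + i) (2 + n))
  L-stable : ∀ i → i ≤ suc n → fromL (compInvList g (suc n)) i ≡ h i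
  L-stable i i≤ = diagonal-stable (compInvList g) (compInvList-length g) (compInvNext g) (compInvList-step g) i≤

powS-xS : ∀ k n → powS xS k n ≡ (if n ≡ᵇ k then 1ℚ else 0ℚ)
powS-xS zero n = refl
powS-xS (suc k) zero = trans (mulS-0 xS (powS xS k)) (ℚ.*-zeroˡ (powS xS k 0))
powS-xS (suc k) (suc n) = trans (mulS-suc xS (powS xS k) n)
  (trans (cong₂ ℚ._+_ (ℚ.*-zeroˡ (powS xS k (suc n))) (trans (mulS-oneˡ (powS xS k) n) (powS-xS k n))) (ℚ.+-identityˡ _))

powS-cong : ∀ {f g} → f ≐ g → ∀ k → powS f k ≐ powS g k
powS-cong f≡g k n = powS-cong≤ k n λ i _ → f≡g i

δℚ : ℕ → ℕ → ℚ
δℚ n j = if n ≡ᵇ j then 1ℚ else 0ℚ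

riordan-vanish : ∀ F G → G 0 ≡ 0ℚ → ∀ {n k} → n < k → riordan F G n k ≡ 0ℚ
riordan-vanish F G G0≡0 {n} {k} n<k = *-zero₁ (1/! k) (*-zero₂ (ℕ→ℚ (n !))
  (∑-≡0 (suc n) λ {i} _ → *-zero₂ (F i) (powS-vanish G G0≡0 (≤-<-trans (m∸n≤m n i) n<k))))

module _ (F G : Series) (F0≡1 : F 0 ≡ 1ℚ) (G0≡0 : G 0 ≡ 0ℚ) (G1≡1 : G 1 ≡ 1ℚ) where
  private
    H = invPairG F G
    F̄ = invPairF F G

  invPair-column : ∀ j → mulS F̄ (compose (mulS F (powS G j)) H) ≐ powS xS j
  invPair-column j n = begin
    mulS F̄ (compose (mulS F (powS G j)) H) n
      ≡⟨ mulS-congʳ F̄ (compose-mulS refl F (powS G j)) n ⟩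
    mulS F̄ (mulS FH (compose (powS G j) H)) n
      ≡⟨ mulS-assoc F̄ FH (compose (powS G j) H) n ⟨
    mulS (mulS F̄ FH) (compose (powS G j) H) n
      ≡⟨ mulS-congˡ (compose (powS G j) H) (λ m → trans (mulS-comm F̄ FH m) (mulS-recip FH FH0≡1 m)) n ⟩
    mulS oneS (compose (powS G j) H) n
      ≡⟨ mulS-oneˡ (compose (powS G j) H) n ⟩
    compose (powS G j) H n
      ≡⟨ compose-powS refl G j n ⟩
    powS (compose G H) j n
      ≡⟨ powS-cong (compose-compInv G G0≡0 G1≡1) j n ⟩
    powS xS j n ∎
    where
    open ≡-Reasoning
    FH = compose F H
    FH0≡1 : FH 0 ≡ 1ℚ
    FH0≡1 = trans (ℚ.+-identityʳ (F 0 ℚ.* 1ℚ)) (trans (ℚ.*-identityʳ (F 0)) F0≡1)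

  -- The factor 1/k! of a column of the first array cancels k! of a row of the second.
  -- `mulS-compose` then reads the product as one coefficient, that of x^j, and n!/j! is 1 on the
  -- diagonal.
  invPair*pair : ∀ n j → ∑ (upTo (suc n)) (λ k → riordan F̄ H n k ℚ.* riordan F G k j) ≡ δℚ n j
  invPair*pair n j = begin
    ∑ (upTo (suc n)) (λ k → riordan F̄ H n k ℚ.* riordan F G k j)
      ≡⟨ ∑-cong (upTo (suc n)) (λ k → trans
           (solve 6 (λ n! x k! b fk fj → ((n! :* x) :* fk) :* ((k! :* b) :* fj) := (n! :* fj) :* ((k! :* fk) :* (b :* x))) refl
             (ℕ→ℚ (n !)) (mulS F̄ (powS H k) n) (ℕ→ℚ (k !)) (B k) (1/! k) (1/! j))
           (cong ((ℕ→ℚ (n !) ℚ.* 1/! j) ℚ.*_) (trans (cong (ℚ._* (B k ℚ.* mulS F̄ (powS H k) n)) (!*1/! k)) (ℚ.*-identityˡ _)))) ⟩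
    ∑ (upTo (suc n)) (λ k → (ℕ→ℚ (n !) ℚ.* 1/! j) ℚ.* (B k ℚ.* mulS F̄ (powS H k) n))
      ≡⟨ ∑-*ˡ (upTo (suc n)) (ℕ→ℚ (n !) ℚ.* 1/! j) (λ k → B k ℚ.* mulS F̄ (powS H k) n) ⟩
    (ℕ→ℚ (n !) ℚ.* 1/! j) ℚ.* ∑ (upTo (suc n)) (λ k → B k ℚ.* mulS F̄ (powS H k) n)
      ≡⟨ cong ((ℕ→ℚ (n !) ℚ.* 1/! j) ℚ.*_) (trans (mulS-compose refl F̄ B n) (trans (invPair-column j n) (powS-xS j n))) ⟩
    (ℕ→ℚ (n !) ℚ.* 1/! j) ℚ.* δℚ n j
      ≡⟨ diagonal ⟩
    δℚ n j ∎
    where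
    open ≡-Reasoning
    B = mulS F (powS G j)
    diagonal : (ℕ→ℚ (n !) ℚ.* 1/! j) ℚ.* δℚ n j ≡ δℚ n j
    diagonal with n ≡ᵇ j in eq
    ... | false = ℚ.*-zeroʳ (ℕ→ℚ (n !) ℚ.* 1/! j)
    ... | true with ≡ᵇ⇒≡ n j (subst T (sym eq) _)
    ...   | refl = trans (ℚ.*-identityʳ _) (!*1/! n)

δℚ-∑ : ∀ {n j} (f : ℕ → ℚ) → j ≤ n → ∑ (upTo (suc n)) (λ i → f i ℚ.* δℚ i j) ≡ f j
δℚ-∑ {n} {j} f j≤n = trans (∑-cong (upTo (suc n)) pull)
  (∑-point (_≡ᵇ j) f (Unique.upTo⁺ (suc n)) (∈-upTo⁺ (s≤s j≤n)) (≡ᵇ-refl j) λ i eq → ≡ᵇ⇒≡ i j (subst T (sym eq) _))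
  where
  pull : ∀ i → f i ℚ.* δℚ i j ≡ (if i ≡ᵇ j then f i else 0ℚ)
  pull i with i ≡ᵇ j
  ... | true  = ℚ.*-identityʳ (f i)
  ... | false = ℚ.*-zeroʳ (f i)

-- Lower triangular matrices with a left inverse

module _ (c ĉ : ℕ → ℕ → ℚ) (c-lower : ∀ {n k} → n < k → c n k ≡ 0ℚ) (ĉ-lower : ∀ {n k} → n < k → ĉ n k ≡ 0ℚ)
         (ĉ*c : ∀ n j → ∑ (upTo (suc n)) (λ k → ĉ n k ℚ.* c k j) ≡ δℚ n j) where

  ∑-last-column : ∀ (x : ℕ → ℚ) n → ∑ (upTo (suc n)) (λ k → x k ℚ.* c k n) ≡ x n ℚ.* c n n
  ∑-last-column x n = trans (∑-upTo-last n (λ k → x k ℚ.* c k n))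
    (trans (cong (ℚ._+ x n ℚ.* c n n) (∑-≡0 n λ {k} k<n → *-zero₂ (x k) (c-lower k<n))) (ℚ.+-identityˡ _))

  diagonal-unit : ∀ n → c n n ℚ.* ĉ n n ≡ 1ℚ
  diagonal-unit n = trans (ℚ.*-comm (c n n) (ĉ n n)) (trans (sym (∑-last-column (ĉ n) n))
    (trans (ĉ*c n n) (cong (λ b → if b then 1ℚ else 0ℚ) (≡ᵇ-refl n))))

  last-zero : ∀ (x : ℕ → ℚ) n → ∑ (upTo (suc n)) (λ k → x k ℚ.* c k n) ≡ 0ℚ → x n ≡ 0ℚ
  last-zero x n eq = trans (sym (ℚ.*-identityʳ (x n))) (trans (cong (x n ℚ.*_) (sym (diagonal-unit n)))
    (trans (sym (ℚ.*-assoc (x n) (c n n) (ĉ n n))) (*-zero₁ (ĉ n n) (trans (sym (∑-last-column x n)) eq))))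

  row-zero : ∀ (x : ℕ → ℚ) N → (∀ j → j < N → ∑ (upTo N) (λ k → x k ℚ.* c k j) ≡ 0ℚ) → ∀ k → k < N → x k ≡ 0ℚ
  row-zero x (suc N) xc≡0 k k<1+N with k ≟ N
  ... | yes refl = last-zero x N (xc≡0 N ≤-refl)
  ... | no k≢N = row-zero x N shorter k (≤∧≢⇒< (s≤s⁻¹ k<1+N) k≢N)
    where
    shorter : ∀ j → j < N → ∑ (upTo N) (λ k → x k ℚ.* c k j) ≡ 0ℚ
    shorter j j<N = trans (sym (ℚ.+-identityʳ _)) (trans (cong (∑ (upTo N) (λ k → x k ℚ.* c k j) ℚ.+_)
        (sym (*-zero₁ (c N j) (last-zero x N (xc≡0 N ≤-refl)))))
      (trans (sym (∑-upTo-last N (λ k → x k ℚ.* c k j))) (xc≡0 j (m<n⇒m<1+n j<N))))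

  row-cancel : ∀ (x y : ℕ → ℚ) N → (∀ j → j < N → ∑ (upTo N) (λ k → x k ℚ.* c k j) ≡ ∑ (upTo N) (λ k → y k ℚ.* c k j)) →
               ∀ k → k < N → x k ≡ y k
  row-cancel x y N eq k k<N = ℚ-cancel (row-zero (λ k → x k ℚ.+ ℚ.- y k) N difference k k<N)
    where
    open ≡-Reasoning
    ℚ-cancel : ∀ {p q} → p ℚ.+ ℚ.- q ≡ 0ℚ → p ≡ q
    ℚ-cancel {p} {q} p-q≡0 = trans (solve 2 (λ p q → p := (p :+ :- q) :+ q) refl p q) (trans (cong (ℚ._+ q) p-q≡0) (ℚ.+-identityˡ q))
    difference : ∀ j → j < N → ∑ (upTo N) (λ k → (x k ℚ.+ ℚ.- y k) ℚ.* c k j) ≡ 0ℚ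
    difference j j<N = begin
      ∑ (upTo N) (λ k → (x k ℚ.+ ℚ.- y k) ℚ.* c k j)
        ≡⟨ ∑-cong (upTo N) (λ k → solve 3 (λ x y c → (x :+ :- y) :* c := x :* c :+ (:- con 1ℚ) :* (y :* c)) refl (x k) (y k) (c k j)) ⟩
      ∑ (upTo N) (λ k → x k ℚ.* c k j ℚ.+ (ℚ.- 1ℚ) ℚ.* (y k ℚ.* c k j))
        ≡⟨ ∑-⊕ (upTo N) (λ k → x k ℚ.* c k j) (λ k → (ℚ.- 1ℚ) ℚ.* (y k ℚ.* c k j)) ⟩
      ∑ (upTo N) (λ k → x k ℚ.* c k j) ℚ.+ ∑ (upTo N) (λ k → (ℚ.- 1ℚ) ℚ.* (y k ℚ.* c k j))
        ≡⟨ cong₂ ℚ._+_ (eq j j<N) (∑-*ˡ (upTo N) (ℚ.- 1ℚ) (λ k → y k ℚ.* c k j)) ⟩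
      Y ℚ.+ (ℚ.- 1ℚ) ℚ.* Y
        ≡⟨ solve 1 (λ y → y :+ (:- con 1ℚ) :* y := con 0ℚ) refl Y ⟩
      0ℚ ∎
      where Y = ∑ (upTo N) (λ k → y k ℚ.* c k j)

  left-inverse-unique : ∀ (r : ℕ → ℕ → ℚ) → (∀ n j → ∑ (upTo (suc n)) (λ k → r n k ℚ.* c k j) ≡ δℚ n j) →
                        ∀ n k → k ≤ n → ĉ n k ≡ r n k
  left-inverse-unique r r*c n k k≤n = row-cancel (ĉ n) (r n) (suc n) (λ j _ → trans (ĉ*c n j) (sym (r*c n j))) k (s≤s k≤n)

  right-inverse : ∀ n j → j ≤ n → ∑ (upTo (suc n)) (λ i → c n i ℚ.* ĉ i j) ≡ δℚ n j
  right-inverse n j j≤n = row-cancel (λ k → ∑ (upTo (suc n)) (λ i → c n i ℚ.* ĉ i k)) (δℚ n) (suc n)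
    (λ j j<1+n → trans (product j (s≤s⁻¹ j<1+n)) (sym (identity j (s≤s⁻¹ j<1+n)))) j (s≤s j≤n)
    where
    open ≡-Reasoning
    us = upTo (suc n)
    identity : ∀ j → j ≤ n → ∑ us (λ k → δℚ n k ℚ.* c k j) ≡ c n j
    identity j j≤n = trans (∑-cong us λ k → trans (ℚ.*-comm (δℚ n k) (c k j)) (cong (c k j ℚ.*_) (δℚ-sym n k)))
                           (δℚ-∑ (λ k → c k j) ≤-refl)
      where
      δℚ-sym : ∀ m n → δℚ m n ≡ δℚ n m
      δℚ-sym zero zero = refl
      δℚ-sym zero (suc n) = refl
      δℚ-sym (suc m) zero = refl
      δℚ-sym (suc m) (suc n) = δℚ-sym m n
    product : ∀ j → j ≤ n → ∑ us (λ k → ∑ us (λ i → c n i ℚ.* ĉ i k) ℚ.* c k j) ≡ c n j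
    product j j≤n = begin
      ∑ us (λ k → ∑ us (λ i → c n i ℚ.* ĉ i k) ℚ.* c k j)
        ≡⟨ ∑-cong us (λ k → sym (∑-*ʳ us (c k j) (λ i → c n i ℚ.* ĉ i k))) ⟩
      ∑ us (λ k → ∑ us λ i → (c n i ℚ.* ĉ i k) ℚ.* c k j)
        ≡⟨ ∑-swap us us (λ k i → (c n i ℚ.* ĉ i k) ℚ.* c k j) ⟩
      ∑ us (λ i → ∑ us λ k → (c n i ℚ.* ĉ i k) ℚ.* c k j)
        ≡⟨ ∑-cong∈ us (λ {i} i∈ → trans (∑-cong us λ k → ℚ.*-assoc (c n i) (ĉ i k) (c k j))
             (trans (∑-*ˡ us (c n i) (λ k → ĉ i k ℚ.* c k j)) (cong (c n i ℚ.*_)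
               -- Row `i` of `ĉ` is zero beyond column `i`, so the sum may be cut there, where
               -- `ĉ*c i j` evaluates it.
               (trans (sym (∑-extend (∈-upTo⁻ i∈) λ {k} i<k → *-zero₁ (c k j) (ĉ-lower i<k))) (ĉ*c i j))))) ⟩
      ∑ us (λ i → c n i ℚ.* δℚ i j)
        ≡⟨ δℚ-∑ (c n) j≤n ⟩
      c n j ∎

-- From integer to rational matrices

ℤ→ℚ-∑ : ∀ {B : Set} (xs : List B) (f : B → ℤ) → ℤ→ℚ (∑ℤ.∑ xs f) ≡ ∑ xs (ℤ→ℚ ∘ f)
ℤ→ℚ-∑ [] f = refl
ℤ→ℚ-∑ (x ∷ xs) f = trans (ℤ→ℚ-+ (f x) (∑ℤ.∑ xs f)) (cong (ℤ→ℚ (f x) ℚ.+_) (ℤ→ℚ-∑ xs f))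

ℤ→ℚ-∑* : ∀ {B : Set} (xs : List B) (f g : B → ℤ) → ℤ→ℚ (∑ℤ.∑ xs (λ x → f x ℤ.* g x)) ≡ ∑ xs (λ x → ℤ→ℚ (f x) ℚ.* ℤ→ℚ (g x))
ℤ→ℚ-∑* xs f g = trans (ℤ→ℚ-∑ xs (λ x → f x ℤ.* g x)) (∑-cong xs λ x → ℤ→ℚ-* (f x) (g x))

ℤ→ℚ-δ : ∀ n j → ℤ→ℚ (δ n j) ≡ δℚ n j
ℤ→ℚ-δ n j with n ≡ᵇ j
... | true  = refl
... | false = refl

module _ (C Ĉ : ℕ → ℕ → ℤ) (C-lower : ∀ {n k} → n < k → C n k ≡ 0ℤ) (Ĉ-lower : ∀ {n k} → n < k → Ĉ n k ≡ 0ℤ)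
         (Ĉ*C≡δ : ∀ n j → ∑ℤ.∑ (upTo (suc n)) (λ k → Ĉ n k ℤ.* C k j) ≡ δ n j) where
  private
    c ĉ : ℕ → ℕ → ℚ
    c n k = ℤ→ℚ (C n k)
    ĉ n k = ℤ→ℚ (Ĉ n k)

    c-lower : ∀ {n k} → n < k → c n k ≡ 0ℚ
    c-lower n<k = cong ℤ→ℚ (C-lower n<k)

    ĉ-lower : ∀ {n k} → n < k → ĉ n k ≡ 0ℚ
    ĉ-lower n<k = cong ℤ→ℚ (Ĉ-lower n<k)

    ĉ*c : ∀ n j → ∑ (upTo (suc n)) (λ k → ĉ n k ℚ.* c k j) ≡ δℚ n j
    ĉ*c n j = trans (sym (ℤ→ℚ-∑* (upTo (suc n)) (Ĉ n) (λ k → C k j))) (trans (cong ℤ→ℚ (Ĉ*C≡δ n j)) (ℤ→ℚ-δ n j))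

  ℤ-left-inverse-unique : ∀ (r : ℕ → ℕ → ℚ) → (∀ n j → ∑ (upTo (suc n)) (λ k → r n k ℚ.* ℤ→ℚ (C k j)) ≡ δℚ n j) →
                          ∀ n k → k ≤ n → ℤ→ℚ (Ĉ n k) ≡ r n k
  ℤ-left-inverse-unique = left-inverse-unique c ĉ c-lower ĉ-lower ĉ*c

  ℤ-right-inverse : ∀ n j → j ≤ n → sumFromTo j n (λ k → C n k ℤ.* Ĉ k j) ≡ δ n j
  ℤ-right-inverse n j j≤n = begin
    sumFromTo j n (λ k → C n k ℤ.* Ĉ k j)
      -- Terms with k < j vanish because Ĉ is lower triangular, so the sum may start at 0.
      ≡⟨ ∑ℤ.∑-drop j (suc (n ∸ j)) (λ {k} k<j → trans (cong (ℤ._*_ (C n k)) (Ĉ-lower k<j)) (ℤ.*-zeroʳ (C n k))) ⟨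
    ∑ℤ.∑ (upTo (j + suc (n ∸ j))) (λ k → C n k ℤ.* Ĉ k j)
      ≡⟨ cong (λ N → ∑ℤ.∑ (upTo N) (λ k → C n k ℤ.* Ĉ k j)) (trans (+-suc j (n ∸ j)) (cong suc (m+[n∸m]≡n j≤n))) ⟩
    ∑ℤ.∑ (upTo (suc n)) (λ k → C n k ℤ.* Ĉ k j)
      ≡⟨ ℤ→ℚ-injective (trans (ℤ→ℚ-∑* (upTo (suc n)) (C n) (λ k → Ĉ k j))
           (trans (right-inverse c ĉ c-lower ĉ-lower ĉ*c n j j≤n) (sym (ℤ→ℚ-δ n j)))) ⟩
    δ n j ∎
    where open ≡-Reasoning

-- The matrices of a c-monop

singleton↔ : ∀ {A : Set} (x : A) → (∀ y → y ≡ x) → A ↔ Fin 1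
singleton↔ x all≡x = mk↔ₛ′ (λ _ → Fin.zero) (λ _ → x) (λ { Fin.zero → refl ; (Fin.suc ()) }) (λ y → sym (all≡x y))

module _ {Msp Osp : Species} (S : CMonop Msp Osp) (En : ∀ n → FinEnum (PP Msp Osp n))
         (dec : ∀ n (x y : PP Msp Osp n) → Dec (_≤P_ S x y)) where
  open CMonop S
  open Matrices S En dec
  open Species Msp using () renaming (card to cardM; finite to finiteM)
  open Species Osp using () renaming (card to cardO; finite to finiteO)

  cardM-0 : cardM 0 ≡ 1
  cardM-0 = ↔⇒≡ (↔-trans (↔-sym (finiteM 0)) (singleton↔ 𝔢 M∅-unique))

  cardO-0 : cardO 0 ≡ 0
  cardO-0 = ↔⇒≡ (↔-trans (↔-sym (finiteO 0)) (empty↔ O-positive))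

  cardO-1 : cardO 1 ≡ 1
  cardO-1 = ↔⇒≡ (↔-trans (↔-sym (finiteO 1)) (singleton↔ e O1-unique))

  Mx Ox : Series
  Mx = egf cardM
  Ox = egf cardO

  Mx-0 : Mx 0 ≡ 1ℚ
  Mx-0 = trans (egf-split cardM 0) (cong (λ z → ℕ→ℚ z ℚ.* 1ℚ) cardM-0)

  Ox-0 : Ox 0 ≡ 0ℚ
  Ox-0 = egf-0 cardO 0 cardO-0

  Ox-1 : Ox 1 ≡ 1ℚ
  Ox-1 = trans (egf-split cardO 1) (cong (λ z → ℕ→ℚ z ℚ.* 1ℚ) cardO-1)

  Cnk-riordan : ∀ n k → ℤ→ℚ (Cnk n k) ≡ riordan Mx Ox n k
  Cnk-riordan n k = trans (cong ℤ→ℚ (Cnk-count S En dec n k)) (riordan-count cardM cardO cardO-0 n k)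

  Ĉnk-lower : ∀ {n k} → n < k → Ĉnk n k ≡ 0ℤ
  Ĉnk-lower {n} {k} n<k = trans (∑ℤ.∑-filterB (λ x → members x ≡ᵇ k) es μ)
    (trans (∑ℤ.∑-cong es λ x → cong (λ b → if b then μ x else 0ℤ) (≢⇒≡ᵇ-false (<⇒≢ (≤-<-trans (members≤n S x) n<k)))) (∑ℤ.∑-zero es))
    where
    es = FinEnum.elems (En n)
    μ = Möbius.μ₀ (En n) (_≤P_ S) (dec n) (hat0 S n)

  Cnk-lower : ∀ {n k} → n < k → Cnk n k ≡ 0ℤ
  Cnk-lower {n} {k} n<k = ℤ→ℚ-injective (trans (Cnk-riordan n k) (riordan-vanish Mx Ox Ox-0 n<k))

  Ĉnk-riordan : ∀ n k → ℤ→ℚ (Ĉnk n k) ≡ riordan (invPairF Mx Ox) (invPairG Mx Ox) n k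
  Ĉnk-riordan n k with k ≤? n
  ... | yes k≤n = ℤ-left-inverse-unique Cnk Ĉnk Cnk-lower Ĉnk-lower (Ĉ*C S En dec) (riordan (invPairF Mx Ox) (invPairG Mx Ox)) inverse n k k≤n
    where
    inverse : ∀ n j → ∑ (upTo (suc n)) (λ k → riordan (invPairF Mx Ox) (invPairG Mx Ox) n k ℚ.* ℤ→ℚ (Cnk k j)) ≡ δℚ n j
    inverse n j = trans (∑-cong (upTo (suc n)) λ k → cong (riordan (invPairF Mx Ox) (invPairG Mx Ox) n k ℚ.*_) (Cnk-riordan k j))
                        (invPair*pair Mx Ox Mx-0 Ox-0 Ox-1 n j)
  ... | no k≰n = trans (cong ℤ→ℚ (Ĉnk-lower (≰⇒> k≰n)))
                       -- Here k > n and both sides are 0; `refl` is the constant term of the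
                       -- compositional inverse, which is 0 by computation.
                       (sym (riordan-vanish (invPairF Mx Ox) (invPairG Mx Ox) refl (≰⇒> k≰n)))

  C*Ĉ : ∀ n j → j ≤ n → sumFromTo j n (λ k → Cnk n k ℤ.* Ĉnk k j) ≡ δ n j
  C*Ĉ = ℤ-right-inverse Cnk Ĉnk Cnk-lower Ĉnk-lower (Ĉ*C S En dec)

theorem7p2 : (Msp Osp : Species) (S : CMonop Msp Osp)
    (En : ∀ n → FinEnum (PP Msp Osp n))
    (dec : ∀ n (x y : PP Msp Osp n) → Dec (_≤P_ S x y)) →
    (∀ n j → j ≤ n →
    sumFromTo j n (λ k → Matrices.Cnk S En dec n k ℤ.* Matrices.Ĉnk S En dec k j) ≡ δ n j)
    × (∀ n k → ℤ→ℚ (Matrices.Cnk S En dec n k)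
    ≡ riordan (egf (Species.card Msp)) (egf (Species.card Osp)) n k)
    × (∀ n k → ℤ→ℚ (Matrices.Ĉnk S En dec n k)
    ≡ riordan (invPairF (egf (Species.card Msp)) (egf (Species.card Osp)))
    (invPairG (egf (Species.card Msp)) (egf (Species.card Osp))) n k)
theorem7p2 Msp Osp S En dec = C*Ĉ S En dec , Cnk-riordan S En dec , Ĉnk-riordan S En dec
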